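{- Let $n\ge 3$ and let $G$ be a simple graph on $n$ vertices that contains no doubly chorded cycle. Then $\rho(G)\le \tfrac{1}{2}+\sqrt{2n-\tfrac{15}{4}}$, with equality if and only if $G\cong K_{1,1,n-2}$.
   Context: All graphs are finite and simple. $\rho(G)$ denotes the spectral radius of $G$, i.e. the largest eigenvalue of its adjacency matrix. For a cycle $C$ in $G$, a chord of $C$ is an edge of $G$ joining two vertices of $C$ that is not itself an edge of $C$. A doubly chorded cycle is a cycle with at least two chords; $G$ contains a doubly chorded cycle if some cycle of $G$ has at least two chords in $G$. $K_{1,1,n-2}$ is the complete tripartite graph with parts of sizes $1,1,n-2$. -}

module Defs where

open import Algebra.Bundles using (RawMonoid)
import Algebra.Definitions.RawMonoid as RawMonoidDefs
open import Data.Bool.Base using (if_then_else_)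
open import Data.Fin.Base using (Fin; zero; suc; toℕ)
import Data.Fin.Properties as Fin
open import Data.Integer.Base as ℤ using (+_)
import Data.Integer.Properties as ℤ
open import Data.Nat.Base as ℕ using (ℕ; zero; suc; s≤s; z≤n)
open import Data.Nat.Coprimality using (1-coprimeTo) renaming (sym to coprime-sym)
open import Data.Nat.DivMod using (_mod_)
import Data.Nat.Properties as ℕ
open import Data.Product.Base using (Σ; ∃-syntax; _×_; _,_)
open import Data.Rational.Base as ℚ
  using (ℚ; mkℚ; 0ℚ; 1ℚ; ½; _+_; _*_; _-_; -_; ∣_∣; _≤_; _<_; _/_; ↥_; *≤*)
import Data.Rational.Properties as ℚ
open import Data.Rational.Unnormalised.Base using (*≡*)
import Data.Rational.Unnormalised.Properties as ℚᵘ
open import Data.Rational.Solver using (module +-*-Solver)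
open import Data.Sum.Base using (_⊎_; inj₁; inj₂)
open import Data.Vec.Functional using (Vector)
open import Function.Bundles using (_↔_; _⇔_; Inverse)
open import Level using (0ℓ)
open import Relation.Binary.Core using (Rel)
open import Relation.Binary.Definitions using (Decidable; Symmetric; Irreflexive)
open import Relation.Binary.PropositionalEquality
  using (_≡_; _≢_; refl; sym; trans; cong; cong₂; subst; subst₂; ≢-sym)
open import Relation.Nullary.Decidable using (Dec; yes; no; ¬?; does)
open import Relation.Nullary.Negation using (¬_; contradiction)

------------------------------------------------------------------------
-- Real numbers, as Cauchy sequences of rationals carrying a modulus of
-- convergence.  Equality of reals is _≃_, not _≡_.

Eventually : (ℕ → Set) → Set
Eventually P = ∃[ N ] (∀ {n} → N ℕ.≤ n → P n)

IsCauchy : (ℕ → ℚ) → Set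
IsCauchy x = ∀ ε → 0ℚ < ε →
  ∃[ N ] (∀ {m n} → N ℕ.≤ m → N ℕ.≤ n → ∣ x m - x n ∣ ≤ ε)

record ℝ : Set where
  constructor mkℝ
  field
    seq    : ℕ → ℚ
    cauchy : IsCauchy seq

open ℝ public

infix  4 _≃_ _≤ℝ_
infixl 6 _+ℝ_
infixl 7 _*ℝ_

_≃_ : Rel ℝ 0ℓ
x ≃ y = ∀ ε → 0ℚ < ε → Eventually λ n → ∣ seq x n - seq y n ∣ ≤ ε

_≤ℝ_ : Rel ℝ 0ℓ
x ≤ℝ y = ∀ ε → 0ℚ < ε → Eventually λ n → seq x n ≤ seq y n + ε

------------------------------------------------------------------------
-- Rational preliminaries

private
  0<½ : 0ℚ < ½
  0<½ = ℚ.positive⁻¹ ½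

  0≤½ : 0ℚ ≤ ½
  0≤½ = ℚ.<⇒≤ 0<½

  0<1 : 0ℚ < 1ℚ
  0<1 = ℚ.positive⁻¹ 1ℚ

  *-pos : ∀ {p q} → 0ℚ < p → 0ℚ < q → 0ℚ < p * q
  *-pos {p} {q} 0<p 0<q =
    ℚ.positive⁻¹ (p * q) {{ℚ.pos*pos⇒pos p {{ℚ.positive 0<p}} q {{ℚ.positive 0<q}}}}

  *-mono-≤ : ∀ {p q r s} → 0ℚ ≤ r → 0ℚ ≤ q → p ≤ q → r ≤ s → p * r ≤ q * s
  *-mono-≤ {p} {q} {r} {s} 0≤r 0≤q p≤q r≤s = ℚ.≤-trans
    (ℚ.*-monoʳ-≤-nonNeg r {{ℚ.nonNegative 0≤r}} p≤q)
    (ℚ.*-monoˡ-≤-nonNeg q {{ℚ.nonNegative 0≤q}} r≤s)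

  *-nonNeg : ∀ {p q} → 0ℚ ≤ p → 0ℚ ≤ q → 0ℚ ≤ p * q
  *-nonNeg {p} {q} 0≤p 0≤q =
    subst (_≤ p * q) (ℚ.*-zeroˡ 0ℚ) (*-mono-≤ ℚ.≤-refl 0≤p 0≤p 0≤q)

  +-nonNeg : ∀ {p q} → 0ℚ ≤ p → 0ℚ ≤ q → 0ℚ ≤ p + q
  +-nonNeg = ℚ.+-mono-≤

  square-cancel-< : ∀ {p q} → 0ℚ ≤ q → p * p < q * q → p < q
  square-cancel-< {p} {q} 0≤q p²<q² with q ℚ.≤? p
  ... | yes q≤p = contradiction
                    (ℚ.<-≤-trans p²<q² (*-mono-≤ 0≤q (ℚ.≤-trans 0≤q q≤p) q≤p q≤p))
                    (ℚ.<-irrefl refl)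
  ... | no  q≰p = ℚ.≰⇒> q≰p

  half+half : ∀ ε → ½ * ε + ½ * ε ≡ ε
  half+half ε = trans (sym (ℚ.*-distribʳ-+ ε ½ ½)) (ℚ.*-identityˡ ε)

  p-p≡0 : ∀ p → ∣ p - p ∣ ≡ 0ℚ
  p-p≡0 p = cong ∣_∣ (ℚ.+-inverseʳ p)

  ∣∣-≤ : ∀ {p q} → p ≤ q → - p ≤ q → ∣ p ∣ ≤ q
  ∣∣-≤ {p} p≤q -p≤q with ℚ.∣p∣≡p∨∣p∣≡-p p
  ... | inj₁ eq = subst (_≤ _) (sym eq) p≤q
  ... | inj₂ eq = subst (_≤ _) (sym eq) -p≤q

  ≤+⇒-≤ : ∀ {p q r} → p ≤ q + r → p - q ≤ r
  ≤+⇒-≤ {p} {q} {r} h = subst (p - q ≤_)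
    (solve 2 (λ q r → q :+ r :- q := r) refl q r) (ℚ.+-monoˡ-≤ (- q) h)
    where open +-*-Solver

  neg-sub : ∀ p q → - (p - q) ≡ q - p
  neg-sub = solve 2 (λ p q → :- (p :- q) := q :- p) refl
    where open +-*-Solver

  divide : ∀ {ε K} → 0ℚ < ε → 0ℚ < K → ∃[ δ ] (0ℚ < δ × K * δ ≡ ε)
  divide {ε} {K} 0<ε 0<K = K⁻¹ * ε , *-pos (ℚ.positive⁻¹ K⁻¹ {{ℚ.1/pos⇒pos K}}) 0<ε ,
    trans (sym (ℚ.*-assoc K K⁻¹ ε)) (trans (cong (_* ε) (ℚ.*-inverseʳ K)) (ℚ.*-identityˡ ε))
    where
    instance
      K>0 = ℚ.positive 0<K
      K≢0 = ℚ.pos⇒nonZero K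
    K⁻¹ = ℚ.1/ K

------------------------------------------------------------------------
-- Field operations needed on reals, all computed termwise

fromℚ : ℚ → ℝ
fromℚ q = mkℝ (λ _ → q) λ ε 0<ε → 0 , λ _ _ →
  subst (_≤ ε) (sym (p-p≡0 q)) (ℚ.<⇒≤ 0<ε)

0ℝ 1ℝ : ℝ
0ℝ = fromℚ 0ℚ
1ℝ = fromℚ 1ℚ

_+ℝ_ : ℝ → ℝ → ℝ
x +ℝ y = mkℝ (λ n → seq x n + seq y n) +-cauchy
  where
  regroup : ∀ a b c d → (a + b) - (c + d) ≡ (a - c) + (b - d)
  regroup = solve 4 (λ a b c d → (a :+ b) :- (c :+ d) := (a :- c) :+ (b :- d)) refl
    where open +-*-Solver

  +-cauchy : IsCauchy (λ n → seq x n + seq y n)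
  +-cauchy ε 0<ε with cauchy x (½ * ε) (*-pos 0<½ 0<ε) | cauchy y (½ * ε) (*-pos 0<½ 0<ε)
  ... | M , hx | N , hy = M ℕ.⊔ N , λ {m} {n} m≥ n≥ →
    subst₂ _≤_ (cong ∣_∣ (sym (regroup (seq x m) (seq y m) (seq x n) (seq y n)))) (half+half ε)
      (ℚ.≤-trans (ℚ.∣p+q∣≤∣p∣+∣q∣ (seq x m - seq x n) (seq y m - seq y n))
        (ℚ.+-mono-≤ (hx (ℕ.m⊔n≤o⇒m≤o M N m≥) (ℕ.m⊔n≤o⇒m≤o M N n≥))
                    (hy (ℕ.m⊔n≤o⇒n≤o M N m≥) (ℕ.m⊔n≤o⇒n≤o M N n≥))))

private
  eventually-bounded : ∀ x → ∃[ B ] (0ℚ < B × Eventually λ n → ∣ seq x n ∣ ≤ B)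
  eventually-bounded x with cauchy x 1ℚ 0<1
  ... | N , h = 1ℚ + ∣ seq x N ∣ , ℚ.+-mono-<-≤ 0<1 (ℚ.0≤∣p∣ (seq x N)) , N , λ {n} n≥ →
    subst (λ a → ∣ a ∣ ≤ 1ℚ + ∣ seq x N ∣) (cancel (seq x n) (seq x N))
      (ℚ.≤-trans (ℚ.∣p+q∣≤∣p∣+∣q∣ (seq x n - seq x N) (seq x N))
        (ℚ.+-monoˡ-≤ ∣ seq x N ∣ (h n≥ ℕ.≤-refl)))
    where
    cancel : ∀ a b → (a - b) + b ≡ a
    cancel = solve 2 (λ a b → (a :- b) :+ b := a) refl
      where open +-*-Solver

  *-difference : ∀ a b c d → a * b - c * d ≡ a * (b - d) + d * (a - c)
  *-difference = solve 4
    (λ a b c d → a :* b :- c :* d := a :* (b :- d) :+ d :* (a :- c)) refl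
    where open +-*-Solver

  *-difference-≤ : ∀ a b c d {A B α β} → ∣ a ∣ ≤ A → ∣ d ∣ ≤ B → 0ℚ ≤ A → 0ℚ ≤ B →
    ∣ b - d ∣ ≤ α → ∣ a - c ∣ ≤ β → ∣ a * b - c * d ∣ ≤ A * α + B * β
  *-difference-≤ a b c d {A} {B} {α} {β} a≤A d≤B 0≤A 0≤B hα hβ = begin
    ∣ a * b - c * d ∣                      ≡⟨ cong ∣_∣ (*-difference a b c d) ⟩
    ∣ a * (b - d) + d * (a - c) ∣          ≤⟨ ℚ.∣p+q∣≤∣p∣+∣q∣ (a * (b - d)) (d * (a - c)) ⟩
    ∣ a * (b - d) ∣ + ∣ d * (a - c) ∣      ≡⟨ cong₂ _+_ (ℚ.∣p*q∣≡∣p∣*∣q∣ a (b - d))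
                                                        (ℚ.∣p*q∣≡∣p∣*∣q∣ d (a - c)) ⟩
    ∣ a ∣ * ∣ b - d ∣ + ∣ d ∣ * ∣ a - c ∣  ≤⟨ ℚ.+-mono-≤
                                                (*-mono-≤ (ℚ.0≤∣p∣ (b - d)) 0≤A a≤A hα)
                                                (*-mono-≤ (ℚ.0≤∣p∣ (a - c)) 0≤B d≤B hβ) ⟩
    A * α + B * β                          ∎
    where open ℚ.≤-Reasoning

  *-isCauchy : ∀ x y → IsCauchy (λ n → seq x n * seq y n)
  *-isCauchy x y ε 0<ε =
    let A , 0<A , M , x≤A = eventually-bounded x
        B , 0<B , N , y≤B = eventually-bounded y
        α , 0<α , Aα≡ε/2  = divide (*-pos 0<½ 0<ε) 0<A
        β , 0<β , Bβ≡ε/2  = divide (*-pos 0<½ 0<ε) 0<B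
        M′ , hy           = cauchy y α 0<α
        N′ , hx           = cauchy x β 0<β
    in (M ℕ.⊔ N) ℕ.⊔ (M′ ℕ.⊔ N′) , λ {m} {n} m≥ n≥ →
      let m≥₁ = ℕ.m⊔n≤o⇒m≤o (M ℕ.⊔ N) (M′ ℕ.⊔ N′) m≥
          m≥₂ = ℕ.m⊔n≤o⇒n≤o (M ℕ.⊔ N) (M′ ℕ.⊔ N′) m≥
          n≥₁ = ℕ.m⊔n≤o⇒m≤o (M ℕ.⊔ N) (M′ ℕ.⊔ N′) n≥
          n≥₂ = ℕ.m⊔n≤o⇒n≤o (M ℕ.⊔ N) (M′ ℕ.⊔ N′) n≥
      in subst (∣ seq x m * seq y m - seq x n * seq y n ∣ ≤_)
           (trans (cong₂ _+_ Aα≡ε/2 Bβ≡ε/2) (half+half ε))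
           (*-difference-≤ (seq x m) (seq y m) (seq x n) (seq y n)
             (x≤A (ℕ.m⊔n≤o⇒m≤o M N m≥₁)) (y≤B (ℕ.m⊔n≤o⇒n≤o M N n≥₁))
             (ℚ.<⇒≤ 0<A) (ℚ.<⇒≤ 0<B)
             (hy (ℕ.m⊔n≤o⇒m≤o M′ N′ m≥₂) (ℕ.m⊔n≤o⇒m≤o M′ N′ n≥₂))
             (hx (ℕ.m⊔n≤o⇒n≤o M′ N′ m≥₂) (ℕ.m⊔n≤o⇒n≤o M′ N′ n≥₂)))

_*ℝ_ : ℝ → ℝ → ℝ
x *ℝ y = mkℝ (λ n → seq x n * seq y n) (*-isCauchy x y)

------------------------------------------------------------------------
-- Square root of a rational.  The k-th approximation is the largest
-- multiple t of 1/(k+1) with t² ≤ q; for negative q the value is 0.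

mesh : ℕ → ℚ
mesh k = mkℚ (+ 1) k (1-coprimeTo (suc k))

climb : (q δ : ℚ) (fuel : ℕ) → ℚ → ℚ
climb q δ zero       t = t
climb q δ (suc fuel) t =
  if does ((t + δ) * (t + δ) ℚ.≤? q) then climb q δ fuel (t + δ) else t

-- The fuel lets the search reach |numerator of q| + 1, whose square exceeds q.
√-approx : ℚ → ℕ → ℚ
√-approx q k = climb q (mesh k) (suc ℤ.∣ ↥ q ∣ ℕ.* suc k) 0ℚ

private
  fromℕ : ℕ → ℚ
  fromℕ n = mkℚ (+ n) 0 (coprime-sym (1-coprimeTo n))

  fromℕ-suc : ∀ n → fromℕ (suc n) ≡ 1ℚ + fromℕ n
  fromℕ-suc n = ℚ.toℚᵘ-injective (ℚᵘ.≃-trans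
    (*≡* (cong (λ a → (ℤ.1ℤ ℤ.+ a) ℤ.* ℤ.1ℤ) (sym (ℤ.*-identityʳ (+ n)))))
    (ℚᵘ.≃-sym (ℚ.toℚᵘ-homo-+ 1ℚ (fromℕ n))))

  fromℕ-nonNeg : ∀ n → 0ℚ ≤ fromℕ n
  fromℕ-nonNeg n = ℚ.nonNegative⁻¹ (fromℕ n)

  fromℕ-mesh : ∀ a k → fromℕ (a ℕ.* suc k) * mesh k ≡ fromℕ a
  fromℕ-mesh a k = ℚ.toℚᵘ-injective (ℚᵘ.≃-trans
    (ℚ.toℚᵘ-homo-* (fromℕ (a ℕ.* suc k)) (mesh k))
    (*≡* eq))
    where
    eq : (+ (a ℕ.* suc k) ℤ.* ℤ.1ℤ) ℤ.* ℤ.1ℤ ≡ + a ℤ.* + suc (k ℕ.+ 0)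
    eq rewrite ℕ.+-identityʳ k
             | ℤ.*-identityʳ (+ (a ℕ.* suc k) ℤ.* ℤ.1ℤ)
             | ℤ.*-identityʳ (+ (a ℕ.* suc k)) = ℤ.pos-* a (suc k)

  ≤-∣numerator∣ : ∀ q → q ≤ fromℕ ℤ.∣ ↥ q ∣
  ≤-∣numerator∣ (mkℚ (+ n) d-1 _) = *≤*
    (ℤ.*-monoˡ-≤-nonNeg (+ n) (ℤ.+≤+ (s≤s z≤n)))
  ≤-∣numerator∣ (mkℚ ℤ.-[1+ n ] d-1 _) = *≤* ℤ.-≤+

  mesh-pos : ∀ k → 0ℚ < mesh k
  mesh-pos k = ℚ.positive⁻¹ (mesh k)

  mesh-small : ∀ ε → 0ℚ < ε → Eventually λ k → mesh k ≤ ε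
  mesh-small ε@(mkℚ (+ suc p) d-1 _) _ = suc d-1 , λ {k} k≥ → *≤*
    (subst (ℤ._≤ + suc p ℤ.* + suc k) (sym (ℤ.*-identityˡ (+ suc d-1)))
      (ℤ.≤-trans (ℤ.+≤+ (ℕ.≤-trans (ℕ.≤-trans k≥ (ℕ.n≤1+n k)) (ℕ.m≤n*m (suc k) (suc p))))
                 (ℤ.≤-reflexive (ℤ.pos-* (suc p) (suc k)))))
  mesh-small (mkℚ (+ zero) _ _)     (ℚ.*<* (ℤ.+<+ ()))
  mesh-small (mkℚ ℤ.-[1+ _ ] _ _) (ℚ.*<* ())

  if-elim : ∀ {A P : Set} (Q : A → Set) (P? : Dec P) {a b : A} →
    (P → Q a) → (¬ P → Q b) → Q (if does P? then a else b)
  if-elim Q (yes p) f g = f p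
  if-elim Q (no ¬p) f g = g ¬p

  record IsApprox (q δ t : ℚ) : Set where
    field
      nonNeg : 0ℚ ≤ t
      lower  : t ≡ 0ℚ ⊎ t * t ≤ q
      upper  : q < (t + δ) * (t + δ)

  climb-isApprox : ∀ q δ → 0ℚ < δ → ∀ fuel t → 0ℚ ≤ t → t ≡ 0ℚ ⊎ t * t ≤ q →
    q < (t + fromℕ fuel * δ) * (t + fromℕ fuel * δ) → IsApprox q δ (climb q δ fuel t)
  climb-isApprox q δ 0<δ zero t 0≤t low up = record
    { nonNeg = 0≤t ; lower = low
    ; upper  = ℚ.<-≤-trans
        (subst (λ a → q < (t + a) * (t + a)) (ℚ.*-zeroˡ δ) up)
        (*-mono-≤ (ℚ.+-mono-≤ 0≤t ℚ.≤-refl) (+-nonNeg 0≤t (ℚ.<⇒≤ 0<δ)) t≤ t≤) }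
    where
    t≤ : t + 0ℚ ≤ t + δ
    t≤ = ℚ.+-monoʳ-≤ t (ℚ.<⇒≤ 0<δ)
  climb-isApprox q δ 0<δ (suc fuel) t 0≤t low up =
    if-elim (IsApprox q δ) ((t + δ) * (t + δ) ℚ.≤? q)
      (λ t+δ-low → climb-isApprox q δ 0<δ fuel (t + δ)
        (+-nonNeg 0≤t (ℚ.<⇒≤ 0<δ)) (inj₂ t+δ-low) (subst (λ a → q < a * a) step up))
      (λ ¬low → record { nonNeg = 0≤t ; lower = low ; upper = ℚ.≰⇒> ¬low })
    where
    step : t + fromℕ (suc fuel) * δ ≡ (t + δ) + fromℕ fuel * δ
    step = trans (cong (λ a → t + a * δ) (fromℕ-suc fuel))
      (solve 3 (λ t a δ → t :+ (con 1ℚ :+ a) :* δ := (t :+ δ) :+ a :* δ) refl t (fromℕ fuel) δ)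
      where open +-*-Solver

  <-square : ∀ {p q} → 0ℚ ≤ q → p ≤ q → p < (1ℚ + q) * (1ℚ + q)
  <-square {p} {q} 0≤q p≤q = ℚ.≤-<-trans p≤q (ℚ.<-≤-trans
    (subst (_< 1ℚ + q) (ℚ.+-identityˡ q) (ℚ.+-monoˡ-< q 0<1))
    (subst (_≤ (1ℚ + q) * (1ℚ + q)) (ℚ.*-identityˡ (1ℚ + q))
      (*-mono-≤ (+-nonNeg (ℚ.<⇒≤ 0<1) 0≤q) (+-nonNeg (ℚ.<⇒≤ 0<1) 0≤q) 1≤1+q ℚ.≤-refl)))
    where
    1≤1+q : 1ℚ ≤ 1ℚ + q
    1≤1+q = ℚ.+-monoʳ-≤ 1ℚ 0≤q

  √-isApprox : ∀ q k → IsApprox q (mesh k) (√-approx q k)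
  √-isApprox q k = climb-isApprox q (mesh k) (mesh-pos k) (suc M ℕ.* suc k) 0ℚ ℚ.≤-refl (inj₁ refl)
    (subst (λ a → q < a * a) (sym reach) (<-square (fromℕ-nonNeg M) (≤-∣numerator∣ q)))
    where
    M = ℤ.∣ ↥ q ∣
    reach : 0ℚ + fromℕ (suc M ℕ.* suc k) * mesh k ≡ 1ℚ + fromℕ M
    reach = trans (ℚ.+-identityˡ (fromℕ (suc M ℕ.* suc k) * mesh k))
      (trans (fromℕ-mesh (suc M) k) (fromℕ-suc M))

  approx-close : ∀ {q δ δ′ s t} → 0ℚ < δ′ → IsApprox q δ s → IsApprox q δ′ t → s ≤ t + δ′
  approx-close {δ′ = δ′} {t = t} 0<δ′ S T with IsApprox.lower S
  ... | inj₁ s≡0 = subst (_≤ t + δ′) (sym s≡0) (+-nonNeg (IsApprox.nonNeg T) (ℚ.<⇒≤ 0<δ′))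
  ... | inj₂ s²≤q = ℚ.<⇒≤ (square-cancel-< (+-nonNeg (IsApprox.nonNeg T) (ℚ.<⇒≤ 0<δ′))
                             (ℚ.≤-<-trans s²≤q (IsApprox.upper T)))

  approx-distance : ∀ {q δ δ′ ε s t} → 0ℚ < δ → 0ℚ < δ′ → δ ≤ ε → δ′ ≤ ε →
    IsApprox q δ s → IsApprox q δ′ t → ∣ s - t ∣ ≤ ε
  approx-distance {ε = ε} {s} {t} 0<δ 0<δ′ δ≤ε δ′≤ε S T = ∣∣-≤
    (≤+⇒-≤ (ℚ.≤-trans (approx-close 0<δ′ S T) (ℚ.+-monoʳ-≤ t δ′≤ε)))
    (subst (_≤ ε) (sym (neg-sub s t))
      (≤+⇒-≤ (ℚ.≤-trans (approx-close 0<δ T S) (ℚ.+-monoʳ-≤ s δ≤ε))))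

  slope : ℚ → ℚ
  slope q = (1ℚ + q) + ((1ℚ + q) + 1ℚ)

  slope-pos : ∀ {q} → 0ℚ ≤ q → 0ℚ < slope q
  slope-pos 0≤q = ℚ.+-mono-< 0<1+q (ℚ.+-mono-< 0<1+q 0<1)
    where
    0<1+q = ℚ.+-mono-<-≤ 0<1 0≤q

  approx-square : ∀ {q δ t η ε} → 0ℚ ≤ q → 0ℚ < ε → slope q * η ≡ ε →
    0ℚ < δ → δ ≤ η → δ ≤ 1ℚ → IsApprox q δ t → ∣ t * t - q ∣ ≤ ε
  approx-square {q} {δ} {t} {η} {ε} 0≤q 0<ε Kη≡ε 0<δ δ≤η δ≤1 T = ∣∣-≤
    (≤+⇒-≤ (ℚ.≤-trans t²≤q (subst (_≤ q + ε) (ℚ.+-identityʳ q) (ℚ.+-monoʳ-≤ q (ℚ.<⇒≤ 0<ε)))))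
    (subst (_≤ ε) (sym (neg-sub (t * t) q))
      (≤+⇒-≤ (ℚ.≤-trans (ℚ.<⇒≤ upper)
        (subst (_≤ t * t + ε) (sym expand) (ℚ.+-monoʳ-≤ (t * t) gap)))))
    where
    open IsApprox T
    t²≤q : t * t ≤ q
    t²≤q with lower
    ... | inj₁ eq = subst (λ a → a * a ≤ q) (sym eq) 0≤q
    ... | inj₂ h  = h
    0≤1+q : 0ℚ ≤ 1ℚ + q
    0≤1+q = +-nonNeg (ℚ.<⇒≤ 0<1) 0≤q
    t≤1+q : t ≤ 1ℚ + q
    t≤1+q = ℚ.<⇒≤ (square-cancel-< 0≤1+q (ℚ.≤-<-trans t²≤q (<-square 0≤q ℚ.≤-refl)))
    expand : (t + δ) * (t + δ) ≡ t * t + (t + (t + δ)) * δ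
    expand = solve 2 (λ t δ → (t :+ δ) :* (t :+ δ) := t :* t :+ (t :+ (t :+ δ)) :* δ) refl t δ
      where open +-*-Solver
    gap : (t + (t + δ)) * δ ≤ ε
    gap = subst ((t + (t + δ)) * δ ≤_) Kη≡ε
      (*-mono-≤ (ℚ.<⇒≤ 0<δ) (ℚ.<⇒≤ (slope-pos 0≤q))
        (ℚ.+-mono-≤ t≤1+q (ℚ.+-mono-≤ t≤1+q δ≤1)) δ≤η)

  √-isCauchy : ∀ q → IsCauchy (√-approx q)
  √-isCauchy q ε 0<ε = let N , small = mesh-small ε 0<ε in N , λ {m} {n} m≥ n≥ →
    approx-distance {q} {mesh m} {mesh n} {ε} {√-approx q m} {√-approx q n}
      (mesh-pos m) (mesh-pos n) (small m≥) (small n≥) (√-isApprox q m) (√-isApprox q n)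

√ : ℚ → ℝ
√ q = mkℝ (√-approx q) (√-isCauchy q)

√-nonNeg : ∀ q → 0ℝ ≤ℝ √ q
√-nonNeg q ε 0<ε = 0 , λ {n} _ →
  +-nonNeg {√-approx q n} {ε} (IsApprox.nonNeg (√-isApprox q n)) (ℚ.<⇒≤ 0<ε)

√-square : ∀ q → 0ℚ ≤ q → √ q *ℝ √ q ≃ fromℚ q
√-square q 0≤q ε 0<ε =
  let η , 0<η , Kη≡ε = divide {ε} {slope q} 0<ε (slope-pos 0≤q)
      N , small      = mesh-small η 0<η
      N′ , small′    = mesh-small 1ℚ 0<1
  in N ℕ.⊔ N′ , λ {n} n≥ →
    approx-square {q} {mesh n} {√-approx q n} {η} {ε} 0≤q 0<ε Kη≡ε (mesh-pos n)
      (small (ℕ.m⊔n≤o⇒m≤o N N′ n≥)) (small′ (ℕ.m⊔n≤o⇒n≤o N N′ n≥)) (√-isApprox q n)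

------------------------------------------------------------------------
-- Finite simple graphs

record Graph (V : Set) : Set₁ where
  field
    Adj    : Rel V 0ℓ
    adj?   : Decidable Adj
    symm   : Symmetric Adj
    irrefl : Irreflexive _≡_ Adj

infix 4 _≅_

_≅_ : ∀ {V W} → Graph V → Graph W → Set
_≅_ {V} {W} G H = Σ (V ↔ W) λ f →
  ∀ u v → Graph.Adj G u v ⇔ Graph.Adj H (Inverse.to f u) (Inverse.to f v)

completeTripartite : ∀ a b c → Graph (Fin a ⊎ Fin b ⊎ Fin c)
completeTripartite a b c = record
  { Adj    = λ u v → part u ≢ part v
  ; adj?   = λ u v → ¬? (part u Fin.≟ part v)
  ; symm   = ≢-sym
  ; irrefl = λ u≡v p≢p → p≢p (cong part u≡v)
  }
  where
  part : Fin a ⊎ Fin b ⊎ Fin c → Fin 3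
  part (inj₁ _)        = zero
  part (inj₂ (inj₁ _)) = suc zero
  part (inj₂ (inj₂ _)) = suc (suc zero)

------------------------------------------------------------------------
-- Cycles and chords

-- Successor in cyclic order: the last element is sent to zero.
next : ∀ {k} → Fin (suc k) → Fin (suc k)
next {k} i = suc (toℕ i) mod suc k

module _ {V : Set} (G : Graph V) where
  open Graph G

  -- A cycle of length 3 + extra, as the cyclic sequence of its vertices.
  record Cycle : Set where
    field
      extra    : ℕ
      vertex   : Fin (3 ℕ.+ extra) → V
      distinct : ∀ {i j} → vertex i ≡ vertex j → i ≡ j
      adjacent : ∀ i → Adj (vertex i) (vertex (next i))

  module _ (C : Cycle) where
    open Cycle C

    OnCycle : V → Set
    OnCycle u = ∃[ i ] vertex i ≡ u

    CycleEdge : Rel V 0ℓ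
    CycleEdge u v = ∃[ i ] ((vertex i ≡ u × vertex (next i) ≡ v)
                           ⊎ (vertex i ≡ v × vertex (next i) ≡ u))

    IsChord : Rel V 0ℓ
    IsChord u v = OnCycle u × OnCycle v × Adj u v × ¬ CycleEdge u v

    -- Two chords that differ as unordered pairs of endpoints.
    DoublyChorded : Set
    DoublyChorded = ∃[ u ] ∃[ v ] ∃[ u′ ] ∃[ v′ ]
      (IsChord u v × IsChord u′ v′ × ¬ (u ≡ u′ × v ≡ v′) × ¬ (u ≡ v′ × v ≡ u′))

  ContainsDoublyChordedCycle : Set
  ContainsDoublyChordedCycle = ∃[ C ] DoublyChorded C

------------------------------------------------------------------------
-- Eigenvalues and spectral radius

+ℝ-rawMonoid : RawMonoid 0ℓ 0ℓ
+ℝ-rawMonoid = record { _≈_ = _≃_ ; _∙_ = _+ℝ_ ; ε = 0ℝ }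

open RawMonoidDefs +ℝ-rawMonoid public using () renaming (sum to sumℝ)

Matrix : ℕ → Set
Matrix n = Fin n → Fin n → ℝ

_*ᵥ_ : ∀ {n} → Matrix n → Vector ℝ n → Vector ℝ n
(A *ᵥ v) i = sumℝ λ j → A i j *ℝ v j

IsEigenvalue : ∀ {n} → Matrix n → ℝ → Set
IsEigenvalue {n} A μ = Σ (Vector ℝ n) λ v →
  ¬ (∀ i → v i ≃ 0ℝ) × (∀ i → (A *ᵥ v) i ≃ μ *ℝ v i)

adjacencyMatrix : ∀ {n} → Graph (Fin n) → Matrix n
adjacencyMatrix G i j = if does (Graph.adj? G i j) then 1ℝ else 0ℝ

-- The adjacency matrix is symmetric, so all its eigenvalues are real.
IsSpectralRadius : ∀ {n} → Graph (Fin n) → ℝ → Set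
IsSpectralRadius G ρ = IsEigenvalue (adjacencyMatrix G) ρ
  × (∀ μ → IsEigenvalue (adjacencyMatrix G) μ → μ ≤ℝ ρ)

module Submission where

-- Let λ > 1 satisfy λ x ≤ A x for a nonnegative vector x (the absolute values of an
-- eigenvector) with maximal entry x u = 1.  Write α w = 1 if w is a neighbour of u and
-- α w = 0 otherwise, and let c w be the number of common neighbours of w and u.  Two
-- steps of A minus one step give
--   λ² - λ ≤ Σ_w (c w - α w) x w ≤ Σ_w max (c w - α w) 0.
-- A graph of minimum degree at least 3 has a doubly chorded cycle (Pósa rotation of a
-- longest path), so without such cycles every set of s ≥ 2 vertices spans at most
-- 2 s - 3 edges.  Applied to all vertices and to u together with its neighbours that
-- lie on a triangle through u, this bounds the last sum by 2 (n - 2), unless u is on no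
-- triangle; then Σ_w c w ≤ 2 n - 3 gives λ² ≤ 2 n - 3 and λ² - λ < 2 (n - 2) directly.
-- The positive root of λ² - λ = 2 (n - 2) is 1/2 + √(2 n - 15/4).  If λ attains it, all
-- slacks vanish, which forces u and a second vertex to be adjacent to everything.
--
-- The order of ℝ is not decidable, but all the order statements needed are stable under
-- double negation, and so is the isomorphism with a complete tripartite graph since it
-- amounts to a decidable property of G.  Hence the argument may be carried out
-- classically.

-- The number 2 (n - 2) comes from adding two instances of the edge bound. Let B be the ball of
-- radius two about u. Sorting the two-step walks from u by their last vertex shows that twice the
-- edges in B plus twice the edges inside N(u) is at least 2 Σ c. The edge bound for B gives at most
-- 4 n - 6 for the first term. For u and its t neighbours on triangles through u it gives at most 2
-- t - 2 for the second. Since Σ c exceeds Σ max (c - α) 0 by exactly Σ min (c, α) = t, the term 2 t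
-- cancels and 4 n - 8 remains. For t = 0 the second set is a single vertex, too small for the edge
-- bound, hence the separate case.
--
-- Inequalities are handled in a semiring, without subtraction: λ is 1 + κ, λ² - λ is (1 + κ) κ, and
-- every estimate is kept as an equation with a nonnegative slack. The equality case is then read
-- off from a vanishing sum of nonnegative terms.

open import Defs

-- Paths, Pósa rotation, and doubly chorded cycles from minimum degree three.

module Paths where

  open import Data.Fin.Base using (Fin; toℕ; fromℕ<)
  import Data.Fin.Properties as Fin
  open import Data.Nat.Base
  open import Data.Nat.DivMod using (_%_; m<n⇒m%n≡m; n%n≡0)
  open import Data.Nat.Properties
  open import Data.Product.Base using (∃-syntax; _×_; _,_; proj₁; proj₂)
  open import Data.Sum.Base using (_⊎_; inj₁; inj₂)
  open import Relation.Binary.Definitions using (tri<; tri≈; tri>)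
  open import Relation.Binary.PropositionalEquality
  open import Relation.Nullary.Decidable using (yes; no)
  open import Relation.Nullary.Negation using (¬_; contradiction)

  toℕ-next : ∀ {k} (i : Fin (suc k)) →
    (toℕ i < k × toℕ (next i) ≡ suc (toℕ i)) ⊎ (toℕ i ≡ k × toℕ (next i) ≡ 0)
  toℕ-next {k} i with m≤n⇒m<n∨m≡n (≤-pred (Fin.toℕ<n i))
  ... | inj₁ i<k = inj₁ (i<k , trans (Fin.toℕ-fromℕ< _) (m<n⇒m%n≡m (s≤s i<k)))
  ... | inj₂ i≡k = inj₂ (i≡k , trans (Fin.toℕ-fromℕ< _)
                              (trans (cong (λ t → suc t % suc k) i≡k) (n%n≡0 (suc k))))

  -- The index change behind a rotation. It is an involution preserving the indices below the
  -- length, so distinct vertices stay distinct.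
  reflect : ℕ → ℕ → ℕ
  reflect j i with i ≤? j
  ... | yes _ = j ∸ i
  ... | no  _ = i

  reflect-≤ : ∀ {j i} → i ≤ j → reflect j i ≡ j ∸ i
  reflect-≤ {j} {i} i≤j with i ≤? j
  ... | yes _ = refl
  ... | no  ≰ = contradiction i≤j ≰

  reflect-> : ∀ {j i} → j < i → reflect j i ≡ i
  reflect-> {j} {i} j<i with i ≤? j
  ... | yes ≤ = contradiction j<i (≤⇒≯ ≤)
  ... | no  _ = refl

  reflect-involutive : ∀ j i → reflect j (reflect j i) ≡ i
  reflect-involutive j i with i ≤? j
  ... | yes i≤j = trans (reflect-≤ (m∸n≤m j i)) (m∸[m∸n]≡n i≤j)
  ... | no  i≰j = reflect-> (≰⇒> i≰j)

  reflect-< : ∀ {j i m} → j < m → i < m → reflect j i < m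
  reflect-< {j} {i} j<m i<m with i ≤? j
  ... | yes _ = ≤-<-trans (m∸n≤m j i) j<m
  ... | no  _ = i<m

  module _ {V : Set} (G : Graph V) where
    open Graph G

    -- Only the values of `at` below m matter.
    record Path (m : ℕ) : Set where
      field
        at       : ℕ → V
        distinct : ∀ {i j} → i < m → j < m → at i ≡ at j → i ≡ j
        step     : ∀ {i} → suc i < m → Adj (at i) (at (suc i))

    open Path

    trivialPath : V → Path 1
    trivialPath v = record
      { at = λ _ → v
      ; distinct = λ { (s≤s z≤n) (s≤s z≤n) _ → refl }
      ; step = λ { (s≤s ()) }
      }

    extend : ∀ {m} (p : Path m) v → (∀ {i} → i < m → at p i ≢ v) → Adj v (at p 0) → Path (suc m)
    extend {m} p v fresh adj = record { at = at′ ; distinct = distinct′ ; step = step′ }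
      where
      at′ : ℕ → V
      at′ zero    = v
      at′ (suc i) = at p i
      distinct′ : ∀ {i j} → i < suc m → j < suc m → at′ i ≡ at′ j → i ≡ j
      distinct′ {zero}  {zero}  _         _         _  = refl
      distinct′ {zero}  {suc j} _         (s≤s j<m) eq = contradiction (sym eq) (fresh j<m)
      distinct′ {suc i} {zero}  (s≤s i<m) _         eq = contradiction eq (fresh i<m)
      distinct′ {suc i} {suc j} (s≤s i<m) (s≤s j<m) eq = cong suc (distinct p i<m j<m eq)
      step′ : ∀ {i} → suc i < suc m → Adj (at′ i) (at′ (suc i))
      step′ {zero}  _       = adj
      step′ {suc i} (s≤s h) = step p h

    -- Pósa rotation: reverse the first j + 1 vertices.
    rotate : ∀ {m} (p : Path m) j → suc j < m → Adj (at p 0) (at p (suc j)) → Path m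
    rotate {m} p j j<m adj = record
      { at = at′
      ; distinct = λ {a} {b} a<m b<m eq → trans (sym (reflect-involutive j a))
          (trans (cong (reflect j) (distinct p (reflect-< j<m′ a<m) (reflect-< j<m′ b<m) eq))
                 (reflect-involutive j b))
      ; step = step′ }
      where
      j<m′ = <-trans (n<1+n j) j<m
      at′ : ℕ → V
      at′ i = at p (reflect j i)
      step′ : ∀ {i} → suc i < m → Adj (at′ i) (at′ (suc i))
      step′ {i} i<m with <-cmp i j
      ... | tri< i<j _ _ = subst₂ (λ a b → Adj (at p a) (at p b))
              (sym (trans (reflect-≤ (<⇒≤ i<j)) (+-∸-assoc 1 i<j))) (sym (reflect-≤ i<j))
              (symm (step p (≤-<-trans (s≤s (m∸n≤m j (suc i))) j<m)))
      -- The junction: index `j` now holds `at p 0`, and the step to the untouched part of the path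
      -- is the edge `adj`.
      ... | tri≈ _ refl _ = subst₂ (λ a b → Adj (at p a) (at p b))
              (sym (trans (reflect-≤ (≤-refl {i})) (n∸n≡0 i))) (sym (reflect-> (n<1+n i))) adj
      ... | tri> _ _ j<i = subst₂ (λ a b → Adj (at p a) (at p b))
              (sym (reflect-> j<i)) (sym (reflect-> (m<n⇒m<1+n j<i))) (step p i<m)

    -- A chord of the cycle formed by the vertices 0 , … , k of a path.
    record ChordAt {m} (p : Path m) (k a b : ℕ) : Set where
      field
        gap     : 2 + a ≤ b
        bound   : b ≤ k
        notEnds : ¬ (a ≡ 0 × b ≡ k)
        adj     : Adj (at p a) (at p b)

    open ChordAt

    -- Chords are given by increasing index pairs, so different pairs also differ as unordered
    -- pairs: a crossed coincidence would reverse one of the two inequalities.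
    twoChords : ∀ {m} (p : Path m) k → 2 ≤ k → k < m → Adj (at p 0) (at p k) →
      ∀ {a b c d} → ChordAt p k a b → ChordAt p k c d → ¬ (a ≡ c × b ≡ d) →
      ContainsDoublyChordedCycle G
    twoChords {m} p (suc (suc e)) (s≤s (s≤s _)) k<m closing {a} {b} {c} {d} ab cd ab≢cd =
      C , at p a , at p b , at p c , at p d , isChord ab , isChord cd ,
      (λ { (ac , bd) → ab≢cd (inj (a≤ ab) (a≤ cd) ac , inj (bound ab) (bound cd) bd) }) ,
      (λ { (ad , bc) → <-asym (subst (_< b) (inj (a≤ ab) (bound cd) ad) (a<b ab))
                              (subst (_< d) (sym (inj (bound ab) (a≤ cd) bc)) (a<b cd)) })
      where
      k = suc (suc e)
      inj : ∀ {i j} → i ≤ k → j ≤ k → at p i ≡ at p j → i ≡ j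
      inj i≤k j≤k = distinct p (≤-<-trans i≤k k<m) (≤-<-trans j≤k k<m)
      a<b : ∀ {a b} → ChordAt p k a b → a < b
      a<b ch = <⇒≤ (gap ch)
      a≤ : ∀ {a b} → ChordAt p k a b → a ≤ k
      a≤ ch = ≤-trans (<⇒≤ (a<b ch)) (bound ch)
      toℕ≤k : (i : Fin (3 + e)) → toℕ i ≤ k
      toℕ≤k i = ≤-pred (Fin.toℕ<n i)
      adjacent : ∀ (i : Fin (3 + e)) → Adj (at p (toℕ i)) (at p (toℕ (next i)))
      adjacent i with toℕ-next i
      ... | inj₁ (i<k , eq) = subst (λ t → Adj (at p (toℕ i)) (at p t)) (sym eq)
                                (step p (≤-<-trans i<k k<m))
      ... | inj₂ (i≡k , eq) = subst₂ (λ s t → Adj (at p s) (at p t)) (sym i≡k) (sym eq) (symm closing)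
      C : Cycle G
      C = record
        { extra    = e
        ; vertex   = λ i → at p (toℕ i)
        ; distinct = λ {i} {j} eq → Fin.toℕ-injective (inj (toℕ≤k i) (toℕ≤k j) eq)
        ; adjacent = adjacent
        }
      on : ∀ {i} → i ≤ k → OnCycle G C (at p i)
      on i≤k = fromℕ< (s≤s i≤k) , cong (at p) (Fin.toℕ-fromℕ< (s≤s i≤k))
      notEdge : ∀ {a b} → ChordAt p k a b → ¬ CycleEdge G C (at p a) (at p b)
      notEdge ch (i , inj₁ (ia , ib)) with inj (toℕ≤k i) (a≤ ch) ia | inj (toℕ≤k (next i)) (bound ch) ib | toℕ-next i
      ... | refl | refl | inj₁ (_ , eq) = <-irrefl (sym eq) (gap ch)
      ... | refl | refl | inj₂ (_ , eq) = contradiction (subst (toℕ i <_) eq (a<b ch)) λ ()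
      notEdge ch (i , inj₂ (ib , ia)) with inj (toℕ≤k i) (bound ch) ib | inj (toℕ≤k (next i)) (a≤ ch) ia | toℕ-next i
      ... | refl | refl | inj₁ (_ , eq) = <-asym (a<b ch) (≤-reflexive (sym eq))
      ... | refl | refl | inj₂ (eq , eq′) = notEnds ch (eq′ , eq)
      isChord : ∀ {a b} → ChordAt p k a b → IsChord G C (at p a) (at p b)
      isChord ch = on (a≤ ch) , on (bound ch) , adj ch , notEdge ch

  module _ {n} (G : Graph (Fin n)) where
    open Graph G
    open Path
    open ChordAt

    onPath? : ∀ {m} (p : Path G m) v → (∃[ i ] (i < m × at p i ≡ v)) ⊎ (∀ {i} → i < m → at p i ≢ v)
    onPath? {m} p v with Fin.any? {n = m} (λ i → at p (toℕ i) Fin.≟ v)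
    ... | yes (i , eq) = inj₁ (toℕ i , Fin.toℕ<n i , eq)
    ... | no  ∄        = inj₂ λ i<m eq → ∄ (fromℕ< i<m , trans (cong (at p) (Fin.toℕ-fromℕ< i<m)) eq)

    path-length : ∀ {m} → Path G m → m ≤ n
    path-length p = Fin.injective⇒≤ {f = λ i → at p (toℕ i)}
      (λ {i} {j} eq → Fin.toℕ-injective (distinct p (Fin.toℕ<n i) (Fin.toℕ<n j) eq))

    -- The neighbour p l of p (1 + j) either gives a second chord of the cycle p 0 , … , p k,
    -- or the rotated path closes into a longer cycle having the edges p 0 p k and
    -- p (1 + j) p (2 + j) as chords.
    closeUp : ∀ {m} (p : Path G m) j k l → 2 + j < k → k < m → l < m →
      Adj (at p 0) (at p (2 + j)) → Adj (at p 0) (at p k) → Adj (at p (1 + j)) (at p l) →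
      l ≢ j → l ≢ 2 + j → ContainsDoublyChordedCycle G
    closeUp {m} p j k l j<k k<m l<m adjⱼ adjₖ adjₗ l≢j l≢2+j with l ≤? k
    ... | yes l≤k = twoChords G p k (≤-trans (m≤m+n 2 j) (<⇒≤ j<k)) k<m adjₖ first second second≢
      where
      first : ChordAt G p k 0 (2 + j)
      first = record { gap = m≤m+n 2 j ; bound = <⇒≤ j<k ; notEnds = λ (_ , eq) → <⇒≢ j<k eq ; adj = adjⱼ }
      other : ∃[ a ] ∃[ b ] (ChordAt G p k a b × ¬ (0 ≡ a × 2 + j ≡ b))
      other with <-cmp l (1 + j)
      ... | tri< l<1+j _ _ = l , 1 + j ,
            record { gap = s≤s (≤∧≢⇒< (≤-pred l<1+j) l≢j) ; bound = ≤-trans (n≤1+n _) (<⇒≤ j<k)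
                   ; notEnds = λ (_ , eq) → <⇒≢ (<-trans (n<1+n _) j<k) eq ; adj = symm adjₗ } ,
            λ (_ , eq) → 1+n≢n eq
      ... | tri≈ _ refl _ = contradiction adjₗ (irrefl refl)
      ... | tri> _ _ 1+j<l = 1 + j , l ,
            record { gap = ≤∧≢⇒< 1+j<l (≢-sym l≢2+j) ; bound = l≤k ; notEnds = λ () ; adj = adjₗ } ,
            λ ()
      second = proj₁ (proj₂ (proj₂ other))
      second≢ = proj₂ (proj₂ (proj₂ other))
    ... | no l≰k = twoChords G q l (≤-trans (m≤m+n 2 j) (<⇒≤ (<-trans j<k k<l))) l<m
          (subst (λ t → Adj (at p (1 + j)) (at p t)) (sym (fixed (<-trans (<⇒≤ j<k) k<l))) adjₗ)
          first second λ ()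
      where
      k<l = ≰⇒> l≰k
      q = rotate G p (1 + j) (<-trans j<k k<m) adjⱼ
      fixed : ∀ {i} → 1 + j < i → reflect (1 + j) i ≡ i
      fixed = reflect->
      first : ChordAt G q l (1 + j) k
      first = record { gap = j<k ; bound = <⇒≤ k<l ; notEnds = λ ()
        ; adj = subst₂ (λ s t → Adj (at p s) (at p t))
                  (sym (trans (reflect-≤ {1 + j} ≤-refl) (n∸n≡0 (1 + j)))) (sym (fixed (<⇒≤ j<k))) adjₖ }
      second : ChordAt G q l 0 (2 + j)
      second = record { gap = m≤m+n 2 j ; bound = <⇒≤ (<-trans j<k k<l)
        ; notEnds = λ (_ , eq) → <⇒≢ (<-trans j<k k<l) eq
        ; adj = subst (λ t → Adj (at p (1 + j)) (at p t)) (sym (fixed (n<1+n _)))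
                  (step p (<-trans j<k k<m)) }

    -- Minimum degree three inside `S`, in the form in which it is consumed: a further neighbour
    -- besides any two given vertices.
    module _ {S : Fin n → Set}
      (degree≥3 : ∀ {i} → S i → ∀ a b → ∃[ j ] (S j × j ≢ a × j ≢ b × Adj i j)) where

      private
        -- No longest path has to be chosen: each prolongation spends one unit of fuel, and with no
        -- fuel left the path would have `suc n` vertices.
        grow : ∀ fuel {m} (p : Path G (suc m)) → (∀ {i} → i < suc m → S (at p i)) →
          suc m + fuel ≡ suc n → ContainsDoublyChordedCycle G
        grow zero p _ m≡1+n = contradiction (path-length p)
          (<⇒≱ (≤-reflexive (sym (trans (sym (+-identityʳ _)) m≡1+n))))
        grow (suc fuel) {m} p inS eq = findFirst
          where
          prolong : (q : Path G (suc m)) → (∀ {i} → i < suc m → S (at q i)) → ∀ v → S v →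
            (∀ {i} → i < suc m → at q i ≢ v) → Adj (at q 0) v → ContainsDoublyChordedCycle G
          prolong q inS v Sv fresh adj = grow fuel (extend G q v fresh (symm adj))
            (λ { {zero} _ → Sv ; {suc i} (s≤s i<) → inS i< })
            (trans (sym (+-suc (suc m) fuel)) eq)

          -- Rotating at the nearer of the two path neighbours of the end makes vertex `1 + j` the
          -- new end. A neighbour of it other than the path vertices `j` and `2 + j` either prolongs
          -- the rotated path or is the third edge that `closeUp` asks for.
          finish : ∀ j k → 2 + j < k → k < suc m → Adj (at p 0) (at p (2 + j)) →
            Adj (at p 0) (at p k) → ContainsDoublyChordedCycle G
          finish j k j<k k<m adjⱼ adjₖ
            with v , Sv , v≢j , v≢2+j , adjᵥ ← degree≥3 (inS (<-trans (<⇒≤ j<k) k<m)) (at p j) (at p (2 + j))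
            with onPath? p v
          ... | inj₁ (l , l<m , refl) = closeUp p j k l j<k k<m l<m adjⱼ adjₖ adjᵥ
                  (λ { refl → v≢j refl }) (λ { refl → v≢2+j refl })
          ... | inj₂ fresh = prolong (rotate G p (1 + j) (<-trans j<k k<m) adjⱼ)
                  (λ i<m → inS (reflect-< 1+j<m i<m)) v Sv (λ i<m → fresh (reflect-< 1+j<m i<m)) adjᵥ
            where 1+j<m = <-trans (<⇒≤ j<k) k<m

          findSecond : ∀ j → 2 + j < suc m → Adj (at p 0) (at p (2 + j)) → ContainsDoublyChordedCycle G
          findSecond j j<m adjⱼ
            with v , Sv , v≢1 , v≢j , adjᵥ ← degree≥3 (inS (s≤s z≤n)) (at p 1) (at p (2 + j))
            with onPath? p v
          ... | inj₂ fresh = prolong p inS v Sv fresh adjᵥ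
          ... | inj₁ (0 , _ , refl) = contradiction adjᵥ (irrefl refl)
          ... | inj₁ (1 , _ , refl) = contradiction refl v≢1
          ... | inj₁ (suc (suc k) , k<m , refl) with <-cmp (2 + j) (2 + k)
          ...   | tri< j<k _ _ = finish j (2 + k) j<k k<m adjⱼ adjᵥ
          ...   | tri≈ _ refl _ = contradiction refl v≢j
          ...   | tri> _ _ k<j = finish k (2 + j) k<j j<m adjᵥ adjⱼ

          findFirst : ContainsDoublyChordedCycle G
          findFirst
            with v , Sv , v≢1 , _ , adjᵥ ← degree≥3 (inS (s≤s z≤n)) (at p 1) (at p 1)
            with onPath? p v
          ... | inj₂ fresh = prolong p inS v Sv fresh adjᵥ
          ... | inj₁ (0 , _ , refl) = contradiction adjᵥ (irrefl refl)
          ... | inj₁ (1 , _ , refl) = contradiction refl v≢1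
          ... | inj₁ (suc (suc j) , j<m , refl) = findSecond j j<m adjᵥ

      minDegree≥3⇒DCC : ∀ {v} → S v → ContainsDoublyChordedCycle G
      minDegree≥3⇒DCC {v} Sv = grow n (trivialPath G v) (λ _ → Sv) refl

-- The quadratic form of the adjacency matrix and the bound on spanned edges.

module EdgeBound where

  open Paths
  open import Data.Bool.Base using (if_then_else_)
  open import Data.Fin.Base using (Fin; zero; suc)
  import Data.Fin.Properties as Fin
  open import Data.Nat.Base
  open import Data.Nat.Properties
  open import Data.Nat.Tactic.RingSolver using (solve-∀)
  open import Data.Product.Base using (∃-syntax; _×_; _,_)
  open import Function.Base using (_∘_)
  open import Relation.Binary.PropositionalEquality
  open import Relation.Nullary.Decidable using (Dec; does; yes; no; ¬?; _×-dec_)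
  open import Relation.Nullary.Negation using (¬_; contradiction)
  open import Algebra.Properties.Semiring.Sum +-*-semiring public

  indicator : ∀ {P : Set} → Dec P → ℕ
  indicator P? = if does P? then 1 else 0

  indicator-yes : ∀ {P : Set} (P? : Dec P) → P → indicator P? ≡ 1
  indicator-yes (yes _) _ = refl
  indicator-yes (no ¬p) p = contradiction p ¬p

  indicator-no : ∀ {P : Set} (P? : Dec P) → ¬ P → indicator P? ≡ 0
  indicator-no (yes p) ¬p = contradiction p ¬p
  indicator-no (no _)  _  = refl

  indicator≤1 : ∀ {P : Set} (P? : Dec P) → indicator P? ≤ 1
  indicator≤1 (yes _) = s≤s z≤n
  indicator≤1 (no _)  = z≤n

  sum-mono : ∀ {n} {f g : Fin n → ℕ} → (∀ i → f i ≤ g i) → sum f ≤ sum g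
  sum-mono {zero}  h = z≤n
  sum-mono {suc n} h = +-mono-≤ (h zero) (sum-mono (h ∘ suc))

  sum-zero : ∀ {n} {f : Fin n → ℕ} → (∀ i → f i ≡ 0) → sum f ≡ 0
  sum-zero {n} h = trans (sum-cong-≗ h) (sum-replicate-zero n)

  sum≡0⇒ : ∀ {n} (f : Fin n → ℕ) → sum f ≡ 0 → ∀ i → f i ≡ 0
  sum≡0⇒ f eq zero    = m+n≡0⇒m≡0 (f zero) eq
  sum≡0⇒ f eq (suc i) = sum≡0⇒ (f ∘ suc) (m+n≡0⇒n≡0 (f zero) eq) i

  sum-one : ∀ n → sum {n} (λ _ → 1) ≡ n
  sum-one zero    = refl
  sum-one (suc n) = cong suc (sum-one n)

  sum≤n : ∀ {n} {f : Fin n → ℕ} → (∀ i → f i ≤ 1) → sum f ≤ n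
  sum≤n {n} {f} f≤1 = subst (sum f ≤_) (sum-one n) (sum-mono f≤1)

  sum≡n⇒ : ∀ {n} (f : Fin n → ℕ) → (∀ i → f i ≤ 1) → sum f ≡ n → ∀ i → f i ≡ 1
  sum≡n⇒ {suc n} f f≤1 eq i with f zero in f0 | f≤1 zero
  ... | 0 | _ = contradiction (sum≤n (f≤1 ∘ suc)) (<⇒≱ (≤-reflexive (sym eq)))
  ... | 1 | _ with i
  ...   | zero  = f0
  ...   | suc i = sum≡n⇒ (f ∘ suc) (f≤1 ∘ suc) (suc-injective eq) i
  sum≡n⇒ {suc n} f f≤1 eq i | 2+ _ | s≤s ()

  infixl 6 _⊕_
  _⊕_ : ∀ {n} → (Fin n → ℕ) → (Fin n → ℕ) → Fin n → ℕ
  (f ⊕ g) i = f i + g i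

  infix 8 _·_
  _·_ : ∀ {n} → (Fin n → ℕ) → (Fin n → ℕ) → ℕ
  f · g = sum λ i → f i * g i

  ·-cong : ∀ {n} {f f′ g g′ : Fin n → ℕ} → f ≗ f′ → g ≗ g′ → f · g ≡ f′ · g′
  ·-cong f≗ g≗ = sum-cong-≗ λ i → cong₂ _*_ (f≗ i) (g≗ i)

  ·-comm : ∀ {n} (f g : Fin n → ℕ) → f · g ≡ g · f
  ·-comm f g = sum-cong-≗ λ i → *-comm (f i) (g i)

  ·-distribˡ : ∀ {n} (f g h : Fin n → ℕ) → f · (g ⊕ h) ≡ f · g + f · h
  ·-distribˡ f g h = trans (sum-cong-≗ λ i → *-distribˡ-+ (f i) (g i) (h i))
                           (∑-distrib-+ (λ i → f i * g i) (λ i → f i * h i))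

  ·-distribʳ : ∀ {n} (f g h : Fin n → ℕ) → (f ⊕ g) · h ≡ f · h + g · h
  ·-distribʳ f g h = trans (sum-cong-≗ λ i → *-distribʳ-+ (h i) (f i) (g i))
                           (∑-distrib-+ (λ i → f i * h i) (λ i → g i * h i))

  δ : ∀ {n} → Fin n → Fin n → ℕ
  δ u i = indicator (u Fin.≟ i)

  δ-≢ : ∀ {n} {u v : Fin n} → u ≢ v → δ u v ≡ 0
  δ-≢ {u = u} {v} = indicator-no (u Fin.≟ v)

  δ≤1 : ∀ {n} (u v : Fin n) → δ u v ≤ 1
  δ≤1 u v = indicator≤1 (u Fin.≟ v)

  δ-· : ∀ {n} u (f : Fin n → ℕ) → δ u · f ≡ f u
  δ-· zero    f = trans (cong₂ _+_ (+-identityʳ (f zero))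
    (sum-zero {f = λ i → δ zero (suc i) * f (suc i)} λ _ → refl)) (+-identityʳ (f zero))
  δ-· (suc u) f = δ-· u (f ∘ suc)

  sum-δ : ∀ {n} (u : Fin n) → sum (δ u) ≡ 1
  sum-δ u = trans (sum-cong-≗ λ i → sym (*-identityʳ (δ u i))) (δ-· u (λ _ → 1))

  module Adjacency {n} (G : Graph (Fin n)) where
    open Graph G

    a : Fin n → Fin n → ℕ
    a i j = indicator (adj? i j)

    a-adj : ∀ {i j} → Adj i j → a i j ≡ 1
    a-adj {i} {j} = indicator-yes (adj? i j)

    a-¬adj : ∀ {i j} → ¬ Adj i j → a i j ≡ 0
    a-¬adj {i} {j} = indicator-no (adj? i j)

    a≤1 : ∀ i j → a i j ≤ 1
    a≤1 i j = indicator≤1 (adj? i j)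

    a-irrefl : ∀ i → a i i ≡ 0
    a-irrefl i = a-¬adj (irrefl refl)

    a-sym : ∀ i j → a i j ≡ a j i
    a-sym i j with adj? i j
    ... | yes ij = sym (a-adj (symm ij))
    ... | no ¬ij = sym (a-¬adj (¬ij ∘ symm))

    -- For a 0/1 function `s`, `A s i` is the number of neighbours of `i` in `s`, and `s · A s` is
    -- twice the number of edges spanned by `s`. All edge counts below are made with this form.
    A : (Fin n → ℕ) → Fin n → ℕ
    A f i = a i · f

    A-⊕ : ∀ f g → A (f ⊕ g) ≗ A f ⊕ A g
    A-⊕ f g i = ·-distribˡ (a i) f g

    A-δ : ∀ u → A (δ u) ≗ a u
    A-δ u i = trans (·-comm (a i) (δ u)) (trans (δ-· u (a i)) (a-sym i u))

    A-symmetric : ∀ f g → f · A g ≡ g · A f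
    A-symmetric f g = begin
      (sum λ i → f i * sum λ j → a i j * g j)    ≡⟨ sum-cong-≗ (λ i → *-distribˡ-sum (f i) (λ j → a i j * g j)) ⟩
      (sum λ i → sum λ j → f i * (a i j * g j))  ≡⟨ ∑-comm (λ i j → f i * (a i j * g j)) ⟩
      (sum λ j → sum λ i → f i * (a i j * g j))  ≡⟨ sum-cong-≗ (λ j → sum-cong-≗ λ i →
                                                      trans (cong (λ t → f i * (t * g j)) (a-sym i j))
                                                            (swap (f i) (a j i) (g j))) ⟩
      (sum λ j → sum λ i → g j * (a j i * f i))  ≡⟨ sum-cong-≗ (λ j → *-distribˡ-sum (g j) (λ i → a j i * f i)) ⟨
      (sum λ j → g j * sum λ i → a j i * f i)    ∎
      where
      open ≡-Reasoning
      swap : ∀ x y z → x * (y * z) ≡ z * (y * x)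
      swap = solve-∀

    square-⊕ : ∀ f g → (f ⊕ g) · A (f ⊕ g) ≡ f · A f + 2 * f · A g + g · A g
    square-⊕ f g = begin
      (f ⊕ g) · A (f ⊕ g)                            ≡⟨ ·-distribʳ f g _ ⟩
      f · A (f ⊕ g) + g · A (f ⊕ g)                  ≡⟨ cong₂ _+_ (expand f) (expand g) ⟩
      (f · A f + f · A g) + (g · A f + g · A g)      ≡⟨ cong (λ t → (f · A f + f · A g) + (t + g · A g)) (A-symmetric g f) ⟩
      (f · A f + f · A g) + (f · A g + g · A g)      ≡⟨ collect (f · A f) (f · A g) (g · A g) ⟩
      f · A f + 2 * f · A g + g · A g                ∎
      where
      open ≡-Reasoning
      expand : ∀ h → h · A (f ⊕ g) ≡ h · A f + h · A g
      expand h = trans (·-cong {f = h} (λ _ → refl) (A-⊕ f g)) (·-distribˡ h (A f) (A g))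
      collect : ∀ x y z → (x + y) + (y + z) ≡ x + 2 * y + z
      collect = solve-∀

    -- The effect of adding a vertex: its degree into `f` enters twice, and there is no loop at `u`.
    square-δ-⊕ : ∀ u f → (δ u ⊕ f) · A (δ u ⊕ f) ≡ 2 * A f u + f · A f
    square-δ-⊕ u f = begin
      (δ u ⊕ f) · A (δ u ⊕ f)                          ≡⟨ square-⊕ (δ u) f ⟩
      δ u · A (δ u) + 2 * δ u · A f + f · A f          ≡⟨ cong₂ (λ s t → s + 2 * t + f · A f)
                                                            (trans (δ-· u _) (trans (A-δ u u) (a-irrefl u)))
                                                            (δ-· u (A f)) ⟩
      2 * A f u + f · A f                              ∎
      where open ≡-Reasoning

    module _ (noDCC : ¬ ContainsDoublyChordedCycle G) where

      private
        -- A set of vertices, given by its 0/1 characteristic function.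
        Is01 : (Fin n → ℕ) → Set
        Is01 s = ∀ i → s i ≤ 1

      degree-bound : ∀ s → Is01 s → ∀ i → A s i + s i ≤ sum s
      degree-bound s s≤1 i = begin
        A s i + s i                              ≡⟨ cong (A s i +_) (δ-· i s) ⟨
        A s i + δ i · s                          ≡⟨ ∑-distrib-+ (λ j → a i j * s j) (λ j → δ i j * s j) ⟨
        sum (λ j → a i j * s j + δ i j * s j)    ≤⟨ sum-mono pointwise ⟩
        sum s                                    ∎
        where
        open ≤-Reasoning
        pointwise : ∀ j → a i j * s j + δ i j * s j ≤ s j
        pointwise j with i Fin.≟ j
        ... | yes refl rewrite a-irrefl i = ≤-reflexive (trans (+-identityʳ _) refl)
        ... | no  _    = ≤-trans (≤-reflexive (+-identityʳ _))
                           (≤-trans (*-monoˡ-≤ (s j) (a≤1 i j)) (≤-reflexive (+-identityʳ _)))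

      -- Otherwise every vertex of `s` has three neighbours in `s`, which yields a doubly chorded
      -- cycle.
      lowDegree : ∀ s → Is01 s → 0 < sum s → ∃[ i ] (s i ≡ 1 × A s i ≤ 2)
      lowDegree s s≤1 0<s with Fin.any? (λ i → (s i ≟ 1) ×-dec (A s i ≤? 2))
      ... | yes found = found
      ... | no  none  with Fin.any? (λ i → s i ≟ 1)
      ...   | no  empty = contradiction (sum-zero λ i → n≤0⇒n≡0 (≤-pred (≤∧≢⇒< (s≤1 i) (empty ∘ (i ,_)))))
                            (≢-sym (<⇒≢ 0<s))
      ...   | yes (v , sv) = contradiction (minDegree≥3⇒DCC G {S = λ i → s i ≡ 1} third sv) noDCC
        where
        third : ∀ {i} → s i ≡ 1 → ∀ p q → ∃[ j ] (s j ≡ 1 × j ≢ p × j ≢ q × Adj i j)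
        third {i} si p q with Fin.any? (λ j → (s j ≟ 1) ×-dec ¬? (j Fin.≟ p) ×-dec ¬? (j Fin.≟ q) ×-dec adj? i j)
        ... | yes found = found
        ... | no  none′ = contradiction (i , si , low) none
          where
          -- With no further neighbour available, the neighbours of `i` in `s` are among `p` and
          -- `q`.
          pointwise : ∀ j → a i j * s j ≤ δ p j + δ q j
          pointwise j with p Fin.≟ j | q Fin.≟ j | adj? i j | s j ≟ 1
          ... | yes _ | _     | ij?    | _      = ≤-trans (*-mono-≤ (indicator≤1 ij?) (s≤1 j)) (s≤s z≤n)
          ... | no  _ | yes _ | ij?    | _      = *-mono-≤ (indicator≤1 ij?) (s≤1 j)
          ... | no p≢ | no q≢ | yes ij | yes sj = contradiction (j , sj , p≢ ∘ sym , q≢ ∘ sym , ij) none′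
          ... | no  _ | no  _ | yes _  | no sj  rewrite n≤0⇒n≡0 (≤-pred (≤∧≢⇒< (s≤1 j) sj)) = z≤n
          ... | no  _ | no  _ | no ¬ij | _      = z≤n
          low : A s i ≤ 2
          low = ≤-trans (sum-mono pointwise) (≤-reflexive
            (trans (∑-distrib-+ (δ p) (δ q)) (cong₂ _+_ (sum-δ p) (sum-δ q))))

      -- The bound e ≤ 2 s - 3, doubled. Deleting a vertex of degree at most two lowers the left
      -- side by at most 4 and the right side by exactly 4. The induction stops at two vertices,
      -- which span at most one edge: 2 + 6 = 4 * 2.
      edge-bound : ∀ s → Is01 s → 2 ≤ sum s → s · A s + 6 ≤ 4 * sum s
      edge-bound s s≤1 2≤s = subst (λ t → s · A s + 6 ≤ 4 * t) (m+[n∸m]≡n 2≤s)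
        (go (sum s ∸ 2) s s≤1 (sym (m+[n∸m]≡n 2≤s)))
        where
        open ≤-Reasoning
        go : ∀ k s → Is01 s → sum s ≡ 2 + k → s · A s + 6 ≤ 4 * (2 + k)
        go zero s s≤1 s≡2 = +-monoˡ-≤ 6 (subst (s · A s ≤_) s≡2 (sum-mono pointwise))
          where
          pointwise : ∀ i → s i * A s i ≤ s i
          pointwise i with s i in si | s≤1 i
          ... | 0 | _ = z≤n
          ... | 1 | _ = ≤-trans (≤-reflexive (+-identityʳ _)) (≤-pred (≤-trans
                          (≤-reflexive (trans (+-comm 1 (A s i)) (cong (A s i +_) (sym si))))
                          (≤-trans (degree-bound s s≤1 i) (≤-reflexive s≡2))))
          ... | 2+ _ | s≤s ()
        go (suc k) s s≤1 s≡3+k with lowDegree s s≤1 (subst (0 <_) (sym s≡3+k) (s≤s z≤n))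
        ... | i , si , low = begin
          s · A s + 6                        ≡⟨ cong (_+ 6) (·-cong s≗ (λ j → ·-cong {f = a j} (λ _ → refl) s≗)) ⟩
          (δ i ⊕ s′) · A (δ i ⊕ s′) + 6      ≡⟨ cong (_+ 6) (square-δ-⊕ i s′) ⟩
          2 * A s′ i + s′ · A s′ + 6         ≡⟨ +-assoc (2 * A s′ i) _ 6 ⟩
          2 * A s′ i + (s′ · A s′ + 6)       ≤⟨ +-mono-≤ (*-monoʳ-≤ 2 low′) (go k s′ s′≤1 s′≡2+k) ⟩
          4 + 4 * (2 + k)                    ≡⟨ *-suc 4 (2 + k) ⟨
          4 * (3 + k)                        ∎
          where
          s′ : Fin n → ℕ
          s′ j = s j ∸ δ i j
          δ≤s : ∀ j → δ i j ≤ s j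
          δ≤s j with i Fin.≟ j
          ... | yes refl = ≤-reflexive (sym si)
          ... | no  _    = z≤n
          s≗ : s ≗ δ i ⊕ s′
          s≗ j = sym (m+[n∸m]≡n (δ≤s j))
          s′≤1 : Is01 s′
          s′≤1 j = ≤-trans (m∸n≤m (s j) (δ i j)) (s≤1 j)
          s′≡2+k : sum s′ ≡ 2 + k
          s′≡2+k = suc-injective (trans (cong (_+ sum s′) (sym (sum-δ i)))
            (trans (sym (∑-distrib-+ (δ i) s′)) (trans (sym (sum-cong-≗ s≗)) s≡3+k)))
          low′ : A s′ i ≤ 2
          low′ = ≤-trans (sum-mono λ j → *-monoʳ-≤ (a i j) (m∸n≤m (s j) (δ i j))) low

-- Counting edges in the ball of radius two about a vertex.

module Codegrees where

  open EdgeBound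
  open import Data.Fin.Base using (Fin)
  import Data.Fin.Properties as Fin
  open import Data.Nat.Base
  open import Data.Nat.Properties
  open import Data.Nat.Tactic.RingSolver using (solve-∀)
  open import Relation.Binary.PropositionalEquality
  open import Relation.Nullary.Decidable using (yes; no)
  open import Relation.Nullary.Negation using (¬_)

  ≤-sum : ∀ {n} (f : Fin n → ℕ) i → f i ≤ sum f
  ≤-sum f i = ≤-trans (≤-reflexive (sym (δ-· i f))) (sum-mono λ j →
    ≤-trans (*-monoˡ-≤ (f j) (δ≤1 i j)) (≤-reflexive (*-identityˡ (f j))))

  module Codegree {n} (G : Graph (Fin n)) (u : Fin n) where
    open Graph G
    open Adjacency G

    -- `β` indicates the vertices at distance two from `u`, `σ` the ball of radius two, and `γ` the
    -- neighbours of `u` that lie on a triangle through `u`. Moreover `γ` is exactly what the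
    -- truncated difference `c i ∸ α i` removes from `c i`.
    α c β σ γ : Fin n → ℕ
    α   = a u
    c   = A α
    β i = (1 ∸ (δ u i + α i)) * (1 ⊓ c i)
    σ   = δ u ⊕ (α ⊕ β)
    γ i = α i ⊓ c i

    α≤1 : ∀ i → α i ≤ 1
    α≤1 = a≤1 u

    codegree-≥1 : ∀ {i j} → Adj i j → Adj u j → 1 ≤ c i
    codegree-≥1 {i} {j} ij uj = ≤-trans
      (≤-reflexive (sym (cong₂ _*_ (a-adj ij) (a-adj uj)))) (≤-sum (λ j → a i j * α j) j)

    δ+α≤1 : ∀ i → δ u i + α i ≤ 1
    δ+α≤1 i with u Fin.≟ i
    ... | yes refl = ≤-reflexive (cong suc (a-irrefl u))
    ... | no  _    = α≤1 i

    σ≡ : ∀ i → σ i ≡ (δ u i + α i) + (1 ∸ (δ u i + α i)) * (1 ⊓ c i)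
    σ≡ i = sym (+-assoc (δ u i) (α i) (β i))

    σ≤1 : ∀ i → σ i ≤ 1
    σ≤1 i = ≤-trans (≤-reflexive (σ≡ i)) (≤-trans
      (+-monoʳ-≤ (δ u i + α i) (≤-trans (*-monoʳ-≤ (1 ∸ (δ u i + α i)) (m⊓n≤m 1 (c i)))
                                        (≤-reflexive (*-identityʳ _))))
      (≤-reflexive (m+[n∸m]≡n (δ+α≤1 i))))

    -- A vertex sharing a neighbour with `u` is at distance at most two, so `c` may be summed over
    -- the ball alone.
    codegree-supp : ∀ i → c i * σ i ≡ c i
    codegree-supp i = go (c i) refl
      where
      go : ∀ k → c i ≡ k → k * σ i ≡ k
      go zero    _  = refl
      go (suc k) ci = trans (cong (suc k *_) σi) (*-identityʳ (suc k))
        where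
        σi : σ i ≡ 1
        σi = trans (σ≡ i) (trans (cong (λ t → (δ u i + α i) + (1 ∸ (δ u i + α i)) * (1 ⊓ t)) ci)
          (trans (cong ((δ u i + α i) +_) (*-identityʳ _)) (m+[n∸m]≡n (δ+α≤1 i))))

    αα : α · α ≡ sum α
    αα = sum-cong-≗ λ i → idem (α≤1 i)
      where
      idem : ∀ {m} → m ≤ 1 → m * m ≡ m
      idem z≤n       = refl
      idem (s≤s z≤n) = refl

    αβ : α · β ≡ 0
    αβ = sum-zero λ i → disjoint (δ u i) (1 ⊓ c i) (α≤1 i)
      where
      disjoint : ∀ {m} d t → m ≤ 1 → m * ((1 ∸ (d + m)) * t) ≡ 0
      disjoint d t z≤n = refl
      disjoint d t (s≤s z≤n) rewrite +-comm d 1 | 0∸n≡0 d = refl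

    αγ : α · γ ≡ sum γ
    αγ = sum-cong-≗ λ i → absorb (c i) (α≤1 i)
      where
      absorb : ∀ {m} t → m ≤ 1 → m * (m ⊓ t) ≡ m ⊓ t
      absorb t z≤n       = refl
      absorb t (s≤s z≤n) = *-identityˡ (1 ⊓ t)

    -- A two-step walk from `u` returns to `u`, ends in the neighbourhood or ends at distance two,
    -- so `sum c` is `α · α + α · c + α · A β`. Doubled, it counts `α · c` twice, whereas `σ · A σ`
    -- contains it once; conversely only `σ · A σ` sees the edges inside `β`.
    σAσ : σ · A σ + α · c ≡ 2 * sum c + β · A β
    σAσ = begin
      σ · A σ + α · c                                              ≡⟨ cong (_+ α · c) (square-δ-⊕ u (α ⊕ β)) ⟩
      2 * α · (α ⊕ β) + (α ⊕ β) · A (α ⊕ β) + α · c                ≡⟨ cong₂ (λ s t → 2 * s + t + α · c)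
                                                                        (·-distribˡ α α β) (square-⊕ α β) ⟩
      2 * (α · α + α · β) + (α · c + 2 * α · A β + β · A β) + α · c ≡⟨ cong (λ t →
                                                                        2 * (α · α + t) + (α · c + 2 * α · A β + β · A β) + α · c) αβ ⟩
      2 * (α · α + 0) + (α · c + 2 * α · A β + β · A β) + α · c    ≡⟨ collect (α · α) (α · c) (α · A β) (β · A β) ⟩
      2 * (α · α + (α · c + α · A β)) + β · A β                    ≡⟨ cong (λ t → 2 * t + β · A β) sum-c ⟨
      2 * sum c + β · A β                                          ∎
      where
      open ≡-Reasoning
      collect : ∀ d e f g → 2 * (d + 0) + (e + 2 * f + g) + e ≡ 2 * (d + (e + f)) + g
      collect = solve-∀
      sum-c : sum c ≡ α · α + (α · c + α · A β)
      sum-c = begin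
        sum c                                ≡⟨ sum-cong-≗ codegree-supp ⟨
        c · σ                                ≡⟨ ·-distribˡ c (δ u) (α ⊕ β) ⟩
        c · δ u + c · (α ⊕ β)                ≡⟨ cong₂ _+_ (trans (·-comm c (δ u)) (δ-· u c)) (·-distribˡ c α β) ⟩
        α · α + (c · α + c · β)              ≡⟨ cong (α · α +_) (cong₂ _+_ (·-comm c α)
                                                  (trans (·-comm c β) (A-symmetric β α))) ⟩
        α · α + (α · c + α · A β)            ∎

    sum-c-split : sum c ≡ sum γ + sum (λ i → c i ∸ α i)
    sum-c-split = trans (sum-cong-≗ λ i → sym (m⊓n+n∸m≡n (α i) (c i))) (∑-distrib-+ γ _)

    -- Both ends of an edge inside the neighbourhood of `u` lie on a triangle with `u`, so no such
    -- edge is lost on passing from `α` to `γ`.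
    αc≤γAγ : α · c ≤ γ · A γ
    αc≤γAγ = begin
      α · c                                     ≡⟨ sum-cong-≗ (λ i → *-distribˡ-sum (α i) (λ j → a i j * α j)) ⟩
      sum (λ i → sum λ j → α i * (a i j * α j)) ≤⟨ sum-mono (λ i → sum-mono (pointwise i)) ⟩
      sum (λ i → sum λ j → γ i * (a i j * γ j)) ≡⟨ sum-cong-≗ (λ i → *-distribˡ-sum (γ i) (λ j → a i j * γ j)) ⟨
      γ · A γ                                   ∎
      where
      open ≤-Reasoning
      γ≡1 : ∀ {i j} → Adj u i → Adj u j → Adj i j → γ i ≡ 1
      γ≡1 {i} ui uj ij = trans (cong (_⊓ c i) (a-adj ui)) (m≤n⇒m⊓n≡m (codegree-≥1 ij uj))
      pointwise : ∀ i j → α i * (a i j * α j) ≤ γ i * (a i j * γ j)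
      pointwise i j = go (adj? u i) (adj? u j) (adj? i j)
        where
        go : _ → _ → _ → _
        go (no ¬ui) _ _ = ≤-trans (≤-reflexive (cong (_* (a i j * α j)) (a-¬adj ¬ui))) z≤n
        go (yes ui) (no ¬uj) _ = ≤-trans (≤-reflexive (trans (cong (λ t → α i * (a i j * t)) (a-¬adj ¬uj))
          (trans (cong (α i *_) (*-zeroʳ (a i j))) (*-zeroʳ (α i))))) z≤n
        go (yes ui) (yes uj) (no ¬ij) = ≤-trans (≤-reflexive (trans (cong (λ t → α i * (t * α j)) (a-¬adj ¬ij))
          (*-zeroʳ (α i)))) z≤n
        go (yes ui) (yes uj) (yes ij) = *-mono-≤
          (≤-trans (α≤1 i) (≤-reflexive (sym (γ≡1 ui uj ij))))
          (*-monoʳ-≤ (a i j) (≤-trans (α≤1 j) (≤-reflexive (sym (γ≡1 uj ui (symm ij))))))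

    module _ (noDCC : ¬ ContainsDoublyChordedCycle G) where

      σ-bound : 1 ≤ sum α → σ · A σ + 6 ≤ 4 * sum σ
      σ-bound 1≤d = edge-bound noDCC σ σ≤1 (begin
        2                            ≤⟨ +-monoʳ-≤ 1 1≤d ⟩
        1 + sum α                    ≤⟨ +-monoʳ-≤ 1 (sum-mono λ i → m≤m+n (α i) (β i)) ⟩
        1 + sum (α ⊕ β)              ≡⟨ cong (_+ sum (α ⊕ β)) (sum-δ u) ⟨
        sum (δ u) + sum (α ⊕ β)      ≡⟨ ∑-distrib-+ (δ u) (α ⊕ β) ⟨
        sum σ                        ∎)
        where open ≤-Reasoning

      -- The edge bound for `u` together with `γ`: as `u` is joined to all of `γ`, its edges account
      -- for `2 * sum γ` of the at most `4 * (1 + sum γ)` less 6.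
      triangle-bound : 1 ≤ sum γ → α · c + 2 ≤ 2 * sum γ
      triangle-bound 1≤γ = +-cancelʳ-≤ (2 * sum γ + 4) _ _ (begin
        α · c + 2 + (2 * sum γ + 4)              ≡⟨ rearrange (α · c) (sum γ) ⟩
        2 * sum γ + α · c + 6                    ≤⟨ +-monoˡ-≤ 6 (+-monoʳ-≤ (2 * sum γ) αc≤γAγ) ⟩
        2 * sum γ + γ · A γ + 6                  ≡⟨ cong (λ t → 2 * t + γ · A γ + 6) αγ ⟨
        2 * A γ u + γ · A γ + 6                  ≡⟨ cong (_+ 6) (square-δ-⊕ u γ) ⟨
        (δ u ⊕ γ) · A (δ u ⊕ γ) + 6              ≤⟨ edge-bound noDCC (δ u ⊕ γ) τ≤1 2≤τ ⟩
        4 * sum (δ u ⊕ γ)                        ≡⟨ cong (4 *_) sum-τ ⟩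
        4 * (1 + sum γ)                          ≡⟨ expand (sum γ) ⟩
        2 * sum γ + (2 * sum γ + 4)              ∎)
        where
        open ≤-Reasoning
        rearrange : ∀ x y → x + 2 + (2 * y + 4) ≡ 2 * y + x + 6
        rearrange = solve-∀
        expand : ∀ y → 4 * (1 + y) ≡ 2 * y + (2 * y + 4)
        expand = solve-∀
        τ≤1 : ∀ i → (δ u ⊕ γ) i ≤ 1
        τ≤1 i = ≤-trans (+-monoʳ-≤ (δ u i) (m⊓n≤m (α i) (c i))) (δ+α≤1 i)
        sum-τ : sum (δ u ⊕ γ) ≡ 1 + sum γ
        sum-τ = trans (∑-distrib-+ (δ u) γ) (cong (_+ sum γ) (sum-δ u))
        2≤τ : 2 ≤ sum (δ u ⊕ γ)
        2≤τ = ≤-trans (+-monoʳ-≤ 1 1≤γ) (≤-reflexive (sym sum-τ))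

      -- Without triangles through `u` the correction `α · c` in `σAσ` vanishes, and the edge bound
      -- for the ball applies to `sum c` directly.
      triangleFree-codegree-sum : 1 ≤ sum α → sum γ ≡ 0 → 2 * sum c + 6 ≤ 4 * n
      triangleFree-codegree-sum 1≤d noTriangle = begin
        2 * sum c + 6                ≤⟨ +-monoˡ-≤ 6 (m≤m+n (2 * sum c) (β · A β)) ⟩
        2 * sum c + β · A β + 6      ≡⟨ cong (_+ 6) σAσ ⟨
        σ · A σ + α · c + 6          ≡⟨ cong (λ t → σ · A σ + t + 6) αc≡0 ⟩
        σ · A σ + 0 + 6              ≡⟨ cong (_+ 6) (+-identityʳ _) ⟩
        σ · A σ + 6                  ≤⟨ σ-bound 1≤d ⟩
        4 * sum σ                    ≤⟨ *-monoʳ-≤ 4 (sum≤n σ≤1) ⟩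
        4 * n                        ∎
        where
        open ≤-Reasoning
        min-zero : ∀ m k → m ⊓ k ≡ 0 → m * k ≡ 0
        min-zero zero    k       _ = refl
        min-zero (suc m) zero    _ = *-zeroʳ m
        αc≡0 : α · c ≡ 0
        αc≡0 = sum-zero λ i → min-zero (α i) (c i) (sum≡0⇒ γ noTriangle i)

      -- The constant 8 is the 6 of the ball plus the 2 of `triangle-bound`, whose term `2 * sum γ`
      -- cancels against the `γ` part of `sum c`. The term `β · A β` is kept for the equality case.
      excess-sum : 1 ≤ sum α → 1 ≤ sum γ →
        2 * sum (λ i → c i ∸ α i) + β · A β + 8 ≤ 4 * sum σ
      excess-sum 1≤d 1≤γ = +-cancelʳ-≤ (2 * sum γ) _ _ (begin
        2 * x + β · A β + 8 + 2 * sum γ                  ≡⟨ rearrange x (β · A β) (sum γ) ⟩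
        2 * (sum γ + x) + β · A β + 8                    ≡⟨ cong (λ t → 2 * t + β · A β + 8) sum-c-split ⟨
        2 * sum c + β · A β + 8                          ≡⟨ cong (_+ 8) σAσ ⟨
        σ · A σ + α · c + 8                              ≡⟨ regroup (σ · A σ) (α · c) ⟩
        (σ · A σ + 6) + (α · c + 2)                      ≤⟨ +-mono-≤ (σ-bound 1≤d) (triangle-bound 1≤γ) ⟩
        4 * sum σ + 2 * sum γ                            ∎)
        where
        open ≤-Reasoning
        x = sum (λ i → c i ∸ α i)
        rearrange : ∀ x y z → 2 * x + y + 8 + 2 * z ≡ 2 * (z + x) + y + 8
        rearrange = solve-∀
        regroup : ∀ x y → x + y + 8 ≡ (x + 6) + (y + 2)
        regroup = solve-∀

-- Semirings with a stable order, and weighted sums over vertices.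

module OrderedSemirings where

  open import Algebra.Bundles using (CommutativeSemiring)
  open import Algebra.Core using (Op₂)
  open import Algebra.Structures using (IsCommutativeSemiring)
  open import Data.Fin.Base using (Fin; zero; suc)
  import Data.Fin.Properties as Fin
  import Data.Nat.Base as ℕ
  import Data.Nat.Properties as ℕ
  open import Data.Nat.Base using (ℕ; zero; suc)
  open import Data.Product.Base using (∃-syntax; _×_; _,_)
  open import Data.Sum.Base using (_⊎_; inj₁; inj₂)
  open import Function.Base using (_∘_)
  open import Level using (0ℓ)
  open import Relation.Binary.Bundles using (Poset)
  open import Relation.Binary.Core using (Rel)
  open import Relation.Binary.Structures using (IsPartialOrder)
  open import Relation.Binary.PropositionalEquality as ≡ using (_≡_)
  open import Relation.Nullary.Negation using (¬_)
  open EdgeBound using (_⊕_; δ; module Adjacency) renaming (sum to sumℕ)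

  -- What survives constructively of the order of ℝ: it is total only up to double
  -- negation, but _≤_ is stable, so that negated and order goals may be proved
  -- classically.
  record IsStableOrderedSemiring {C : Set} (_≈_ _≤_ : Rel C 0ℓ) (_+_ _*_ : Op₂ C) (0# 1# : C) : Set where
    field
      isCommutativeSemiring : IsCommutativeSemiring _≈_ _+_ _*_ 0# 1#
      isPartialOrder        : IsPartialOrder _≈_ _≤_
      +-mono-≤              : ∀ {w x y z} → w ≤ x → y ≤ z → (w + y) ≤ (x + z)
      +-cancelʳ-≤           : ∀ z {x y} → (x + z) ≤ (y + z) → x ≤ y
      0≤1                   : 0# ≤ 1#
      *-monoˡ-≤             : ∀ {x y z} → 0# ≤ x → y ≤ z → (x * y) ≤ (x * z)
      *-cancelˡ-≤           : ∀ {x y z} → ¬ x ≤ 0# → (x * y) ≤ (x * z) → y ≤ z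
      difference            : ∀ {x y} → x ≤ y → ∃[ d ] (x + d) ≈ y
      ≤-stable              : ∀ {x y} → ¬ ¬ x ≤ y → x ≤ y
      ≤-total               : ∀ x y → ¬ ¬ (x ≤ y ⊎ y ≤ x)

  record StableOrderedSemiring : Set₁ where
    infix  4 _≈_ _≤_
    infixl 6 _+_
    infixl 7 _*_
    field
      Carrier                 : Set
      _≈_ _≤_                 : Rel Carrier 0ℓ
      _+_ _*_                 : Op₂ Carrier
      0# 1#                   : Carrier
      isStableOrderedSemiring : IsStableOrderedSemiring _≈_ _≤_ _+_ _*_ 0# 1#

    open IsStableOrderedSemiring isStableOrderedSemiring public

    commutativeSemiring : CommutativeSemiring 0ℓ 0ℓ
    commutativeSemiring = record { isCommutativeSemiring = isCommutativeSemiring }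

    poset : Poset 0ℓ 0ℓ 0ℓ
    poset = record { isPartialOrder = isPartialOrder }

    open CommutativeSemiring commutativeSemiring public
      hiding (Carrier; _≈_; _+_; _*_; 0#; 1#; isCommutativeSemiring)
    open IsPartialOrder isPartialOrder public
      using () renaming (refl to ≤-refl; trans to ≤-trans; antisym to ≤-antisym; reflexive to ≤-reflexive)

  module OrderedSemiring (R : StableOrderedSemiring) where
    open StableOrderedSemiring R hiding (zero)
    open import Algebra.Properties.Semiring.Sum semiring
    open import Algebra.Properties.Semiring.Mult semiring using (×-homo-+; ×1-homo-*) renaming (_×_ to _×ₙ_)
    open import Algebra.Solver.Ring.NaturalCoefficients.Default commutativeSemiring
    open import Relation.Binary.Reasoning.PartialOrder poset

    difference-≥0 : ∀ {x y} → x ≤ y → ∃[ d ] (0# ≤ d × x + d ≈ y)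
    difference-≥0 {x} {y} x≤y with difference x≤y
    ... | d , x+d≈y = d , +-cancelʳ-≤ x (begin
            0# + x  ≈⟨ +-identityˡ x ⟩
            x       ≤⟨ x≤y ⟩
            y       ≈⟨ x+d≈y ⟨
            x + d   ≈⟨ +-comm x d ⟩
            d + x   ∎) , x+d≈y

    +-nonNeg : ∀ {x y} → 0# ≤ x → 0# ≤ y → 0# ≤ x + y
    +-nonNeg 0≤x 0≤y = ≤-trans (≤-reflexive (sym (+-identityˡ 0#))) (+-mono-≤ 0≤x 0≤y)

    *-nonNeg : ∀ {x y} → 0# ≤ x → 0# ≤ y → 0# ≤ x * y
    *-nonNeg {x} 0≤x 0≤y = ≤-trans (≤-reflexive (sym (zeroʳ x))) (*-monoˡ-≤ 0≤x 0≤y)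

    x≤x+y : ∀ {x y} → 0# ≤ y → x ≤ x + y
    x≤x+y {x} 0≤y = ≤-trans (≤-reflexive (sym (+-identityʳ x))) (+-mono-≤ ≤-refl 0≤y)

    x≤y+x : ∀ {x y} → 0# ≤ y → x ≤ y + x
    x≤y+x {x} {y} 0≤y = ≤-trans (x≤x+y 0≤y) (≤-reflexive (+-comm x y))

    +-cancelʳ-≈ : ∀ z {x y} → x + z ≈ y + z → x ≈ y
    +-cancelʳ-≈ z eq = ≤-antisym (+-cancelʳ-≤ z (≤-reflexive eq)) (+-cancelʳ-≤ z (≤-reflexive (sym eq)))

    nonPos*nonNeg : ∀ {x y} → x ≤ 0# → 0# ≤ y → y * x ≤ 0#
    nonPos*nonNeg {x} {y} x≤0 0≤y = ≤-trans (*-monoˡ-≤ 0≤y x≤0) (≤-reflexive (zeroʳ y))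

    cancel-pos : ∀ {x y} → ¬ x ≤ 0# → x * y ≤ 0# → y ≤ 0#
    cancel-pos {x} x>0 xy≤0 = *-cancelˡ-≤ x>0 (≤-trans xy≤0 (≤-reflexive (sym (zeroʳ x))))

    pos⇒nonNeg : ∀ {x} → ¬ x ≤ 0# → 0# ≤ x
    pos⇒nonNeg {x} x>0 = ≤-stable λ ¬0≤x → ≤-total x 0# λ { (inj₁ x≤0) → x>0 x≤0 ; (inj₂ 0≤x) → ¬0≤x 0≤x }

    ι : ℕ → Carrier
    ι n = n ×ₙ 1#

    ι-1 : ι 1 ≈ 1#
    ι-1 = +-identityʳ 1#

    ι-+ : ∀ m n → ι (m ℕ.+ n) ≈ ι m + ι n
    ι-+ = ×-homo-+ 1#

    ι-* : ∀ m n → ι (m ℕ.* n) ≈ ι m * ι n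
    ι-* = ×1-homo-*

    ι-cong : ∀ {m n} → m ≡ n → ι m ≈ ι n
    ι-cong ≡.refl = refl

    ι-nonNeg : ∀ n → 0# ≤ ι n
    ι-nonNeg zero    = ≤-refl
    ι-nonNeg (suc n) = +-nonNeg 0≤1 (ι-nonNeg n)

    ι-mono : ∀ {m n} → m ℕ.≤ n → ι m ≤ ι n
    ι-mono {m} {n} m≤n = begin
      ι m                    ≤⟨ x≤x+y (ι-nonNeg (n ℕ.∸ m)) ⟩
      ι m + ι (n ℕ.∸ m)      ≈⟨ ι-+ m (n ℕ.∸ m) ⟨
      ι (m ℕ.+ (n ℕ.∸ m))    ≈⟨ ι-cong (ℕ.m+[n∸m]≡n m≤n) ⟩
      ι n                    ∎

    0*ι : ∀ {m} x → m ≡ 0 → ι m * x ≈ 0#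
    0*ι x ≡.refl = zeroˡ x

    1*ι : ∀ {m} x → m ≡ 1 → ι m * x ≈ x
    1*ι x ≡.refl = trans (*-congʳ ι-1) (*-identityˡ x)

    x≤ιx : ∀ {m x} → 1 ℕ.≤ m → 0# ≤ x → x ≤ ι m * x
    x≤ιx {m} {x} 1≤m 0≤x = begin
      x          ≈⟨ 1*ι x ≡.refl ⟨
      ι 1 * x    ≈⟨ *-comm (ι 1) x ⟩
      x * ι 1    ≤⟨ *-monoˡ-≤ 0≤x (ι-mono 1≤m) ⟩
      x * ι m    ≈⟨ *-comm x (ι m) ⟩
      ι m * x    ∎

    sum-nonNeg : ∀ {n} {f : Fin n → Carrier} → (∀ i → 0# ≤ f i) → 0# ≤ sum f
    sum-nonNeg {zero}  h = ≤-refl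
    sum-nonNeg {suc n} h = +-nonNeg (h zero) (sum-nonNeg (h ∘ suc))

    +≤0ˡ : ∀ {x y} → 0# ≤ y → x + y ≤ 0# → x ≤ 0#
    +≤0ˡ 0≤y h = ≤-trans (x≤x+y 0≤y) h

    +≤0ʳ : ∀ {x y} → 0# ≤ x → x + y ≤ 0# → y ≤ 0#
    +≤0ʳ 0≤x h = ≤-trans (x≤y+x 0≤x) h

    sum≤0⇒ : ∀ {n} (f : Fin n → Carrier) → (∀ i → 0# ≤ f i) → sum f ≤ 0# → ∀ i → f i ≤ 0#
    sum≤0⇒ f h ≤0 zero    = +≤0ˡ (sum-nonNeg (h ∘ suc)) ≤0
    sum≤0⇒ f h ≤0 (suc i) = sum≤0⇒ (f ∘ suc) (h ∘ suc) (+≤0ʳ (h zero) ≤0) i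

    ι-sum : ∀ {n} (f : Fin n → ℕ) → ι (sumℕ f) ≈ sum (ι ∘ f)
    ι-sum {zero}  f = refl
    ι-sum {suc n} f = trans (ι-+ (f zero) (sumℕ (f ∘ suc))) (+-congˡ (ι-sum (f ∘ suc)))

    infix 8 _∙_
    -- Coefficients stay in ℕ and only the weights lie in the semiring, so the counting results
    -- carry over through `ι`.
    _∙_ : ∀ {n} → (Fin n → ℕ) → (Fin n → Carrier) → Carrier
    f ∙ x = sum λ j → ι (f j) * x j

    ∙-nonNeg : ∀ {n} (f : Fin n → ℕ) {x} → (∀ i → 0# ≤ x i) → 0# ≤ f ∙ x
    ∙-nonNeg f x≥0 = sum-nonNeg λ j → *-nonNeg (ι-nonNeg (f j)) (x≥0 j)

    ∙-cong : ∀ {n} {f g : Fin n → ℕ} x → (∀ i → f i ≡ g i) → f ∙ x ≈ g ∙ x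
    ∙-cong x f≗g = sum-cong-≋ λ j → *-congʳ (ι-cong (f≗g j))

    ∙-congˡ : ∀ {n} (f : Fin n → ℕ) {x y} → (∀ i → x i ≈ y i) → f ∙ x ≈ f ∙ y
    ∙-congˡ f x≈y = sum-cong-≋ λ j → *-congˡ (x≈y j)

    ∙-distribʳ : ∀ {n} (f g : Fin n → ℕ) x → (f ⊕ g) ∙ x ≈ f ∙ x + g ∙ x
    ∙-distribʳ f g x = trans
      (sum-cong-≋ λ j → trans (*-congʳ (ι-+ (f j) (g j))) (distribʳ (x j) (ι (f j)) (ι (g j))))
      (∑-distrib-+ (λ j → ι (f j) * x j) (λ j → ι (g j) * x j))

    ∙-distribˡ : ∀ {n} (f : Fin n → ℕ) x y → f ∙ (λ j → x j + y j) ≈ f ∙ x + f ∙ y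
    ∙-distribˡ f x y = trans (sum-cong-≋ λ j → distribˡ (ι (f j)) (x j) (y j))
      (∑-distrib-+ (λ j → ι (f j) * x j) (λ j → ι (f j) * y j))

    ∙-scale : ∀ {n} (f : Fin n → ℕ) c x → f ∙ (λ j → c * x j) ≈ c * f ∙ x
    ∙-scale f c x = trans
      (sum-cong-≋ λ j → solve 3 (λ f c x → f :* (c :* x) := c :* (f :* x)) refl (ι (f j)) c (x j))
      (sym (*-distribˡ-sum c (λ j → ι (f j) * x j)))

    ∙-const : ∀ {n} (f : Fin n → ℕ) c → f ∙ (λ _ → c) ≈ ι (sumℕ f) * c
    ∙-const f c = trans (sym (*-distribʳ-sum c (ι ∘ f))) (*-congʳ (sym (ι-sum f)))

    ∙-zero : ∀ {n} {f : Fin n → ℕ} x → (∀ i → f i ≡ 0) → f ∙ x ≈ 0#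
    ∙-zero {n} x f≡0 = trans (sum-cong-≋ λ j → 0*ι (x j) (f≡0 j)) (sum-replicate-zero n)

    ∙-δ : ∀ {n} u (x : Fin n → Carrier) → δ u ∙ x ≈ x u
    ∙-δ zero x = trans (+-cong (1*ι (x zero) ≡.refl)
      (∙-zero {f = λ i → δ zero (suc i)} (x ∘ suc) λ _ → ≡.refl)) (+-identityʳ (x zero))
    ∙-δ (suc u) x = trans (+-cong (0*ι (x zero) ≡.refl) (∙-δ u (x ∘ suc))) (+-identityˡ (x (suc u)))

    -- The difference of the two sums has nonnegative terms and is at most zero, so each of its
    -- terms vanishes. This is how tight inequalities between weights force adjacencies below.
    ∙-antimono⇒ : ∀ {n} (f g : Fin n → ℕ) {x} → (∀ i → 0# ≤ x i) → (∀ i → g i ℕ.≤ f i) →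
      f ∙ x ≤ g ∙ x → ∀ i → g i ℕ.< f i → x i ≤ 0#
    ∙-antimono⇒ f g {x} x≥0 g≤f h i gᵢ<fᵢ = ≤-trans (x≤ιx (ℕ.m<n⇒0<n∸m gᵢ<fᵢ) (x≥0 i))
      (sum≤0⇒ (λ j → ι (f j ℕ.∸ g j) * x j) (λ j → *-nonNeg (ι-nonNeg (f j ℕ.∸ g j)) (x≥0 j)) excess≤0 i)
      where
      excess≤0 : (λ j → f j ℕ.∸ g j) ∙ x ≤ 0#
      excess≤0 = +-cancelʳ-≤ (g ∙ x) (begin
        (λ j → f j ℕ.∸ g j) ∙ x + g ∙ x    ≈⟨ ∙-distribʳ (λ j → f j ℕ.∸ g j) g x ⟨
        ((λ j → f j ℕ.∸ g j) ⊕ g) ∙ x      ≈⟨ ∙-cong x (λ j → ℕ.m∸n+n≡m (g≤f j)) ⟩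
        f ∙ x                              ≤⟨ h ⟩
        g ∙ x                              ≈⟨ +-identityˡ (g ∙ x) ⟨
        0# + g ∙ x                         ∎)

    ∙-mono : ∀ {n} (f g : Fin n → ℕ) {x} → (∀ i → 0# ≤ x i) → (∀ i → g i ℕ.≤ f i) → g ∙ x ≤ f ∙ x
    ∙-mono f g {x} x≥0 g≤f = begin
      g ∙ x                              ≤⟨ x≤y+x (∙-nonNeg (λ j → f j ℕ.∸ g j) x≥0) ⟩
      (λ j → f j ℕ.∸ g j) ∙ x + g ∙ x    ≈⟨ ∙-distribʳ (λ j → f j ℕ.∸ g j) g x ⟨
      ((λ j → f j ℕ.∸ g j) ⊕ g) ∙ x      ≈⟨ ∙-cong x (λ j → ℕ.m∸n+n≡m (g≤f j)) ⟩
      f ∙ x                              ∎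

    -- Comparing two entries is possible only under double negation, hence so is choosing a maximal
    -- one.
    maximum : ∀ {n} → 0 ℕ.< n → (x : Fin n → Carrier) → ¬ ¬ (∃[ u ] ∀ j → x j ≤ x u)
    maximum {suc zero}    _ x none = none (zero , λ { zero → ≤-refl })
    maximum {suc (suc n)} _ x none = maximum (ℕ.s≤s ℕ.z≤n) (x ∘ suc) λ (u , u-max) →
      ≤-total (x zero) (x (suc u)) λ
        { (inj₁ x₀≤) → none (suc u , λ { zero → x₀≤ ; (suc j) → u-max j })
        ; (inj₂ ≤x₀) → none (zero , λ { zero → ≤-refl ; (suc j) → ≤-trans (u-max j) ≤x₀ }) }

    module _ {n} (G : Graph (Fin n)) where
      open Adjacency G

      ∙-A : ∀ f x → A f ∙ x ≈ f ∙ (λ w → a w ∙ x)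
      ∙-A f x = begin-equality
        sum (λ j → ι (sumℕ λ v → a j v ℕ.* f v) * x j)        ≈⟨ sum-cong-≋ (λ j →
                                                                   trans (*-congʳ (ι-sum (λ v → a j v ℕ.* f v)))
                                                                         (*-distribʳ-sum (x j) (λ v → ι (a j v ℕ.* f v)))) ⟩
        sum (λ j → sum λ v → ι (a j v ℕ.* f v) * x j)         ≈⟨ ∑-comm (λ j v → ι (a j v ℕ.* f v) * x j) ⟩
        sum (λ v → sum λ j → ι (a j v ℕ.* f v) * x j)         ≈⟨ sum-cong-≋ (λ v → sum-cong-≋ λ j → regroup v j) ⟩
        sum (λ v → sum λ j → ι (f v) * (ι (a v j) * x j))     ≈⟨ sum-cong-≋ (λ v →
                                                                   *-distribˡ-sum (ι (f v)) (λ j → ι (a v j) * x j)) ⟨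
        sum (λ v → ι (f v) * a v ∙ x)                         ∎
        where
        regroup : ∀ v j → ι (a j v ℕ.* f v) * x j ≈ ι (f v) * (ι (a v j) * x j)
        regroup v j = trans (*-congʳ (trans (ι-cong (≡.trans (≡.cong (ℕ._* f v) (a-sym j v)) (ℕ.*-comm (a v j) (f v))))
                                            (ι-* (f v) (a v j))))
                            (*-assoc (ι (f v)) (ι (a v j)) (x j))

-- Small configurations containing doubly chorded cycles, and K(1,1,n-2) as a book of triangles.

module Books where

  open Paths
  open import Data.Fin.Base using (Fin; zero; suc; punchOut)
  import Data.Fin.Properties as Fin
  open import Data.Fin.Permutation as Perm using (Permutation; _⟨$⟩ʳ_)
  open import Data.Nat.Base using (ℕ; suc; z≤n; s≤s; _<_; _∸_; 2+)
  open import Data.Nat.Properties using (≤-refl)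
  open import Data.Product.Base using (Σ; ∃-syntax; _×_; _,_)
  open import Data.Sum.Base using (_⊎_; inj₁; inj₂)
  open import Function.Bundles using (_↔_; _⇔_; Inverse; Equivalence; mk⇔; mk↔ₛ′)
  open import Function.Construct.Composition using (_↔-∘_)
  open import Relation.Binary.PropositionalEquality
  open import Relation.Nullary.Decidable using (Dec; yes; no; ¬?; map′; _×-dec_; _→-dec_)
  open import Relation.Nullary.Negation using (¬_; contradiction)

  module _ {V : Set} (G : Graph V) where
    open Graph G

    adj⇒≢ : ∀ {x y} → Adj x y → x ≢ y
    adj⇒≢ adj x≡y = irrefl x≡y adj

    private
      fresh₁ : ∀ {w v} → w ≢ v → ∀ {i} → i < 1 → Path.at (trivialPath G w) i ≢ v
      fresh₁ w≢v _ = w≢v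

      fresh-extend : ∀ {m} (p : Path G m) {w v} {new : ∀ {i} → i < m → Path.at p i ≢ w}
        {adj : Adj w (Path.at p 0)} → w ≢ v → (∀ {i} → i < m → Path.at p i ≢ v) →
        ∀ {i} → i < suc m → Path.at (extend G p w new adj) i ≢ v
      fresh-extend p w≢v old {ℕ.zero} _         = w≢v
      fresh-extend p w≢v old {suc i}  (s≤s i<m) = old i<m

    -- The 4-cycle w x y z with both of its diagonals.
    K₄⇒DCC : ∀ {w x y z} → Adj w x → Adj x y → Adj y z → Adj w z → Adj w y → Adj x z →
      ContainsDoublyChordedCycle G
    K₄⇒DCC {w} {x} {y} {z} wx xy yz wz wy xz =
      twoChords G p₄ 3 (s≤s (s≤s z≤n)) ≤-refl wz
        (record { gap = s≤s (s≤s z≤n) ; bound = s≤s (s≤s z≤n) ; notEnds = λ () ; adj = wy })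
        (record { gap = s≤s (s≤s (s≤s z≤n)) ; bound = ≤-refl ; notEnds = λ () ; adj = xz })
        λ ()
      where
      new₂ = fresh₁ (≢-sym (adj⇒≢ yz))
      p₂ = extend G (trivialPath G z) y new₂ yz
      new₃ : ∀ {i} → i < 2 → Path.at p₂ i ≢ x
      new₃ = fresh-extend (trivialPath G z) {new = new₂} {yz} (≢-sym (adj⇒≢ xy)) (fresh₁ (≢-sym (adj⇒≢ xz)))
      p₃ = extend G p₂ x new₃ xy
      new₄ : ∀ {i} → i < 3 → Path.at p₃ i ≢ w
      new₄ = fresh-extend p₂ {new = new₃} {xy} (≢-sym (adj⇒≢ wx))
        (fresh-extend (trivialPath G z) {new = new₂} {yz} (≢-sym (adj⇒≢ wy)) (fresh₁ (≢-sym (adj⇒≢ wz))))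
      p₄ = extend G p₃ w new₄ wx

    -- The 5-cycle u x y w z with chords u y and w x.
    K₂₃+edge⇒DCC : ∀ {u w x y z} → Adj u x → Adj u y → Adj u z → Adj w x → Adj w y → Adj w z →
      Adj x y → u ≢ w → x ≢ z → y ≢ z → ContainsDoublyChordedCycle G
    K₂₃+edge⇒DCC {u} {w} {x} {y} {z} ux uy uz wx wy wz xy u≢w x≢z y≢z =
      twoChords G p₅ 4 (s≤s (s≤s z≤n)) ≤-refl uz
        (record { gap = s≤s (s≤s z≤n) ; bound = s≤s (s≤s z≤n) ; notEnds = λ () ; adj = uy })
        (record { gap = s≤s (s≤s (s≤s z≤n)) ; bound = s≤s (s≤s (s≤s z≤n)) ; notEnds = λ () ; adj = symm wx })
        λ ()
      where
      new₂ = fresh₁ (≢-sym (adj⇒≢ wz))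
      p₂ = extend G (trivialPath G z) w new₂ wz
      new₃ : ∀ {i} → i < 2 → Path.at p₂ i ≢ y
      new₃ = fresh-extend (trivialPath G z) {new = new₂} {wz} (adj⇒≢ wy) (fresh₁ (≢-sym y≢z))
      p₃ = extend G p₂ y new₃ (symm wy)
      new₄ : ∀ {i} → i < 3 → Path.at p₃ i ≢ x
      new₄ = fresh-extend p₂ {new = new₃} {symm wy} (≢-sym (adj⇒≢ xy))
        (fresh-extend (trivialPath G z) {new = new₂} {wz} (adj⇒≢ wx) (fresh₁ (≢-sym x≢z)))
      p₄ = extend G p₃ x new₄ xy
      new₅ : ∀ {i} → i < 4 → Path.at p₄ i ≢ u
      new₅ = fresh-extend p₃ {new = new₄} {xy} (≢-sym (adj⇒≢ ux))
        (fresh-extend p₂ {new = new₃} {symm wy} (≢-sym (adj⇒≢ uy))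
          (fresh-extend (trivialPath G z) {new = new₂} {wz} (≢-sym u≢w) (fresh₁ (≢-sym (adj⇒≢ uz)))))
      p₅ = extend G p₄ u new₅ ux

  -- G is the book whose pages are triangles sharing the edge u v.
  record Book {n} (G : Graph (Fin n)) (u v : Fin n) : Set where
    open Graph G
    field
      u≢v   : u ≢ v
      hub₁  : ∀ j → j ≢ u → Adj u j
      hub₂  : ∀ j → j ≢ v → Adj v j
      pages : ∀ i j → i ≢ u → i ≢ v → j ≢ u → j ≢ v → ¬ Adj i j

  -- Needed to recover an actual book from its double-negated existence.
  book? : ∀ {n} (G : Graph (Fin n)) u v → Dec (Book G u v)
  book? G u v = map′
    (λ (p , q , r , s) → record { u≢v = p ; hub₁ = q ; hub₂ = r ; pages = s })
    (λ b → let open Book b in u≢v , hub₁ , hub₂ , pages)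
    (¬? (u Fin.≟ v)
      ×-dec Fin.all? (λ j → ¬? (j Fin.≟ u) →-dec adj? u j)
      ×-dec Fin.all? (λ j → ¬? (j Fin.≟ v) →-dec adj? v j)
      ×-dec Fin.all? (λ i → Fin.all? λ j → ¬? (i Fin.≟ u) →-dec ¬? (i Fin.≟ v) →-dec
                              ¬? (j Fin.≟ u) →-dec ¬? (j Fin.≟ v) →-dec ¬? (adj? i j)))
    where open Graph G

  -- An edge between two pages would form a K₄ with the two hubs.
  dominatingPair⇒Book : ∀ {n} (G : Graph (Fin n)) → ¬ ContainsDoublyChordedCycle G → ∀ {u v} → u ≢ v →
    (∀ j → j ≢ u → Graph.Adj G u j) → (∀ j → j ≢ v → Graph.Adj G v j) → Book G u v
  dominatingPair⇒Book G noDCC {u} {v} u≢v hub₁ hub₂ = record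
    { u≢v = u≢v ; hub₁ = hub₁ ; hub₂ = hub₂
    ; pages = λ i j i≢u i≢v j≢u j≢v ij → noDCC (K₄⇒DCC G
        (hub₁ i i≢u) ij (symm (hub₂ j j≢v)) (hub₁ v (≢-sym u≢v)) (hub₁ j j≢u) (symm (hub₂ i i≢v))) }
    where open Graph G

  private
    Parts : ℕ → Set
    Parts m = Fin 1 ⊎ Fin 1 ⊎ Fin m

    pattern part₁   = inj₁ zero
    pattern part₂   = inj₂ (inj₁ zero)
    pattern part₃ k = inj₂ (inj₂ k)

    split : ∀ {m} → Fin (2+ m) ↔ Parts m
    split = mk↔ₛ′
      (λ { zero → part₁ ; (suc zero) → part₂ ; (suc (suc k)) → part₃ k })
      (λ { part₁ → zero ; part₂ → suc zero ; (part₃ k) → suc (suc k) })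
      (λ { part₁ → refl ; part₂ → refl ; (part₃ k) → refl })
      (λ { zero → refl ; (suc zero) → refl ; (suc (suc k)) → refl })

    insert-at : ∀ {m n} i j (π : Permutation m n) → Perm.insert i j π ⟨$⟩ʳ i ≡ j
    insert-at i j π with i Fin.≟ i
    ... | yes _  = refl
    ... | no i≢i = contradiction refl i≢i

    placeHubs : ∀ {n} (u v : Fin n) → u ≢ v →
      Σ (Fin n ↔ Parts (n ∸ 2)) λ f → Inverse.to f u ≡ part₁ × Inverse.to f v ≡ part₂
    placeHubs {suc ℕ.zero} zero zero u≢v = contradiction refl u≢v
    placeHubs {2+ m} u v u≢v =
      split ↔-∘ π , cong (Inverse.to split) (insert-at u zero π′) , cong (Inverse.to split) πv
      where
      -- `v′` is the position of `v` once `u` is removed; inserting it first and `u` afterwards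
      -- sends `u` to 0 and `v` to 1.
      v′ = punchOut u≢v
      π′ = Perm.insert v′ zero Perm.id
      π = Perm.insert u zero π′
      πv : π ⟨$⟩ʳ v ≡ suc zero
      πv = trans (cong (π ⟨$⟩ʳ_) (sym (Fin.punchIn-punchOut u≢v)))
        (trans (Perm.insert-punchIn u zero π′ v′) (cong suc (insert-at v′ zero Perm.id)))

  module _ {n} (G : Graph (Fin n)) (f : Fin n ↔ Parts (n ∸ 2)) where
    open Graph G
    private
      module f = Inverse f
      K = completeTripartite 1 1 (n ∸ 2)
      injective : ∀ {i j} → f.to i ≡ f.to j → i ≡ j
      injective {i} {j} eq = trans (sym (f.strictlyInverseʳ i)) (trans (cong f.from eq) (f.strictlyInverseʳ j))

    Book⇒adj⇔ : ∀ {u v} → Book G u v → f.to u ≡ part₁ → f.to v ≡ part₂ →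
      ∀ i j → Adj i j ⇔ Graph.Adj K (f.to i) (f.to j)
    Book⇒adj⇔ {u} {v} book fu fv i j with f.to i in fi | f.to j in fj
    ... | part₁   | part₁   = mk⇔ (λ ij _ → irrefl (injective (trans fi (sym fj))) ij) (contradiction refl)
    ... | part₂   | part₂   = mk⇔ (λ ij _ → irrefl (injective (trans fi (sym fj))) ij) (contradiction refl)
    ... | part₁   | part₂   rewrite injective (trans fi (sym fu)) =
          mk⇔ (λ _ ()) λ _ → Book.hub₁ book j λ { refl → contradiction (trans (sym fu) fj) λ () }
    ... | part₁   | part₃ _ rewrite injective (trans fi (sym fu)) =
          mk⇔ (λ _ ()) λ _ → Book.hub₁ book j λ { refl → contradiction (trans (sym fu) fj) λ () }
    ... | part₂   | part₁   rewrite injective (trans fi (sym fv)) =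
          mk⇔ (λ _ ()) λ _ → Book.hub₂ book j λ { refl → contradiction (trans (sym fv) fj) λ () }
    ... | part₂   | part₃ _ rewrite injective (trans fi (sym fv)) =
          mk⇔ (λ _ ()) λ _ → Book.hub₂ book j λ { refl → contradiction (trans (sym fv) fj) λ () }
    ... | part₃ _ | part₁   rewrite injective (trans fj (sym fu)) =
          mk⇔ (λ _ ()) λ _ → symm (Book.hub₁ book i λ { refl → contradiction (trans (sym fu) fi) λ () })
    ... | part₃ _ | part₂   rewrite injective (trans fj (sym fv)) =
          mk⇔ (λ _ ()) λ _ → symm (Book.hub₂ book i λ { refl → contradiction (trans (sym fv) fi) λ () })
    ... | part₃ _ | part₃ _ = mk⇔
          (λ ij → contradiction ij (Book.pages book i j
            (λ { refl → contradiction (trans (sym fu) fi) λ () }) (λ { refl → contradiction (trans (sym fv) fi) λ () })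
            (λ { refl → contradiction (trans (sym fu) fj) λ () }) (λ { refl → contradiction (trans (sym fv) fj) λ () })))
          (contradiction refl)

    adj⇔⇒Book : (∀ i j → Adj i j ⇔ Graph.Adj K (f.to i) (f.to j)) → Book G (f.from part₁) (f.from part₂)
    adj⇔⇒Book adj⇔ = record
      { u≢v   = λ eq → contradiction (trans (sym fu) (trans (cong f.to eq) fv)) λ ()
      ; hub₁  = λ j j≢u → Equivalence.from (adj⇔ u j) (subst (λ t → Graph.Adj K t (f.to j)) (sym fu) (to-hub₁ j j≢u))
      ; hub₂  = λ j j≢v → Equivalence.from (adj⇔ v j) (subst (λ t → Graph.Adj K t (f.to j)) (sym fv) (to-hub₂ j j≢v))
      ; pages = λ i j i≢u i≢v j≢u j≢v ij →
          to-pages i j i≢u i≢v j≢u j≢v (Equivalence.to (adj⇔ i j) ij) }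
      where
      u = f.from part₁
      v = f.from part₂
      fu : f.to u ≡ part₁
      fu = f.strictlyInverseˡ part₁
      fv : f.to v ≡ part₂
      fv = f.strictlyInverseˡ part₂
      to-hub₁ : ∀ j → j ≢ u → Graph.Adj K part₁ (f.to j)
      to-hub₁ j j≢u with f.to j in fj
      ... | part₁   = contradiction (injective (trans fj (sym fu))) j≢u
      ... | part₂   = λ ()
      ... | part₃ _ = λ ()
      to-hub₂ : ∀ j → j ≢ v → Graph.Adj K part₂ (f.to j)
      to-hub₂ j j≢v with f.to j in fj
      ... | part₁   = λ ()
      ... | part₂   = contradiction (injective (trans fj (sym fv))) j≢v
      ... | part₃ _ = λ ()
      to-pages : ∀ i j → i ≢ u → i ≢ v → j ≢ u → j ≢ v → ¬ Graph.Adj K (f.to i) (f.to j)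
      to-pages i j i≢u i≢v j≢u j≢v with f.to i in fi | f.to j in fj
      ... | part₁   | _       = contradiction (injective (trans fi (sym fu))) i≢u
      ... | part₂   | _       = contradiction (injective (trans fi (sym fv))) i≢v
      ... | part₃ _ | part₁   = contradiction (injective (trans fj (sym fu))) j≢u
      ... | part₃ _ | part₂   = contradiction (injective (trans fj (sym fv))) j≢v
      ... | part₃ _ | part₃ _ = contradiction refl

  Book⇔≅K₁₁ₙ₋₂ : ∀ {n} (G : Graph (Fin n)) →
    (∃[ u ] ∃[ v ] Book G u v) ⇔ (G ≅ completeTripartite 1 1 (n ∸ 2))
  Book⇔≅K₁₁ₙ₋₂ G = mk⇔
    (λ (u , v , book) → let f , fu , fv = placeHubs u v (Book.u≢v book) in f , Book⇒adj⇔ G f book fu fv)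
    (λ (f , adj⇔) → _ , _ , adj⇔⇒Book G f adj⇔)

-- The spectral inequality at a maximal entry, and its equality case.

module Subeigenvectors where

  open import Data.Fin.Base using (Fin; zero; suc)
  import Data.Fin.Properties as Fin
  import Data.Nat.Base as ℕ
  import Data.Nat.Properties as ℕ
  open import Data.Nat.Base using (ℕ; z≤n; s≤s; _∸_)
  open import Data.Nat.Tactic.RingSolver using (solve-∀)
  open import Data.Product.Base using (∃-syntax; _×_; _,_; proj₁; proj₂)
  open import Function.Base using (_∘_)
  open import Relation.Binary.PropositionalEquality as ≡ using (_≡_; _≢_; ≢-sym)
  open import Relation.Nullary.Decidable using (yes; no; ¬?; _×-dec_; decidable-stable)
  open import Relation.Nullary.Negation using (¬_; contradiction)
  open EdgeBound using (_⊕_; _·_; δ; module Adjacency) renaming (sum to sumℕ)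
  open Codegrees
  open OrderedSemirings
  open Books

  sum≥1⇒ : ∀ {n} (f : Fin n → ℕ) → 1 ℕ.≤ sumℕ f → ∃[ i ] 1 ℕ.≤ f i
  sum≥1⇒ f 1≤ with Fin.any? (λ i → 1 ℕ.≤? f i)
  ... | yes found = found
  ... | no  none  = contradiction (EdgeBound.sum-zero λ i → ℕ.n<1⇒n≡0 (ℕ.≰⇒> (none ∘ (i ,_)))) (≢-sym (ℕ.<⇒≢ 1≤))

  δ⊕≤1 : ∀ {n} (u : Fin n) (f : Fin n → ℕ) → (∀ i → f i ℕ.≤ 1) → f u ≡ 0 → ∀ i → (δ u ⊕ f) i ℕ.≤ 1
  δ⊕≤1 u f f≤1 fu≡0 i with u Fin.≟ i
  ... | yes ≡.refl = ℕ.≤-reflexive (≡.cong ℕ.suc fu≡0)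
  ... | no  _      = f≤1 i

  sum-δ⊕ : ∀ {n} (u : Fin n) f → sumℕ (δ u ⊕ f) ≡ 1 ℕ.+ sumℕ f
  sum-δ⊕ u f = ≡.trans (EdgeBound.∑-distrib-+ (δ u) f) (≡.cong (ℕ._+ sumℕ f) (EdgeBound.sum-δ u))

  -- The four point indicators add up to a 0/1 function of sum 4.
  four≤n : ∀ {n} {x y z w : Fin n} → x ≢ y → x ≢ z → x ≢ w → y ≢ z → y ≢ w → z ≢ w → 4 ℕ.≤ n
  four≤n {n} {x} {y} {z} {w} x≢y x≢z x≢w y≢z y≢w z≢w = ≡.subst (ℕ._≤ n) total
    (EdgeBound.sum≤n (δ⊕≤1 x (δ y ⊕ (δ z ⊕ δ w))
      (δ⊕≤1 y (δ z ⊕ δ w) (δ⊕≤1 z (δ w) (EdgeBound.δ≤1 w) (off z≢w))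
        (≡.cong₂ ℕ._+_ (off y≢z) (off y≢w)))
      (≡.cong₂ ℕ._+_ (off x≢y) (≡.cong₂ ℕ._+_ (off x≢z) (off x≢w)))))
    where
    off : ∀ {i j : Fin n} → i ≢ j → δ j i ≡ 0
    off i≢j = EdgeBound.δ-≢ (≢-sym i≢j)
    total : sumℕ (δ x ⊕ (δ y ⊕ (δ z ⊕ δ w))) ≡ 4
    total = ≡.trans (sum-δ⊕ x _) (≡.cong ℕ.suc (≡.trans (sum-δ⊕ y _) (≡.cong ℕ.suc
      (≡.trans (sum-δ⊕ z _) (≡.cong ℕ.suc (EdgeBound.sum-δ w))))))

  module Subeigenvector (R : StableOrderedSemiring) {n} (3≤n : 3 ℕ.≤ n)
    (G : Graph (Fin n)) (noDCC : ¬ ContainsDoublyChordedCycle G) where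

    open StableOrderedSemiring R hiding (zero)
    open OrderedSemiring R
    open Graph G
    open Adjacency G
    open import Relation.Binary.Reasoning.PartialOrder poset
    open import Algebra.Solver.Ring.NaturalCoefficients.Default commutativeSemiring

    T : Carrier
    T = ι (2 ℕ.* (n ∸ 2))

    4n≡ : 4 ℕ.* n ≡ 2 ℕ.* (2 ℕ.* (n ∸ 2)) ℕ.+ 8
    4n≡ = ≡.trans (≡.cong (4 ℕ.*_) (≡.sym (ℕ.m+[n∸m]≡n (ℕ.≤-trans (ℕ.n≤1+n 2) 3≤n)))) (expand (n ∸ 2))
      where
      expand : ∀ m → 4 ℕ.* (2 ℕ.+ m) ≡ 2 ℕ.* (2 ℕ.* m) ℕ.+ 8
      expand = solve-∀

    ∙≤0⇒ : ∀ (f : Fin n → ℕ) {x} → (∀ i → 0# ≤ x i) → f ∙ x ≤ 0# → ∀ {i} → 1 ℕ.≤ f i → x i ≤ 0#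
    ∙≤0⇒ f {x} x≥0 ≤0 {i} 1≤fᵢ = ≤-trans (x≤ιx 1≤fᵢ (x≥0 i))
      (sum≤0⇒ (λ j → ι (f j) * x j) (λ j → *-nonNeg (ι-nonNeg (f j)) (x≥0 j)) ≤0 i)

    δ≤ : ∀ {f : Fin n → ℕ} {i} → 1 ℕ.≤ f i → ∀ j → δ i j ℕ.≤ f j
    δ≤ {i = i} 1≤fᵢ j with i Fin.≟ j
    ... | yes ≡.refl = 1≤fᵢ
    ... | no  _      = z≤n

    -- Λ = 1 + κ is a candidate for the spectral radius, and x a nonnegative vector
    -- with Λ x ≤ A x that attains its positive maximum M at u.
    module AtMaximum (κ : Carrier) (κ>0 : ¬ κ ≤ 0#) (x : Fin n → Carrier) (x≥0 : ∀ i → 0# ≤ x i)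
      (sub : ∀ i → (1# + κ) * x i ≤ a i ∙ x)
      (u : Fin n) (u-max : ∀ j → x j ≤ x u) (M>0 : ¬ x u ≤ 0#) where

      open Codegree G u

      Λ M : Carrier
      Λ = 1# + κ
      M = x u

      κ≥0 : 0# ≤ κ
      κ≥0 = pos⇒nonNeg κ>0

      Λ≥0 : 0# ≤ Λ
      Λ≥0 = +-nonNeg 0≤1 κ≥0

      Λ>0 : ¬ Λ ≤ 0#
      Λ>0 = κ>0 ∘ +≤0ʳ 0≤1

      -- Slacks of `Λ x ≤ A x` and of `x ≤ M`. With them the main estimate becomes the exact
      -- identity `balance`.
      g y : Fin n → Carrier
      g i = proj₁ (difference-≥0 (sub i))
      y j = proj₁ (difference-≥0 (u-max j))

      g≥0 : ∀ i → 0# ≤ g i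
      g≥0 i = proj₁ (proj₂ (difference-≥0 (sub i)))

      y≥0 : ∀ j → 0# ≤ y j
      y≥0 j = proj₁ (proj₂ (difference-≥0 (u-max j)))

      Λx+g : ∀ i → Λ * x i + g i ≈ a i ∙ x
      Λx+g i = proj₂ (proj₂ (difference-≥0 (sub i)))

      x+y : ∀ j → x j + y j ≈ M
      x+y j = proj₂ (proj₂ (difference-≥0 (u-max j)))

      ∙x+∙y : ∀ f → f ∙ x + f ∙ y ≈ ι (sumℕ f) * M
      ∙x+∙y f = begin-equality
        f ∙ x + f ∙ y              ≈⟨ ∙-distribˡ f x y ⟨
        f ∙ (λ j → x j + y j)      ≈⟨ ∙-congˡ f x+y ⟩
        f ∙ (λ _ → M)              ≈⟨ ∙-const f M ⟩
        ι (sumℕ f) * M             ∎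

      -- Both sides are the value of A² x at `u`: first through codegrees, then by applying the
      -- eigenvalue relation at each neighbour of `u`.
      twoSteps : c ∙ x ≈ Λ * α ∙ x + α ∙ g
      twoSteps = begin-equality
        A α ∙ x                           ≈⟨ ∙-A G α x ⟩
        α ∙ (λ w → a w ∙ x)               ≈⟨ ∙-congˡ α Λx+g ⟨
        α ∙ (λ w → Λ * x w + g w)         ≈⟨ ∙-distribˡ α (λ w → Λ * x w) g ⟩
        α ∙ (λ w → Λ * x w) + α ∙ g       ≈⟨ +-congʳ (∙-scale α Λ x) ⟩
        Λ * α ∙ x + α ∙ g                 ∎

      1≤d : 1 ℕ.≤ sumℕ α
      1≤d with 1 ℕ.≤? sumℕ α
      ... | yes 1≤ = 1≤
      ... | no  1≰ = contradiction (cancel-pos Λ>0 (≤-trans (sub u)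
              (≤-reflexive (∙-zero x (EdgeBound.sum≡0⇒ α (ℕ.n<1⇒n≡0 (ℕ.≰⇒> 1≰))))))) M>0

      module TriangleFree (noTriangle : sumℕ γ ≡ 0) where

        sum-c-bound : sumℕ c ℕ.≤ 2 ℕ.* (n ∸ 2) ℕ.+ 1
        sum-c-bound = ℕ.*-cancelˡ-≤ 2 (ℕ.+-cancelʳ-≤ 6 _ _ (ℕ.≤-trans
          (triangleFree-codegree-sum noDCC 1≤d noTriangle)
          (ℕ.≤-reflexive (≡.trans 4n≡ (regroup (2 ℕ.* (n ∸ 2)))))))
          where
          regroup : ∀ m → 2 ℕ.* m ℕ.+ 8 ≡ 2 ℕ.* (m ℕ.+ 1) ℕ.+ 6
          regroup = solve-∀

        -- Here two steps alone give `Λ * Λ ≤ T + 1#`, and `Λ * Λ` is `Λ * κ + κ + 1#`. The extra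
        -- `κ` excludes equality in this case.
        Λκ+κ≤T : Λ * κ + κ ≤ T
        Λκ+κ≤T = +-cancelʳ-≤ 1# (begin
          Λ * κ + κ + 1#   ≈⟨ solve 1 (λ k → (con 1 :+ k) :* k :+ k :+ con 1 := (con 1 :+ k) :* (con 1 :+ k)) refl κ ⟩
          Λ * Λ            ≤⟨ *-cancelˡ-≤ M>0 bound ⟩
          T + 1#           ∎)
          where
          bound : M * (Λ * Λ) ≤ M * (T + 1#)
          bound = begin
            M * (Λ * Λ)                        ≈⟨ solve 2 (λ m l → m :* (l :* l) := l :* (l :* m)) refl M Λ ⟩
            Λ * (Λ * M)                        ≤⟨ *-monoˡ-≤ Λ≥0 (sub u) ⟩
            Λ * α ∙ x                          ≤⟨ x≤x+y (∙-nonNeg α g≥0) ⟩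
            Λ * α ∙ x + α ∙ g                  ≈⟨ twoSteps ⟨
            c ∙ x                              ≤⟨ x≤x+y (∙-nonNeg c y≥0) ⟩
            c ∙ x + c ∙ y                      ≈⟨ ∙x+∙y c ⟩
            ι (sumℕ c) * M                     ≈⟨ *-comm _ M ⟩
            M * ι (sumℕ c)                     ≤⟨ *-monoˡ-≤ (x≥0 u) (ι-mono sum-c-bound) ⟩
            M * ι (2 ℕ.* (n ∸ 2) ℕ.+ 1)        ≈⟨ *-congˡ (trans (ι-+ (2 ℕ.* (n ∸ 2)) 1) (+-congˡ ι-1)) ⟩
            M * (T + 1#)                       ∎

      module WithTriangle (1≤γ : 1 ℕ.≤ sumℕ γ) where

        p q : Fin n → ℕ
        p j = c j ∸ α j
        q j = α j ∸ c j

        D : ℕ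
        D = 2 ℕ.* (n ∸ 2) ∸ sumℕ p

        count : 2 ℕ.* sumℕ p ℕ.+ β · A β ℕ.+ 8 ℕ.≤ 4 ℕ.* sumℕ σ
        count = excess-sum noDCC 1≤d 1≤γ

        sum-p-bound : sumℕ p ℕ.≤ 2 ℕ.* (n ∸ 2)
        sum-p-bound = ℕ.*-cancelˡ-≤ 2 (ℕ.+-cancelʳ-≤ 8 _ _ (ℕ.≤-trans
          (ℕ.+-monoˡ-≤ 8 (ℕ.m≤m+n (2 ℕ.* sumℕ p) (β · A β)))
          (ℕ.≤-trans count (ℕ.≤-trans (ℕ.*-monoʳ-≤ 4 (EdgeBound.sum≤n σ≤1)) (ℕ.≤-reflexive 4n≡)))))

        -- The five possible losses: in the eigenvalue inequality at `u` and at its neighbours,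
        -- through entries below `M` where `c` exceeds `α`, through positive entries where `α`
        -- exceeds `c`, and in the edge count.
        slack : Carrier
        slack = κ * g u + (α ∙ g + ((p ∙ y + q ∙ x) + ι D * M))

        slack₁≥0 : 0# ≤ κ * g u
        slack₁≥0 = *-nonNeg κ≥0 (g≥0 u)
        slack₂≥0 : 0# ≤ α ∙ g
        slack₂≥0 = ∙-nonNeg α g≥0
        slack₃≥0 : 0# ≤ p ∙ y
        slack₃≥0 = ∙-nonNeg p y≥0
        slack₄≥0 : 0# ≤ q ∙ x
        slack₄≥0 = ∙-nonNeg q x≥0
        slack₅≥0 : 0# ≤ ι D * M
        slack₅≥0 = *-nonNeg (ι-nonNeg D) (x≥0 u)

        c∙x-α∙x : c ∙ x + (p ∙ y + q ∙ x) ≈ α ∙ x + ι (sumℕ p) * M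
        c∙x-α∙x = begin-equality
          c ∙ x + (p ∙ y + q ∙ x)                  ≈⟨ +-congʳ (split γ p (λ j → ≡.sym (ℕ.m⊓n+n∸m≡n (α j) (c j)))) ⟩
          (γ ∙ x + p ∙ x) + (p ∙ y + q ∙ x)        ≈⟨ solve 4 (λ m r s t → (m :+ r) :+ (s :+ t) := (m :+ t) :+ (r :+ s))
                                                       refl (γ ∙ x) (p ∙ x) (p ∙ y) (q ∙ x) ⟩
          (γ ∙ x + q ∙ x) + (p ∙ x + p ∙ y)        ≈⟨ +-cong (split γ q α-split) (sym (∙x+∙y p)) ⟨
          α ∙ x + ι (sumℕ p) * M                   ∎
          where
          split : ∀ {f} g h → (∀ j → f j ≡ g j ℕ.+ h j) → f ∙ x ≈ g ∙ x + h ∙ x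
          split g h eq = trans (∙-cong x eq) (∙-distribʳ g h x)
          α-split : ∀ j → α j ≡ γ j ℕ.+ q j
          α-split j = ≡.sym (≡.trans (≡.cong (ℕ._+ q j) (ℕ.⊓-comm (α j) (c j))) (ℕ.m⊓n+n∸m≡n (c j) (α j)))

        -- This is A² x - A x at `u` in two forms. By the eigenvalue relations it is `Λ * κ * M`
        -- plus the two `g` slacks; by codegrees it is `ι (sumℕ p) * M` less `p ∙ y` and `q ∙ x`.
        -- Adding `s` to both sides replaces the subtraction of `α ∙ x`.
        balance : Λ * κ * M + slack ≈ T * M
        balance = +-cancelʳ-≈ s (begin-equality
          Λ * κ * M + slack + s                            ≈⟨ +-congˡ (Λx+g u) ⟨
          Λ * κ * M + slack + (Λ * M + g u)                ≈⟨ solve 7 (λ k m g G p q d →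
              (con 1 :+ k) :* k :* m :+ (k :* g :+ (G :+ ((p :+ q) :+ d))) :+ ((con 1 :+ k) :* m :+ g)
              := (con 1 :+ k) :* ((con 1 :+ k) :* m :+ g) :+ G :+ (p :+ q) :+ d)
              refl κ M (g u) (α ∙ g) (p ∙ y) (q ∙ x) (ι D * M) ⟩
          Λ * (Λ * M + g u) + α ∙ g + (p ∙ y + q ∙ x) + ι D * M   ≈⟨ +-congʳ (+-congʳ (+-congʳ (*-congˡ (Λx+g u)))) ⟩
          Λ * s + α ∙ g + (p ∙ y + q ∙ x) + ι D * M        ≈⟨ +-congʳ (+-congʳ twoSteps) ⟨
          c ∙ x + (p ∙ y + q ∙ x) + ι D * M                ≈⟨ +-congʳ c∙x-α∙x ⟩
          s + ι (sumℕ p) * M + ι D * M                     ≈⟨ solve 4 (λ s k d m → s :+ k :* m :+ d :* m := (k :+ d) :* m :+ s)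
                                                                refl s (ι (sumℕ p)) (ι D) M ⟩
          (ι (sumℕ p) + ι D) * M + s                       ≈⟨ +-congʳ (*-congʳ (trans (sym (ι-+ (sumℕ p) D))
                                                                (ι-cong (ℕ.m+[n∸m]≡n sum-p-bound)))) ⟩
          T * M + s                                        ∎)
          where s = α ∙ x

        Λκ≤T : Λ * κ ≤ T
        Λκ≤T = *-cancelˡ-≤ M>0 (begin
          M * (Λ * κ)            ≈⟨ *-comm M _ ⟩
          Λ * κ * M              ≤⟨ x≤x+y (+-nonNeg slack₁≥0 (+-nonNeg slack₂≥0
                                      (+-nonNeg (+-nonNeg slack₃≥0 slack₄≥0) slack₅≥0))) ⟩
          Λ * κ * M + slack      ≈⟨ balance ⟩
          T * M                  ≈⟨ *-comm T M ⟩
          M * T                  ∎)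

        module Extremal (Λκ≈T : Λ * κ ≈ T) where

          slack≤0 : slack ≤ 0#
          slack≤0 = +-cancelʳ-≤ (T * M) (≤-reflexive (begin-equality
            slack + T * M          ≈⟨ +-comm slack _ ⟩
            T * M + slack          ≈⟨ +-congʳ (*-congʳ Λκ≈T) ⟨
            Λ * κ * M + slack      ≈⟨ balance ⟩
            T * M                  ≈⟨ +-identityˡ (T * M) ⟨
            0# + T * M             ∎))

          private
            slack₂₋₅≤0 = +≤0ʳ slack₁≥0 slack≤0
            slack₃₋₅≤0 = +≤0ʳ slack₂≥0 slack₂₋₅≤0
            slack₃₊₄≤0 = +≤0ˡ slack₅≥0 slack₃₋₅≤0
            slack₅≤0 = +≤0ʳ (+-nonNeg slack₃≥0 slack₄≥0) slack₃₋₅≤0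

          ≤Λx : ∀ {w} → g w ≤ 0# → a w ∙ x ≤ Λ * x w
          ≤Λx {w} g≤0 = begin
            a w ∙ x              ≈⟨ Λx+g w ⟨
            Λ * x w + g w        ≤⟨ +-mono-≤ ≤-refl g≤0 ⟩
            Λ * x w + 0#         ≈⟨ +-identityʳ _ ⟩
            Λ * x w              ∎

          tight-u : α ∙ x ≤ Λ * M
          tight-u = ≤Λx (cancel-pos κ>0 (+≤0ˡ (+-nonNeg slack₂≥0 (+-nonNeg (+-nonNeg slack₃≥0 slack₄≥0) slack₅≥0)) slack≤0))

          tight : ∀ {w} → Adj u w → a w ∙ x ≤ Λ * x w
          tight {w} uw = ≤Λx (∙≤0⇒ α g≥0 (+≤0ˡ (+-nonNeg (+-nonNeg slack₃≥0 slack₄≥0) slack₅≥0) slack₂₋₅≤0)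
                                (ℕ.≤-reflexive (≡.sym (a-adj uw))))

          M≤x : ∀ {j} → α j ℕ.< c j → M ≤ x j
          M≤x {j} α<c = begin
            M              ≈⟨ x+y j ⟨
            x j + y j      ≤⟨ +-mono-≤ ≤-refl (∙≤0⇒ p y≥0 (+≤0ˡ slack₄≥0 slack₃₊₄≤0) (ℕ.m<n⇒0<n∸m α<c)) ⟩
            x j + 0#       ≈⟨ +-identityʳ (x j) ⟩
            x j            ∎

          x≤0 : ∀ {j} → c j ℕ.< α j → x j ≤ 0#
          x≤0 c<α = ∙≤0⇒ q x≥0 (+≤0ʳ slack₃≥0 slack₃₊₄≤0) (ℕ.m<n⇒0<n∸m c<α)

          2[n∸2]≤sum-p : 2 ℕ.* (n ∸ 2) ℕ.≤ sumℕ p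
          2[n∸2]≤sum-p with D in eq
          ... | ℕ.zero  = ℕ.m∸n≡0⇒m≤n eq
          ... | ℕ.suc k = contradiction (≤-trans (x≤ιx (ℕ.≤-trans (s≤s z≤n) (ℕ.≤-reflexive (≡.sym eq))) (x≥0 u)) slack₅≤0) M>0

          -- The edge count is tight. As `sumℕ σ` is at most `n`, this one inequality yields both
          -- that every vertex is within distance two of `u` and that no edge joins two vertices at
          -- distance two.
          4n+βAβ≤4σ : 4 ℕ.* n ℕ.+ β · A β ℕ.≤ 4 ℕ.* sumℕ σ
          4n+βAβ≤4σ = ℕ.≤-trans (ℕ.≤-reflexive (≡.trans (≡.cong (ℕ._+ β · A β) 4n≡) (regroup (2 ℕ.* (n ∸ 2)) (β · A β))))
            (ℕ.≤-trans (ℕ.+-monoˡ-≤ 8 (ℕ.+-monoˡ-≤ (β · A β) (ℕ.*-monoʳ-≤ 2 2[n∸2]≤sum-p))) count)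
            where
            regroup : ∀ x y → 2 ℕ.* x ℕ.+ 8 ℕ.+ y ≡ 2 ℕ.* x ℕ.+ y ℕ.+ 8
            regroup = solve-∀

          σ≡1 : ∀ i → σ i ≡ 1
          σ≡1 = EdgeBound.sum≡n⇒ σ σ≤1 (ℕ.≤-antisym (EdgeBound.sum≤n σ≤1)
            (ℕ.*-cancelˡ-≤ 4 (ℕ.≤-trans (ℕ.m≤m+n (4 ℕ.* n) (β · A β)) 4n+βAβ≤4σ)))

          βAβ≡0 : β · A β ≡ 0
          βAβ≡0 = ℕ.n≤0⇒n≡0 (ℕ.+-cancelˡ-≤ (4 ℕ.* n) _ _ (ℕ.≤-trans 4n+βAβ≤4σ
            (ℕ.≤-trans (ℕ.*-monoʳ-≤ 4 (EdgeBound.sum≤n σ≤1)) (ℕ.≤-reflexive (≡.sym (ℕ.+-identityʳ _))))))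

          δ∙≤ : ∀ {f : Fin n → ℕ} {i} → 1 ℕ.≤ f i → x i ≤ f ∙ x
          δ∙≤ {f} {i} 1≤fᵢ = ≤-trans (≤-reflexive (sym (∙-δ i x))) (∙-mono f (δ i) x≥0 (δ≤ 1≤fᵢ))

          1≤a : ∀ {i j} → Adj i j → 1 ℕ.≤ a i j
          1≤a ij = ℕ.≤-reflexive (≡.sym (a-adj ij))

          x>0 : ∀ {w} → Adj u w → ¬ x w ≤ 0#
          x>0 {w} uw xw≤0 = M>0 (begin
            M            ≤⟨ δ∙≤ {f = a w} (1≤a (symm uw)) ⟩
            a w ∙ x      ≤⟨ tight uw ⟩
            Λ * x w      ≤⟨ nonPos*nonNeg xw≤0 Λ≥0 ⟩
            0#           ∎)

          -- A neighbour of `u` on no triangle through `u` would have `c` below `α`, hence entry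
          -- zero.
          1≤c : ∀ {w} → Adj u w → 1 ℕ.≤ c w
          1≤c {w} uw with 1 ℕ.≤? c w
          ... | yes 1≤ = 1≤
          ... | no  1≰ = contradiction (x≤0 (ℕ.<-≤-trans (ℕ.≰⇒> 1≰) (1≤a uw))) (x>0 uw)

          a≥1⇒Adj : ∀ {i j} → 1 ℕ.≤ a i j → Adj i j
          a≥1⇒Adj {i} {j} 1≤ = decidable-stable (adj? i j) λ ¬ij → ℕ.<⇒≢ 1≤ (≡.sym (a-¬adj ¬ij))

          triangle : ∃[ v ] ∃[ w ] (Adj u v × Adj u w × Adj v w)
          triangle with sum≥1⇒ α 1≤d
          ... | v , 1≤αv with sum≥1⇒ (λ w → a v w ℕ.* α w) (1≤c (a≥1⇒Adj 1≤αv))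
          ...   | w , 1≤ = v , w , a≥1⇒Adj 1≤αv ,
                  a≥1⇒Adj (ℕ.≤-trans 1≤ (ℕ.≤-trans (ℕ.*-monoˡ-≤ (α w) (a≤1 v w)) (ℕ.≤-reflexive (ℕ.*-identityˡ (α w))))) ,
                  a≥1⇒Adj (ℕ.≤-trans 1≤ (ℕ.≤-trans (ℕ.*-monoʳ-≤ (a v w) (α≤1 w)) (ℕ.≤-reflexive (ℕ.*-identityʳ (a v w)))))

          -- A vertex w at distance two would be a twin of u, and a triangle u v z would
          -- extend to a copy of K₂,₃ plus an edge.
          module Twin {w} (w≢u : w ≢ u) (¬uw : ¬ Adj u w) where

            β≡1 : ∀ {j} → j ≢ u → ¬ Adj u j → β j ≡ 1
            β≡1 {j} j≢u ¬uj = ≡.trans (≡.sym (≡.cong₂ (λ s t → s ℕ.+ (t ℕ.+ β j)) (EdgeBound.δ-≢ (≢-sym j≢u)) (a-¬adj ¬uj))) (σ≡1 j)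

            1≤c-w : 1 ℕ.≤ c w
            1≤c-w with c w in eq
            ... | ℕ.suc _ = s≤s z≤n
            ... | ℕ.zero  = contradiction (≡.trans (≡.sym (β≡1 w≢u ¬uw))
                    (≡.trans (≡.cong (λ t → (1 ∸ (δ u w ℕ.+ α w)) ℕ.* (1 ℕ.⊓ t)) eq) (ℕ.*-zeroʳ (1 ∸ (δ u w ℕ.+ α w))))) λ ()

            M≤xw : M ≤ x w
            M≤xw = M≤x (ℕ.≤-trans (s≤s (ℕ.≤-reflexive (a-¬adj ¬uw))) 1≤c-w)

            -- A neighbour of `w` not adjacent to `u` would also be at distance two, giving an edge
            -- inside `β`.
            N[w]⊆N[u] : ∀ {j} → Adj w j → Adj u j
            N[w]⊆N[u] {j} wj = decidable-stable (adj? u j) λ ¬uj → contradiction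
              (≡.trans (≡.sym (≡.cong₂ ℕ._*_ (a-adj wj) (β≡1 (λ { ≡.refl → ¬uw (symm wj) }) ¬uj)))
                (EdgeBound.sum≡0⇒ (λ j → a w j ℕ.* β j) Aβw≡0 j))
              λ ()
              where
              Aβw≡0 : A β w ≡ 0
              Aβw≡0 = ≡.trans (≡.sym (≡.trans (≡.cong (ℕ._* A β w) (β≡1 w≢u ¬uw)) (ℕ.*-identityˡ (A β w))))
                (EdgeBound.sum≡0⇒ (λ i → β i ℕ.* A β i) βAβ≡0 w)

            -- The neighbourhood of `w` lies in that of `u` but weighs at least as much, since `x w`
            -- is maximal too. A missing vertex would have entry zero, contrary to `x>0`.
            N[u]⊆N[w] : ∀ {j} → Adj u j → Adj w j
            N[u]⊆N[w] {j} uj = decidable-stable (adj? w j) λ ¬wj → x>0 uj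
              (∙-antimono⇒ α (a w) x≥0 a≤α α∙x≤aw∙x j
                (ℕ.≤-trans (s≤s (ℕ.≤-reflexive (a-¬adj ¬wj))) (1≤a uj)))
              where
              a≤α : ∀ j → a w j ℕ.≤ α j
              a≤α j with adj? w j
              ... | yes wj = 1≤a (N[w]⊆N[u] wj)
              ... | no  _  = z≤n
              α∙x≤aw∙x : α ∙ x ≤ a w ∙ x
              α∙x≤aw∙x = ≤-trans tight-u (≤-trans (*-monoˡ-≤ Λ≥0 M≤xw) (sub w))

            -- Suppose `v` and `z` are the only neighbours of `u`. The neighbours u, w, z of `v`
            -- weigh `M + (M + x z)`, and this is at most `Λ * x v`, hence at most `Λ * M` and so at
            -- most `x v + x z`. As `x v` is at most `M`, this gives `M ≤ 0#`.
            third : ∀ {v z} → Adj u v → Adj u z → Adj v z → ∃[ t ] (t ≢ v × t ≢ z × Adj u t)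
            third {v} {z} uv uz vz with Fin.any? (λ t → ¬? (t Fin.≟ v) ×-dec ¬? (t Fin.≟ z) ×-dec adj? u t)
            ... | yes found = found
            ... | no  none  = contradiction (+-cancelʳ-≤ (M + x z) (begin
                M + (M + x z)                      ≤⟨ +-mono-≤ ≤-refl (+-mono-≤ M≤xw ≤-refl) ⟩
                x u + (x w + x z)                  ≈⟨ +-cong (∙-δ u x) (+-cong (∙-δ w x) (∙-δ z x)) ⟨
                δ u ∙ x + (δ w ∙ x + δ z ∙ x)      ≈⟨ +-congˡ (∙-distribʳ (δ w) (δ z) x) ⟨
                δ u ∙ x + (δ w ⊕ δ z) ∙ x          ≈⟨ ∙-distribʳ (δ u) (δ w ⊕ δ z) x ⟨
                (δ u ⊕ (δ w ⊕ δ z)) ∙ x            ≤⟨ ∙-mono (a v) (δ u ⊕ (δ w ⊕ δ z)) x≥0 δ≤av ⟩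
                a v ∙ x                            ≤⟨ tight uv ⟩
                Λ * x v                            ≤⟨ *-monoˡ-≤ Λ≥0 (u-max v) ⟩
                Λ * M                              ≤⟨ sub u ⟩
                α ∙ x                              ≤⟨ ∙-mono (δ v ⊕ δ z) α x≥0 α≤δ ⟩
                (δ v ⊕ δ z) ∙ x                    ≈⟨ ∙-distribʳ (δ v) (δ z) x ⟩
                δ v ∙ x + δ z ∙ x                  ≈⟨ +-cong (∙-δ v x) (∙-δ z x) ⟩
                x v + x z                          ≤⟨ +-mono-≤ (u-max v) ≤-refl ⟩
                M + x z                            ≈⟨ +-identityˡ _ ⟨
                0# + (M + x z)                     ∎)) M>0
              where
              δ≤av : ∀ j → (δ u ⊕ (δ w ⊕ δ z)) j ℕ.≤ a v j
              δ≤av j with u Fin.≟ j | w Fin.≟ j | z Fin.≟ j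
              ... | yes ≡.refl | yes w≡u    | _          = contradiction w≡u w≢u
              ... | yes ≡.refl | no _       | yes ≡.refl = contradiction uz (irrefl ≡.refl)
              ... | yes ≡.refl | no _       | no _       = 1≤a (symm uv)
              ... | no _       | yes ≡.refl | yes ≡.refl = contradiction uz ¬uw
              ... | no _       | yes ≡.refl | no _       = 1≤a (symm (N[u]⊆N[w] uv))
              ... | no _       | no _       | yes ≡.refl = 1≤a vz
              ... | no _       | no _       | no _       = z≤n
              α≤δ : ∀ j → α j ℕ.≤ (δ v ⊕ δ z) j
              α≤δ j with adj? u j | v Fin.≟ j | z Fin.≟ j
              ... | no  _  | _      | _     = z≤n
              ... | yes _  | yes _  | _     = s≤s z≤n
              ... | yes _  | no _   | yes _ = s≤s z≤n
              ... | yes uj | no v≢j | no z≢j = contradiction (j , ≢-sym v≢j , ≢-sym z≢j , uj) none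

            DCC : ContainsDoublyChordedCycle G
            DCC with triangle
            ... | v , z , uv , uz , vz with third uv uz vz
            ...   | t , t≢v , t≢z , ut = K₂₃+edge⇒DCC G uv uz ut (N[u]⊆N[w] uv) (N[u]⊆N[w] uz) (N[u]⊆N[w] ut)
                    vz (≢-sym w≢u) (≢-sym t≢v) (≢-sym t≢z)

          u-dominates : ∀ j → j ≢ u → Adj u j
          u-dominates j j≢u = decidable-stable (adj? u j) λ ¬uj → noDCC (Twin.DCC j≢u ¬uj)

          -- If another vertex has codegree at least two with `u`, its entry is also `M` and it
          -- dominates as `u` does. Otherwise only `u` contributes to `sumℕ p`, so 2 (n - 2) ≤ n -
          -- 1, which leaves n = 3 and the triangle.
          book : ∃[ u ] ∃[ v ] Book G u v
          book with Fin.any? (λ w → ¬? (w Fin.≟ u) ×-dec 2 ℕ.≤? c w)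
          ... | yes (w , w≢u , 2≤c) = u , w , dominatingPair⇒Book G noDCC (≢-sym w≢u) u-dominates w-dominates
            where
            M≤xw : M ≤ x w
            M≤xw = M≤x (ℕ.≤-trans (s≤s (α≤1 w)) 2≤c)
            everywhere>0 : ∀ j → ¬ x j ≤ 0#
            everywhere>0 j with j Fin.≟ u
            ... | yes ≡.refl = M>0
            ... | no  j≢u    = x>0 (u-dominates j j≢u)
            closed-u≥1 : ∀ j → 1 ℕ.≤ (δ u ⊕ α) j
            closed-u≥1 j with u Fin.≟ j
            ... | yes _   = s≤s z≤n
            ... | no  u≢j = 1≤a (u-dominates j (≢-sym u≢j))
            closed-w≤closed-u : ∀ j → (δ w ⊕ a w) j ℕ.≤ (δ u ⊕ α) j
            closed-w≤closed-u j = ℕ.≤-trans (δ⊕≤1 w (a w) (a≤1 w) (a-irrefl w) j) (closed-u≥1 j)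
            -- Closed neighbourhoods are compared because `u` and `w` are adjacent, so their open
            -- neighbourhoods are not nested.
            closed-≤ : (δ u ⊕ α) ∙ x ≤ (δ w ⊕ a w) ∙ x
            closed-≤ = begin
              (δ u ⊕ α) ∙ x            ≈⟨ ∙-distribʳ (δ u) α x ⟩
              δ u ∙ x + α ∙ x          ≤⟨ +-mono-≤ (≤-reflexive (∙-δ u x)) tight-u ⟩
              M + Λ * M                ≤⟨ +-mono-≤ M≤xw (*-monoˡ-≤ Λ≥0 M≤xw) ⟩
              x w + Λ * x w            ≤⟨ +-mono-≤ (≤-reflexive (sym (∙-δ w x))) (sub w) ⟩
              δ w ∙ x + a w ∙ x        ≈⟨ ∙-distribʳ (δ w) (a w) x ⟨
              (δ w ⊕ a w) ∙ x          ∎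
            w-dominates : ∀ j → j ≢ w → Adj w j
            w-dominates j j≢w = decidable-stable (adj? w j) λ ¬wj → everywhere>0 j
              (∙-antimono⇒ (δ u ⊕ α) (δ w ⊕ a w) x≥0 closed-w≤closed-u closed-≤ j
                (ℕ.≤-trans (s≤s (ℕ.≤-reflexive (≡.cong₂ ℕ._+_ (EdgeBound.δ-≢ (≢-sym j≢w)) (a-¬adj ¬wj)))) (closed-u≥1 j)))
          ... | no none with triangle
          ...   | v , z , uv , uz , vz = u , v , dominatingPair⇒Book G noDCC (adj⇒≢ G uv) u-dominates v-dominates
            where
            p≤ : ∀ j → p j ℕ.≤ δ u j ℕ.* c j
            p≤ j with u Fin.≟ j
            ... | yes _   = ℕ.≤-trans (ℕ.m∸n≤m (c j) (α j)) (ℕ.≤-reflexive (≡.sym (ℕ.+-identityʳ (c j))))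
            ... | no  u≢j = ℕ.≤-reflexive (ℕ.m≤n⇒m∸n≡0 (ℕ.≤-trans (ℕ.≤-pred (ℕ.≰⇒> λ 2≤c → none (j , ≢-sym u≢j , 2≤c)))
                              (1≤a (u-dominates j (≢-sym u≢j)))))
            sum-p≤ : 1 ℕ.+ sumℕ p ℕ.≤ n
            sum-p≤ = ℕ.≤-trans (ℕ.+-monoʳ-≤ 1 (ℕ.≤-trans (EdgeBound.sum-mono p≤) (ℕ.≤-reflexive (≡.trans (EdgeBound.δ-· u c) αα))))
              (ℕ.≤-trans (ℕ.≤-reflexive (≡.sym (sum-δ⊕ u α))) (EdgeBound.sum≤n δ+α≤1))
            n<4 : ¬ 4 ℕ.≤ n
            n<4 4≤n = ℕ.<⇒≱ (ℕ.≤-trans (s≤s 2[n∸2]≤sum-p) sum-p≤) (ℕ.≤-trans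
              (ℕ.≤-reflexive (≡.sym (ℕ.m+[n∸m]≡n (ℕ.≤-trans (ℕ.n≤1+n 2) 3≤n))))
              (ℕ.≤-trans (ℕ.+-monoˡ-≤ (n ∸ 2) (ℕ.∸-monoˡ-≤ 2 4≤n))
                (ℕ.≤-reflexive (≡.cong (n ∸ 2 ℕ.+_) (≡.sym (ℕ.+-identityʳ (n ∸ 2)))))))
            v-dominates : ∀ j → j ≢ v → Adj v j
            v-dominates j j≢v with j Fin.≟ u | j Fin.≟ z
            ... | yes ≡.refl | _          = symm uv
            ... | no  _      | yes ≡.refl = vz
            ... | no  j≢u    | no  j≢z    = contradiction
                  (four≤n (adj⇒≢ G uv) (adj⇒≢ G uz) (≢-sym j≢u) (adj⇒≢ G vz) (≢-sym j≢v) (≢-sym j≢z)) n<4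

      conclusion : Λ * κ ≤ T × (Λ * κ ≈ T → ∃[ u ] ∃[ v ] Book G u v)
      conclusion with 1 ℕ.≤? sumℕ γ
      ... | yes 1≤γ = Λκ≤T , Extremal.book
        where open WithTriangle 1≤γ
      -- Without a triangle through `u`, equality would turn the stronger bound into `κ + T ≤ T`.
      ... | no  1≰γ = ≤-trans (x≤x+y κ≥0) Λκ+κ≤T , λ Λκ≈T →
            contradiction (+-cancelʳ-≤ T (begin
              κ + T            ≈⟨ +-congˡ Λκ≈T ⟨
              κ + Λ * κ        ≈⟨ +-comm κ _ ⟩
              Λ * κ + κ        ≤⟨ Λκ+κ≤T ⟩
              T                ≈⟨ +-identityˡ T ⟨
              0# + T           ∎)) κ>0
        where open TriangleFree (ℕ.n<1⇒n≡0 (ℕ.≰⇒> 1≰γ))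

    module _ {κ} (κ>0 : ¬ κ ≤ 0#) {x : Fin n → Carrier} (x≥0 : ∀ i → 0# ≤ x i)
      (x≢0 : ¬ (∀ i → x i ≤ 0#)) (sub : ∀ i → (1# + κ) * x i ≤ a i ∙ x) where

      private
        atMaximum : ¬ ¬ (((1# + κ) * κ ≤ T) × ((1# + κ) * κ ≈ T → ∃[ u ] ∃[ v ] Book G u v))
        atMaximum none = maximum (ℕ.≤-trans (s≤s z≤n) 3≤n) x λ (u , u-max) →
          none (AtMaximum.conclusion κ κ>0 x x≥0 sub u u-max λ xu≤0 →
            x≢0 λ i → ≤-trans (u-max i) xu≤0)

      spectral-bound : (1# + κ) * κ ≤ T
      spectral-bound = ≤-stable λ ¬bound → atMaximum (¬bound ∘ proj₁)

      extremal⇒Book : (1# + κ) * κ ≈ T → ∃[ u ] ∃[ v ] Book G u v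
      extremal⇒Book eq = decidable-stable (Fin.any? λ u → Fin.any? λ v → book? G u v)
        λ ¬book → atMaximum λ (_ , book) → ¬book (book eq)

-- Comparison with the positive root, and an eigenvector of the book.

module Comparisons where

  open import Data.Bool.Base using (if_then_else_)
  open import Data.Fin.Base using (Fin)
  import Data.Fin.Properties as Fin
  import Data.Nat.Base as ℕ
  import Data.Nat.Properties as ℕ
  open import Data.Nat.Base using (ℕ; _∸_)
  open import Data.Product.Base using (∃-syntax; _×_; _,_)
  open import Data.Vec.Functional using (foldr)
  open import Algebra.Core using (Op₂)
  open import Level using (0ℓ)
  open import Relation.Binary.Core using (Rel)
  open import Data.Sum.Base using (inj₁; inj₂)
  open import Relation.Binary.PropositionalEquality as ≡ using (_≡_; _≢_; ≢-sym)
  open import Relation.Nullary.Decidable using (yes; no; does; _⊎-dec_)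
  open import Relation.Nullary.Negation using (¬_; contradiction)
  open EdgeBound using (_⊕_; δ; module Adjacency) renaming (sum to sumℕ)
  open Codegrees
  open OrderedSemirings
  open Books
  open Subeigenvectors

  module BookEigenvector (R : StableOrderedSemiring) {n} (G : Graph (Fin n)) {u v} (book : Book G u v) where
    open StableOrderedSemiring R hiding (zero)
    open OrderedSemiring R
    open Graph G
    open Adjacency G
    open Book book
    open import Algebra.Solver.Ring.NaturalCoefficients.Default commutativeSemiring

    page : Fin n → ℕ
    page j = 1 ∸ (δ u j ℕ.+ δ v j)

    δ+δ≤1 : ∀ j → δ u j ℕ.+ δ v j ℕ.≤ 1
    δ+δ≤1 j with u Fin.≟ j
    ... | yes ≡.refl = ℕ.≤-reflexive (≡.cong ℕ.suc (EdgeBound.δ-≢ (≢-sym u≢v)))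
    ... | no  _      = EdgeBound.δ≤1 v j

    sum-page : sumℕ page ≡ n ∸ 2
    sum-page = ≡.trans (≡.sym (ℕ.m+n∸m≡n 2 (sumℕ page))) (≡.cong (_∸ 2) (begin
      2 ℕ.+ sumℕ page                      ≡⟨ ≡.cong ℕ.suc (sum-δ⊕ v page) ⟨
      1 ℕ.+ sumℕ (δ v ⊕ page)              ≡⟨ sum-δ⊕ u (δ v ⊕ page) ⟨
      sumℕ (δ u ⊕ (δ v ⊕ page))            ≡⟨ EdgeBound.sum-cong-≗ (λ j → ≡.trans (≡.sym (ℕ.+-assoc (δ u j) (δ v j) (page j)))
                                                                  (ℕ.m+[n∸m]≡n (δ+δ≤1 j))) ⟩
      sumℕ {n} (λ _ → 1)                   ≡⟨ EdgeBound.sum-one n ⟩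
      n                                    ∎))
      where open ≡.≡-Reasoning

    hub₁-row : ∀ j → a u j ≡ (δ v ⊕ page) j
    hub₁-row j with u Fin.≟ j | v Fin.≟ j
    ... | yes ≡.refl | yes v≡u = contradiction (≡.sym v≡u) u≢v
    ... | yes ≡.refl | no _    = a-irrefl u
    ... | no u≢j     | yes _   = a-adj (hub₁ j (≢-sym u≢j))
    ... | no u≢j     | no _    = a-adj (hub₁ j (≢-sym u≢j))

    hub₂-row : ∀ j → a v j ≡ (δ u ⊕ page) j
    hub₂-row j with u Fin.≟ j | v Fin.≟ j
    ... | yes ≡.refl | yes v≡u = contradiction (≡.sym v≡u) u≢v
    ... | no _       | yes ≡.refl = a-irrefl v
    ... | yes _      | no v≢j  = a-adj (hub₂ j (≢-sym v≢j))
    ... | no _       | no v≢j  = a-adj (hub₂ j (≢-sym v≢j))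

    page-row : ∀ {i} → i ≢ u → i ≢ v → ∀ j → a i j ≡ (δ u ⊕ δ v) j
    page-row {i} i≢u i≢v j with u Fin.≟ j | v Fin.≟ j
    ... | yes ≡.refl | yes v≡u    = contradiction (≡.sym v≡u) u≢v
    ... | yes ≡.refl | no _       = a-adj (symm (hub₁ i i≢u))
    ... | no _       | yes ≡.refl = a-adj (symm (hub₂ i i≢v))
    ... | no u≢j     | no v≢j     = a-¬adj (pages i j i≢u i≢v (≢-sym u≢j) (≢-sym v≢j))

    module _ (μ : Carrier) (μ²≈μ+T : μ * μ ≈ μ + ι (2 ℕ.* (n ∸ 2))) where
      open import Relation.Binary.Reasoning.PartialOrder poset

      -- Value `μ` at the hubs and 2 on the pages, which avoids dividing by `μ`. The page rows read
      -- μ + μ = μ · 2, and the hub rows are the quadratic equation for `μ`.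
      eigenvector : Fin n → Carrier
      eigenvector j = if does ((u Fin.≟ j) ⊎-dec (v Fin.≟ j)) then μ else ι 2

      at-hub₁ : eigenvector u ≡ μ
      at-hub₁ with u Fin.≟ u
      ... | yes _  = ≡.refl
      ... | no u≢u = contradiction ≡.refl u≢u

      at-hub₂ : eigenvector v ≡ μ
      at-hub₂ with u Fin.≟ v | v Fin.≟ v
      ... | yes _ | _      = ≡.refl
      ... | no _  | yes _  = ≡.refl
      ... | no _  | no v≢v = contradiction ≡.refl v≢v

      page∙eigenvector : page ∙ eigenvector ≈ ι (2 ℕ.* (n ∸ 2))
      page∙eigenvector = begin-equality
        page ∙ eigenvector           ≈⟨ sum-cong-≋ pointwise ⟩
        page ∙ (λ _ → ι 2)           ≈⟨ ∙-const page (ι 2) ⟩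
        ι (sumℕ page) * ι 2          ≈⟨ *-comm _ _ ⟩
        ι 2 * ι (sumℕ page)          ≈⟨ *-congˡ (ι-cong sum-page) ⟩
        ι 2 * ι (n ∸ 2)              ≈⟨ ι-* 2 (n ∸ 2) ⟨
        ι (2 ℕ.* (n ∸ 2))            ∎
        where
        open import Algebra.Properties.Semiring.Sum semiring using (sum-cong-≋)
        pointwise : ∀ j → ι (page j) * eigenvector j ≈ ι (page j) * ι 2
        pointwise j with u Fin.≟ j | v Fin.≟ j
        ... | yes _ | yes _ = trans (zeroˡ μ) (sym (zeroˡ (ι 2)))
        ... | yes _ | no  _ = trans (zeroˡ μ) (sym (zeroˡ (ι 2)))
        ... | no  _ | yes _ = trans (zeroˡ μ) (sym (zeroˡ (ι 2)))
        ... | no  _ | no  _ = refl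

      hub-row : ∀ {i j} → eigenvector i ≡ μ → eigenvector j ≡ μ → (∀ k → a i k ≡ (δ j ⊕ page) k) →
        a i ∙ eigenvector ≈ μ * eigenvector i
      hub-row {i} {j} at-i at-j row = begin-equality
        a i ∙ eigenvector                        ≈⟨ ∙-cong eigenvector row ⟩
        (δ j ⊕ page) ∙ eigenvector               ≈⟨ ∙-distribʳ (δ j) page eigenvector ⟩
        δ j ∙ eigenvector + page ∙ eigenvector   ≈⟨ +-cong (trans (∙-δ j eigenvector) (reflexive at-j)) page∙eigenvector ⟩
        μ + ι (2 ℕ.* (n ∸ 2))                    ≈⟨ μ²≈μ+T ⟨
        μ * μ                                    ≡⟨ ≡.cong (μ *_) at-i ⟨
        μ * eigenvector i                        ∎

      isEigenvector : ∀ i → a i ∙ eigenvector ≈ μ * eigenvector i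
      isEigenvector i = go (u Fin.≟ i) (v Fin.≟ i)
        where
        at-page : u ≢ i → v ≢ i → eigenvector i ≡ ι 2
        at-page u≢i v≢i with u Fin.≟ i | v Fin.≟ i
        ... | yes u≡i | _       = contradiction u≡i u≢i
        ... | no _    | yes v≡i = contradiction v≡i v≢i
        ... | no _    | no _    = ≡.refl
        go : _ → _ → a i ∙ eigenvector ≈ μ * eigenvector i
        go (yes ≡.refl) _            = hub-row at-hub₁ at-hub₂ hub₁-row
        go (no _)       (yes ≡.refl) = hub-row at-hub₂ at-hub₁ hub₂-row
        go (no u≢i)     (no v≢i)     = begin-equality
          a i ∙ eigenvector                        ≈⟨ ∙-cong eigenvector (page-row (≢-sym u≢i) (≢-sym v≢i)) ⟩
          (δ u ⊕ δ v) ∙ eigenvector                ≈⟨ ∙-distribʳ (δ u) (δ v) eigenvector ⟩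
          δ u ∙ eigenvector + δ v ∙ eigenvector    ≈⟨ +-cong (trans (∙-δ u eigenvector) (reflexive at-hub₁))
                                                             (trans (∙-δ v eigenvector) (reflexive at-hub₂)) ⟩
          μ + μ                                    ≈⟨ solve 1 (λ m → m :+ m := m :* (con 1 :+ (con 1 :+ con 0))) refl μ ⟩
          μ * ι 2                                  ≡⟨ ≡.cong (μ *_) (at-page u≢i v≢i) ⟨
          μ * eigenvector i                        ∎

  module Comparison (R : StableOrderedSemiring) {n} (3≤n : 3 ℕ.≤ n)
    (G : Graph (Fin n)) (noDCC : ¬ ContainsDoublyChordedCycle G) where

    open StableOrderedSemiring R hiding (zero)
    open OrderedSemiring R
    open Adjacency G
    open Subeigenvector R 3≤n G noDCC
    open import Relation.Binary.Reasoning.PartialOrder poset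
    open import Algebra.Solver.Ring.NaturalCoefficients.Default commutativeSemiring

    module _ {ν} (ν>0 : ¬ ν ≤ 0#) (root : (1# + ν) * ν ≈ T) where

      -- t ↦ (1 + t) t is strictly increasing for t ≥ 0.
      root-largest : ∀ {d} → 0# ≤ d → (1# + (ν + d)) * (ν + d) ≤ T → d ≤ 0#
      root-largest {d} d≥0 bound = +≤0ˡ (+-nonNeg (*-nonNeg (+-nonNeg ν≥0 ν≥0) d≥0) (*-nonNeg d≥0 d≥0))
        (+-cancelʳ-≤ T (begin
          d + ((ν + ν) * d + d * d) + T                  ≈⟨ +-congˡ root ⟨
          d + ((ν + ν) * d + d * d) + (1# + ν) * ν       ≈⟨ solve 2 (λ v d → d :+ ((v :+ v) :* d :+ d :* d) :+ (con 1 :+ v) :* v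
                                                              := (con 1 :+ (v :+ d)) :* (v :+ d)) refl ν d ⟩
          (1# + (ν + d)) * (ν + d)                       ≤⟨ bound ⟩
          T                                              ≈⟨ +-identityˡ T ⟨
          0# + T                                         ∎))
        where ν≥0 = pos⇒nonNeg ν>0

      root-square : ∀ {μ} → 1# + ν ≈ μ → μ * μ ≈ μ + ι (2 ℕ.* (n ∸ 2))
      root-square {μ} 1+ν≈μ = begin-equality
        μ * μ                        ≈⟨ *-cong 1+ν≈μ 1+ν≈μ ⟨
        (1# + ν) * (1# + ν)          ≈⟨ solve 1 (λ v → (con 1 :+ v) :* (con 1 :+ v) := (con 1 :+ v) :+ (con 1 :+ v) :* v) refl ν ⟩
        (1# + ν) + (1# + ν) * ν      ≈⟨ +-cong 1+ν≈μ root ⟩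
        μ + T                        ∎

      root-positive : ∀ {μ} → 1# + ν ≈ μ → ¬ μ ≤ 0#
      root-positive 1+ν≈μ μ≤0 = ν>0 (+≤0ʳ 0≤1 (≤-trans (≤-reflexive 1+ν≈μ) μ≤0))

      module _ {μ ρ} (1+ν≈μ : 1# + ν ≈ μ) {x : Fin n → Carrier} (x≥0 : ∀ i → 0# ≤ x i)
        (x≢0 : ¬ (∀ i → x i ≤ 0#)) (sub : ∀ i → ρ * x i ≤ a i ∙ x) where

        private
          subeigen : ∀ {κ} → 1# + κ ≈ ρ → ∀ i → (1# + κ) * x i ≤ a i ∙ x
          subeigen 1+κ≈ρ i = ≤-trans (≤-reflexive (*-congʳ 1+κ≈ρ)) (sub i)

        -- Only the case `μ ≤ ρ` needs work: there `ρ` is `1# + (ν + d)`, which has the shape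
        -- required by `spectral-bound`, and `root-largest` gives `d ≤ 0#`.
        ≤-root : ρ ≤ μ
        ≤-root = ≤-stable λ ρ≰μ → ≤-total ρ μ λ { (inj₁ ρ≤μ) → ρ≰μ ρ≤μ ; (inj₂ μ≤ρ) → ρ≰μ (below μ≤ρ) }
          where
          below : μ ≤ ρ → ρ ≤ μ
          below μ≤ρ with difference-≥0 μ≤ρ
          ... | d , d≥0 , μ+d≈ρ = begin
            ρ          ≈⟨ μ+d≈ρ ⟨
            μ + d      ≤⟨ +-mono-≤ ≤-refl (root-largest d≥0 (spectral-bound
                            (λ ν+d≤0 → ν>0 (+≤0ˡ d≥0 ν+d≤0)) x≥0 x≢0 (subeigen 1+ν+d≈ρ))) ⟩
            μ + 0#     ≈⟨ +-identityʳ μ ⟩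
            μ          ∎
            where
            1+ν+d≈ρ : 1# + (ν + d) ≈ ρ
            1+ν+d≈ρ = trans (sym (+-assoc 1# ν d)) (trans (+-congʳ 1+ν≈μ) μ+d≈ρ)

        ≈-root⇒Book : ρ ≈ μ → ∃[ u ] ∃[ v ] Book G u v
        ≈-root⇒Book ρ≈μ = extremal⇒Book ν>0 x≥0 x≢0 (subeigen (trans 1+ν≈μ (sym ρ≈μ))) root

  -- With bare operations as parameters, the types obtained for ℝ contain no record
  -- projections; comparing terms up to such projections would unfold the arithmetic
  -- of ℚ, which does not terminate in reasonable time.
  module Interface {C : Set} {_≈_ _≤_ : Rel C 0ℓ} {_+_ _*_ : Op₂ C} {0# 1# : C}
    (isStableOrderedSemiring : IsStableOrderedSemiring _≈_ _≤_ _+_ _*_ 0# 1#)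
    (ι : ℕ → C) (ι-zero : ι 0 ≡ 0#) (ι-suc : ∀ m → ι (ℕ.suc m) ≡ 1# + ι m)
    (sum : ∀ {n} → (Fin n → C) → C)
    (sum≡ : ∀ {n} (f : Fin n → C) → sum f ≡ foldr _+_ 0# f)
    (n : ℕ) (3≤n : 3 ℕ.≤ n) (G : Graph (Fin n)) (noDCC : ¬ ContainsDoublyChordedCycle G) where

    private
      R : StableOrderedSemiring
      R = record { isStableOrderedSemiring = isStableOrderedSemiring }

    open StableOrderedSemiring R using (reflexive; trans; sym; *-congʳ; ≤-reflexive; ≤-trans; semiring)
    open OrderedSemiring R using (_∙_) renaming (ι to ι′)
    open import Algebra.Properties.Semiring.Sum semiring using (sum-cong-≋)
    open Adjacency G

    ι≡ : ∀ m → ι m ≡ ι′ m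
    ι≡ ℕ.zero    = ι-zero
    ι≡ (ℕ.suc m) = ≡.trans (ι-suc m) (≡.cong (1# +_) (ι≡ m))

    row : (Fin n → C) → Fin n → C
    row x i = sum λ j → ι (a i j) * x j

    row≈ : ∀ x i → row x i ≈ (a i ∙ x)
    row≈ x i = trans (reflexive (sum≡ λ j → ι (a i j) * x j)) (sum-cong-≋ λ j → *-congʳ (reflexive (ι≡ (a i j))))

    module _ {ν μ} (ν>0 : ¬ ν ≤ 0#) (1+ν≈μ : (1# + ν) ≈ μ)
      (root : ((1# + ν) * ν) ≈ ι (2 ℕ.* (n ∸ 2))) where

      private
        root′ = trans root (reflexive (ι≡ (2 ℕ.* (n ∸ 2))))
        open Comparison R 3≤n G noDCC

      module _ {ρ} {x : Fin n → C} (x≥0 : ∀ i → 0# ≤ x i) (x≢0 : ¬ (∀ i → x i ≤ 0#))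
        (sub : ∀ i → (ρ * x i) ≤ (sum λ j → ι (Adjacency.a G i j) * x j)) where

        private
          sub′ : ∀ i → (ρ * x i) ≤ (a i ∙ x)
          sub′ i = ≤-trans (sub i) (≤-reflexive (row≈ x i))

        subeigenvalue-≤ : ρ ≤ μ
        subeigenvalue-≤ = ≤-root ν>0 root′ 1+ν≈μ x≥0 x≢0 sub′

        subeigenvalue-≈⇒Book : ρ ≈ μ → ∃[ u ] ∃[ v ] Book G u v
        subeigenvalue-≈⇒Book = ≈-root⇒Book ν>0 root′ 1+ν≈μ x≥0 x≢0 sub′

      Book⇒eigenvector : ∀ {u v} → Book G u v →
        ∃[ x ] (¬ (∀ i → x i ≈ 0#) × (∀ i → (sum λ j → ι (Adjacency.a G i j) * x j) ≈ (μ * x i)))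
      Book⇒eigenvector {u} book = eigenvector μ square ,
        (λ x≈0 → root-positive ν>0 root′ 1+ν≈μ (≤-reflexive (≡.subst (_≈ 0#) (at-hub₁ μ square) (x≈0 u)))) ,
        λ i → trans (row≈ (eigenvector μ square) i) (isEigenvector μ square i)
        where
        open BookEigenvector R G book
        square = root-square ν>0 root′ 1+ν≈μ

-- The Cauchy reals as a stable ordered semiring.

module Reals where

  open OrderedSemirings using (IsStableOrderedSemiring)
  open import Algebra.Structures using (IsCommutativeSemiring)
  open import Data.Integer.Base using (+_)
  import Data.Nat.Base as ℕ
  import Data.Nat.Properties as ℕ
  open import Data.Nat.Base using (ℕ)
  open import Data.Product.Base using (∃-syntax; _×_; _,_)
  open import Data.Rational.Base hiding (_≃_)
  import Data.Rational.Properties as ℚ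
  open import Data.Rational.Solver using (module +-*-Solver)
  open import Data.Sum.Base using (_⊎_; inj₁; inj₂; [_,_]′)
  open import Function.Base using (id; _∘_)
  open import Relation.Binary.PropositionalEquality
  open import Relation.Binary.Structures using (IsEquivalence; IsPartialOrder)
  open import Relation.Nullary.Decidable using (yes; no)
  open import Relation.Nullary.Negation using (¬_; contradiction)
  open +-*-Solver

  both : ∀ {P Q : ℕ → Set} → Eventually P → Eventually Q → Eventually λ n → P n × Q n
  both (M , p) (N , q) = M ℕ.⊔ N , λ n≥ → p (ℕ.m⊔n≤o⇒m≤o M N n≥) , q (ℕ.m⊔n≤o⇒n≤o M N n≥)

  weaken : ∀ {P Q : ℕ → Set} → (∀ {n} → P n → Q n) → Eventually P → Eventually Q
  weaken f (N , p) = N , f ∘ p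

  -- Turns an inequality between rationals into a ring identity with an explicit nonnegative
  -- difference, fit for the ring solver.
  by-slack : ∀ {p q} d → 0ℚ ≤ d → p + d ≡ q → p ≤ q
  by-slack {p} d 0≤d eq = subst₂ _≤_ (ℚ.+-identityʳ p) eq (ℚ.+-monoʳ-≤ p 0≤d)

  0≤gap : ∀ {p q} → p ≤ q → 0ℚ ≤ q - p
  0≤gap {p} {q} p≤q = subst (_≤ q - p) (ℚ.+-inverseʳ p) (ℚ.+-monoˡ-≤ (- p) p≤q)

  +-nonNegℚ : ∀ {p q} → 0ℚ ≤ p → 0ℚ ≤ q → 0ℚ ≤ p + q
  +-nonNegℚ = ℚ.+-mono-≤

  *-nonNegℚ : ∀ {p q} → 0ℚ ≤ p → 0ℚ ≤ q → 0ℚ ≤ p * q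
  *-nonNegℚ {p} {q} 0≤p 0≤q = subst (_≤ p * q) (ℚ.*-zeroʳ p) (ℚ.*-monoˡ-≤-nonNeg p {{nonNegative 0≤p}} 0≤q)

  *-posℚ : ∀ {p q} → 0ℚ < p → 0ℚ < q → 0ℚ < p * q
  *-posℚ {p} {q} 0<p 0<q = ℚ.positive⁻¹ (p * q) {{ℚ.pos*pos⇒pos p {{positive 0<p}} q {{positive 0<q}}}}

  0<½ : 0ℚ < ½
  0<½ = ℚ.positive⁻¹ ½

  ⅕ : ℚ
  ⅕ = + 1 / 5

  p≤∣p∣ : ∀ p → p ≤ ∣ p ∣
  p≤∣p∣ p with ℚ.≤-total 0ℚ p
  ... | inj₁ 0≤p = ℚ.≤-reflexive (sym (ℚ.0≤p⇒∣p∣≡p 0≤p))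
  ... | inj₂ p≤0 = ℚ.≤-trans p≤0 (ℚ.0≤∣p∣ p)

  ∣p-q∣≤⇒p≤q+ : ∀ p q e → ∣ p - q ∣ ≤ e → p ≤ q + e
  ∣p-q∣≤⇒p≤q+ p q e h = by-slack (e - (p - q)) (0≤gap (ℚ.≤-trans (p≤∣p∣ (p - q)) h))
    (solve 3 (λ p q e → p :+ (e :- (p :- q)) := q :+ e) refl p q e)

  ∣p-q∣≡∣q-p∣ : ∀ p q → ∣ p - q ∣ ≡ ∣ q - p ∣
  ∣p-q∣≡∣q-p∣ p q = trans (sym (ℚ.∣-p∣≡∣p∣ (p - q)))
    (cong ∣_∣ (solve 2 (λ p q → :- (p :- q) := q :- p) refl p q))

  ∣p-q∣≤⇒q≤p+ : ∀ p q e → ∣ p - q ∣ ≤ e → q ≤ p + e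
  ∣p-q∣≤⇒q≤p+ p q e h = ∣p-q∣≤⇒p≤q+ q p e (subst (_≤ e) (∣p-q∣≡∣q-p∣ p q) h)

  ≤⇒∣p-q∣≤ : ∀ p q e → p ≤ q + e → q ≤ p + e → ∣ p - q ∣ ≤ e
  ≤⇒∣p-q∣≤ p q e p≤ q≤ with ℚ.∣p∣≡p∨∣p∣≡-p (p - q)
  ... | inj₁ eq = subst (_≤ e) (sym eq) (by-slack (q + e - p) (0≤gap p≤)
                    (solve 3 (λ p q e → p :- q :+ (q :+ e :- p) := e) refl p q e))
  ... | inj₂ eq = subst (_≤ e) (sym eq) (by-slack (p + e - q) (0≤gap q≤)
                    (solve 3 (λ p q e → :- (p :- q) :+ (p :+ e :- q) := e) refl p q e))

  divide : ∀ {ε K} → 0ℚ < ε → 0ℚ < K → ∃[ η ] (0ℚ < η × K * η ≡ ε)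
  divide {ε} {K} 0<ε 0<K = 1/ K * ε , *-posℚ (ℚ.positive⁻¹ (1/ K) {{ℚ.1/pos⇒pos K}}) 0<ε ,
    trans (sym (ℚ.*-assoc K (1/ K) ε)) (trans (cong (_* ε) (ℚ.*-inverseʳ K)) (ℚ.*-identityˡ ε))
    where
    instance
      _ = positive 0<K
      _ = ℚ.pos⇒nonZero K {{positive 0<K}}

  ½ε+½ε : ∀ p ε → p + ½ * ε + ½ * ε ≡ p + ε
  ½ε+½ε = solve 2 (λ p ε → p :+ con ½ :* ε :+ con ½ :* ε := p :+ ε) refl

  pointwise-≤ : ∀ x y → (∀ n → seq x n ≤ seq y n) → x ≤ℝ y
  pointwise-≤ x y h ε 0<ε = 0 , λ {n} _ → ℚ.≤-trans (h n) (by-slack ε (ℚ.<⇒≤ 0<ε) refl)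

  ≤ℝ-trans : ∀ x y z → x ≤ℝ y → y ≤ℝ z → x ≤ℝ z
  ≤ℝ-trans x y z x≤y y≤z ε 0<ε = weaken
    (λ {n} (p , q) → ℚ.≤-trans p (ℚ.≤-trans (ℚ.+-monoˡ-≤ (½ * ε) q) (ℚ.≤-reflexive (½ε+½ε (seq z n) ε))))
    (both (x≤y (½ * ε) (*-posℚ 0<½ 0<ε)) (y≤z (½ * ε) (*-posℚ 0<½ 0<ε)))

  ≃⇒≤ : ∀ x y → x ≃ y → x ≤ℝ y
  ≃⇒≤ x y x≃y ε 0<ε = weaken (λ {n} → ∣p-q∣≤⇒p≤q+ (seq x n) (seq y n) ε) (x≃y ε 0<ε)

  ≃⇒≥ : ∀ x y → x ≃ y → y ≤ℝ x
  ≃⇒≥ x y x≃y ε 0<ε = weaken (λ {n} → ∣p-q∣≤⇒q≤p+ (seq x n) (seq y n) ε) (x≃y ε 0<ε)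

  ≤ℝ-antisym : ∀ x y → x ≤ℝ y → y ≤ℝ x → x ≃ y
  ≤ℝ-antisym x y x≤y y≤x ε 0<ε = weaken (λ {n} (p , q) → ≤⇒∣p-q∣≤ (seq x n) (seq y n) ε p q) (both (x≤y ε 0<ε) (y≤x ε 0<ε))

  pointwise-≃ : ∀ x y → (∀ n → seq x n ≡ seq y n) → x ≃ y
  pointwise-≃ x y h = ≤ℝ-antisym x y (pointwise-≤ x y λ n → ℚ.≤-reflexive (h n))
                                     (pointwise-≤ y x λ n → ℚ.≤-reflexive (sym (h n)))

  ≃-isEquivalence : IsEquivalence _≃_
  ≃-isEquivalence = record
    { refl  = λ {x} → pointwise-≃ x x λ _ → refl
    ; sym   = λ {x} {y} x≃y → ≤ℝ-antisym y x (≃⇒≥ x y x≃y) (≃⇒≤ x y x≃y)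
    ; trans = λ {x} {y} {z} x≃y y≃z → ≤ℝ-antisym x z
        (≤ℝ-trans x y z (≃⇒≤ x y x≃y) (≃⇒≤ y z y≃z)) (≤ℝ-trans z y x (≃⇒≥ y z y≃z) (≃⇒≥ x y x≃y))
    }

  ≤ℝ-isPartialOrder : IsPartialOrder _≃_ _≤ℝ_
  ≤ℝ-isPartialOrder = record
    { isPreorder = record
      { isEquivalence = ≃-isEquivalence
      ; reflexive     = λ {x} {y} → ≃⇒≤ x y
      ; trans         = λ {x} {y} {z} → ≤ℝ-trans x y z
      }
    ; antisym = λ {x} {y} → ≤ℝ-antisym x y
    }

  bounded : ∀ x → ∃[ B ] (0ℚ < B × Eventually λ n → ∣ seq x n ∣ ≤ B)
  bounded x with cauchy x 1ℚ (ℚ.positive⁻¹ 1ℚ)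
  ... | N , h = ∣ seq x N ∣ + 1ℚ , ℚ.+-mono-≤-< (ℚ.0≤∣p∣ (seq x N)) (ℚ.positive⁻¹ 1ℚ) , N , λ {n} n≥ →
    ℚ.≤-trans (subst (_≤ ∣ seq x N ∣ + ∣ seq x n - seq x N ∣)
                (cong ∣_∣ (solve 2 (λ p q → q :+ (p :- q) := p) refl (seq x n) (seq x N)))
                (ℚ.∣p+q∣≤∣p∣+∣q∣ (seq x N) (seq x n - seq x N)))
              (ℚ.+-monoʳ-≤ ∣ seq x N ∣ (h n≥ ℕ.≤-refl))

  +ℝ-mono-≤ : ∀ w x y z → w ≤ℝ x → y ≤ℝ z → w +ℝ y ≤ℝ x +ℝ z
  +ℝ-mono-≤ w x y z w≤x y≤z ε 0<ε = weaken
    (λ {n} (p , q) → ℚ.≤-trans (ℚ.+-mono-≤ p q) (ℚ.≤-reflexive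
      (solve 3 (λ x z ε → (x :+ con ½ :* ε) :+ (z :+ con ½ :* ε) := x :+ z :+ ε) refl (seq x n) (seq z n) ε)))
    (both (w≤x (½ * ε) (*-posℚ 0<½ 0<ε)) (y≤z (½ * ε) (*-posℚ 0<½ 0<ε)))

  +ℝ-cancelʳ-≤ : ∀ z x y → x +ℝ z ≤ℝ y +ℝ z → x ≤ℝ y
  +ℝ-cancelʳ-≤ z x y h ε 0<ε = weaken
    (λ {n} p → by-slack (seq y n + seq z n + ε - (seq x n + seq z n)) (0≤gap p)
      (solve 4 (λ x y z ε → x :+ (y :+ z :+ ε :- (x :+ z)) := y :+ ε) refl (seq x n) (seq y n) (seq z n) ε))
    (h ε 0<ε)

  +ℝ-cong : ∀ {w x y z} → w ≃ x → y ≃ z → w +ℝ y ≃ x +ℝ z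
  +ℝ-cong {w} {x} {y} {z} w≃x y≃z = ≤ℝ-antisym (w +ℝ y) (x +ℝ z)
    (+ℝ-mono-≤ w x y z (≃⇒≤ w x w≃x) (≃⇒≤ y z y≃z)) (+ℝ-mono-≤ x w z y (≃⇒≥ w x w≃x) (≃⇒≥ y z y≃z))

  *ℝ-comm : ∀ x y → x *ℝ y ≃ y *ℝ x
  *ℝ-comm x y = pointwise-≃ (x *ℝ y) (y *ℝ x) λ n → ℚ.*-comm (seq x n) (seq y n)

  ∣xy-xz∣≤ : ∀ x y z {B η} → ∣ x ∣ ≤ B → ∣ y - z ∣ ≤ η → ∣ x * y - x * z ∣ ≤ B * η
  ∣xy-xz∣≤ x y z {B} {η} ∣x∣≤B ∣y-z∣≤η = begin
    ∣ x * y - x * z ∣    ≡⟨ cong ∣_∣ factor ⟩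
    ∣ x * (y - z) ∣      ≡⟨ ℚ.∣p*q∣≡∣p∣*∣q∣ x (y - z) ⟩
    ∣ x ∣ * ∣ y - z ∣    ≤⟨ ℚ.*-monoʳ-≤-nonNeg ∣ y - z ∣ {{nonNegative (ℚ.0≤∣p∣ (y - z))}} ∣x∣≤B ⟩
    B * ∣ y - z ∣        ≤⟨ ℚ.*-monoˡ-≤-nonNeg B {{nonNegative (ℚ.≤-trans (ℚ.0≤∣p∣ x) ∣x∣≤B)}} ∣y-z∣≤η ⟩
    B * η                ∎
    where
    open ℚ.≤-Reasoning
    factor : x * y - x * z ≡ x * (y - z)
    factor = solve 3 (λ x y z → x :* y :- x :* z := x :* (y :- z)) refl x y z

  *ℝ-congˡ : ∀ x y z → y ≃ z → x *ℝ y ≃ x *ℝ z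
  *ℝ-congˡ x y z y≃z ε 0<ε =
    let B , 0<B , x≤B = bounded x
        η , 0<η , Bη≡ε = divide 0<ε 0<B
    in weaken (λ {n} (p , q) → subst (∣ seq x n * seq y n - seq x n * seq z n ∣ ≤_) Bη≡ε
                                 (∣xy-xz∣≤ (seq x n) (seq y n) (seq z n) {B} {η} p q))
              (both x≤B (y≃z η 0<η))

  ℝ-isCommutativeSemiring : IsCommutativeSemiring _≃_ _+ℝ_ _*ℝ_ 0ℝ 1ℝ
  ℝ-isCommutativeSemiring = record
    { isSemiring = record
      { isSemiringWithoutAnnihilatingZero = record
        { +-isCommutativeMonoid = record
          { isMonoid = record
            { isSemigroup = record
              { isMagma = record { isEquivalence = ≃-isEquivalence ; ∙-cong = λ {w} {x} {y} {z} → +ℝ-cong {w} {x} {y} {z} }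
              ; assoc = λ x y z → pointwise-≃ (x +ℝ y +ℝ z) (x +ℝ (y +ℝ z)) λ n → ℚ.+-assoc (seq x n) (seq y n) (seq z n)
              }
            ; identity = (λ x → pointwise-≃ (0ℝ +ℝ x) x λ n → ℚ.+-identityˡ (seq x n))
                       , (λ x → pointwise-≃ (x +ℝ 0ℝ) x λ n → ℚ.+-identityʳ (seq x n))
            }
          ; comm = λ x y → pointwise-≃ (x +ℝ y) (y +ℝ x) λ n → ℚ.+-comm (seq x n) (seq y n)
          }
        ; *-cong = λ {w} {x} {y} {z} w≃x y≃z → IsEquivalence.trans ≃-isEquivalence {w *ℝ y} {w *ℝ z} {x *ℝ z}
            (*ℝ-congˡ w y z y≃z) (IsEquivalence.trans ≃-isEquivalence {w *ℝ z} {z *ℝ w} {x *ℝ z} (*ℝ-comm w z)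
              (IsEquivalence.trans ≃-isEquivalence {z *ℝ w} {z *ℝ x} {x *ℝ z} (*ℝ-congˡ z w x w≃x) (*ℝ-comm z x)))
        ; *-assoc = λ x y z → pointwise-≃ (x *ℝ y *ℝ z) (x *ℝ (y *ℝ z)) λ n → ℚ.*-assoc (seq x n) (seq y n) (seq z n)
        ; *-identity = (λ x → pointwise-≃ (1ℝ *ℝ x) x λ n → ℚ.*-identityˡ (seq x n))
                     , (λ x → pointwise-≃ (x *ℝ 1ℝ) x λ n → ℚ.*-identityʳ (seq x n))
        ; distrib = (λ x y z → pointwise-≃ (x *ℝ (y +ℝ z)) (x *ℝ y +ℝ x *ℝ z)
                       λ n → ℚ.*-distribˡ-+ (seq x n) (seq y n) (seq z n))
                  , (λ x y z → pointwise-≃ ((y +ℝ z) *ℝ x) (y *ℝ x +ℝ z *ℝ x)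
                       λ n → ℚ.*-distribʳ-+ (seq x n) (seq y n) (seq z n))
        }
      ; zero = (λ x → pointwise-≃ (0ℝ *ℝ x) 0ℝ λ n → ℚ.*-zeroˡ (seq x n))
             , (λ x → pointwise-≃ (x *ℝ 0ℝ) 0ℝ λ n → ℚ.*-zeroʳ (seq x n))
      }
    ; *-comm = *ℝ-comm
    }

  -- (x + η)(w + η) ≥ 0 bounds x w from below by - η (x + w + η).
  product-≥ : ∀ {x w η K ε} → 0ℚ ≤ x + η → 0ℚ ≤ w + η → 0ℚ ≤ η → x + w + η ≤ K → K * η ≤ ε → 0ℚ ≤ x * w + ε
  product-≥ {x} {w} {η} {K} {ε} 0≤x+η 0≤w+η 0≤η ≤K Kη≤ε = by-slack
    ((x + η) * (w + η) + η * (K - (x + w + η)) + (ε - K * η))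
    (+-nonNegℚ (+-nonNegℚ (*-nonNegℚ 0≤x+η 0≤w+η) (*-nonNegℚ 0≤η (0≤gap ≤K))) (0≤gap Kη≤ε))
    (solve 5 (λ x w η K ε → con 0ℚ :+ ((x :+ η) :* (w :+ η) :+ η :* (K :- (x :+ w :+ η)) :+ (ε :- K :* η)) := x :* w :+ ε)
      refl x w η K ε)

  *ℝ-monoˡ-≤ : ∀ x y z → 0ℝ ≤ℝ x → y ≤ℝ z → x *ℝ y ≤ℝ x *ℝ z
  *ℝ-monoˡ-≤ x y z 0≤x y≤z ε 0<ε =
    let A , 0<A , x≤A = bounded x
        B , 0<B , y≤B = bounded y
        C , 0<C , z≤C = bounded z
        -- An eventual bound on `x + (z - y) + η`, the final `1ℚ` making room for `η`.
        K = A + (C + B) + 1ℚ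
        0<K = ℚ.+-mono-< (ℚ.+-mono-< 0<A (ℚ.+-mono-< 0<C 0<B)) 0<1
        η′ , 0<η′ , Kη′≡ε = divide 0<ε 0<K
        η , 0<η , η≤η′ , η≤1 = below 0<η′
        Kη≤ε = ℚ.≤-trans (ℚ.*-monoˡ-≤-nonNeg K {{nonNegative (ℚ.<⇒≤ 0<K)}} η≤η′) (ℚ.≤-reflexive Kη′≡ε)
    in weaken
      (λ {n} ((0≤x+η , y≤z+η) , (∣x∣≤A , (∣y∣≤B , ∣z∣≤C))) → rearrange {seq x n} {seq y n} {seq z n} {ε}
        (product-≥ {seq x n} {seq z n - seq y n} {η} {K} {ε} 0≤x+η (shift {seq y n} {seq z n} y≤z+η) (ℚ.<⇒≤ 0<η)
          (ℚ.+-mono-≤ (ℚ.+-mono-≤ (ℚ.≤-trans (p≤∣p∣ (seq x n)) ∣x∣≤A)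
            (ℚ.+-mono-≤ (ℚ.≤-trans (p≤∣p∣ (seq z n)) ∣z∣≤C)
              (ℚ.≤-trans (p≤∣p∣ (- seq y n)) (subst (_≤ B) (sym (ℚ.∣-p∣≡∣p∣ (seq y n))) ∣y∣≤B)))) η≤1) Kη≤ε))
      (both (both (0≤x η 0<η) (y≤z η 0<η)) (both x≤A (both y≤B z≤C)))
    where
    0<1 = ℚ.positive⁻¹ 1ℚ
    below : ∀ {p} → 0ℚ < p → ∃[ η ] (0ℚ < η × η ≤ p × η ≤ 1ℚ)
    below {p} 0<p with ℚ.≤-total p 1ℚ
    ... | inj₁ p≤1 = p , 0<p , ℚ.≤-refl , p≤1
    ... | inj₂ 1≤p = 1ℚ , 0<1 , 1≤p , ℚ.≤-refl
    shift : ∀ {p q e} → p ≤ q + e → 0ℚ ≤ q - p + e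
    shift {p} {q} {e} h = subst (0ℚ ≤_) (solve 3 (λ p q e → q :+ e :- p := q :- p :+ e) refl p q e) (0≤gap h)
    rearrange : ∀ {x y z e} → 0ℚ ≤ x * (z - y) + e → x * y ≤ x * z + e
    rearrange {x} {y} {z} {e} h = by-slack (x * (z - y) + e) h
      (solve 4 (λ x y z e → x :* y :+ (x :* (z :- y) :+ e) := x :* z :+ e) refl x y z e)

  -- Decides between approximations that are within e = ε / 5 of the limits.
  compare : ∀ x y ε → 0ℚ < ε →
    (Eventually λ n → seq x n ≤ seq y n + ε) ⊎ (∃[ η ] (0ℚ < η × Eventually λ n → seq y n + η ≤ seq x n))
  compare x y ε 0<ε =
    let M , hx = cauchy x e 0<e
        N , hy = cauchy y e 0<e
        K      = M ℕ.⊔ N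
    in decide K (λ n≥ → hx (ℕ.m≤m⊔n M N) (ℕ.m⊔n≤o⇒m≤o M N n≥)) (λ n≥ → hy (ℕ.m≤n⊔m M N) (ℕ.m⊔n≤o⇒n≤o M N n≥))
    where
    e = ⅕ * ε
    0<e : 0ℚ < e
    0<e = *-posℚ (ℚ.positive⁻¹ ⅕) 0<ε
    fifths : e + e + e + e + e ≡ ε
    fifths = solve 1 (λ ε → con ⅕ :* ε :+ con ⅕ :* ε :+ con ⅕ :* ε :+ con ⅕ :* ε :+ con ⅕ :* ε := ε) refl ε
    near : ∀ {x X y Y e} → x ≤ X + e → X ≤ Y + (e + e + e) → Y ≤ y + e → x ≤ y + (e + e + e + e + e)
    near {x} {X} {y} {Y} {e} x≤X X≤Y Y≤y = ℚ.≤-trans x≤X (ℚ.≤-trans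
      (ℚ.+-monoˡ-≤ e (ℚ.≤-trans X≤Y (ℚ.+-monoˡ-≤ (e + e + e) Y≤y)))
      (ℚ.≤-reflexive (solve 2 (λ y e → y :+ e :+ (e :+ e :+ e) :+ e := y :+ (e :+ e :+ e :+ e :+ e)) refl y e)))
    far : ∀ {x X y Y e} → X ≤ x + e → Y + (e + e + e) ≤ X → y ≤ Y + e → y + e ≤ x
    far {x} {X} {y} {Y} {e} X≤x Y≤X y≤Y = by-slack ((x + e - X) + (X - (Y + (e + e + e))) + (Y + e - y))
      (+-nonNegℚ (+-nonNegℚ (0≤gap X≤x) (0≤gap Y≤X)) (0≤gap y≤Y))
      (solve 5 (λ x X y Y e → y :+ e :+ ((x :+ e :- X) :+ (X :- (Y :+ (e :+ e :+ e))) :+ (Y :+ e :- y)) := x) refl x X y Y e)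
    decide : ∀ K → (∀ {n} → K ℕ.≤ n → ∣ seq x K - seq x n ∣ ≤ e) → (∀ {n} → K ℕ.≤ n → ∣ seq y K - seq y n ∣ ≤ e) →
      (Eventually λ n → seq x n ≤ seq y n + ε) ⊎ (∃[ η ] (0ℚ < η × Eventually λ n → seq y n + η ≤ seq x n))
    decide K hx hy with seq x K ℚ.≤? seq y K + (e + e + e)
    ... | yes x≤y = inj₁ (K , λ {n} n≥ → subst (λ t → seq x n ≤ seq y n + t) fifths
            (near {seq x n} {seq x K} {seq y n} {seq y K} {e}
              (∣p-q∣≤⇒q≤p+ (seq x K) (seq x n) e (hx n≥)) x≤y (∣p-q∣≤⇒p≤q+ (seq y K) (seq y n) e (hy n≥))))
    ... | no x≰y = inj₂ (e , 0<e , K , λ {n} n≥ →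
            far {seq x n} {seq x K} {seq y n} {seq y K} {e}
              (∣p-q∣≤⇒p≤q+ (seq x K) (seq x n) e (hx n≥)) (ℚ.<⇒≤ (ℚ.≰⇒> x≰y))
              (∣p-q∣≤⇒q≤p+ (seq y K) (seq y n) e (hy n≥)))

  separated⇒≰ : ∀ x y → (∃[ η ] (0ℚ < η × Eventually λ n → seq y n + η ≤ seq x n)) → ¬ x ≤ℝ y
  separated⇒≰ x y (η , 0<η , sep) x≤y with both sep (x≤y (½ * η) (*-posℚ 0<½ 0<η))
  ... | N , h = let y+η≤x , x≤y+½η = h {N} ℕ.≤-refl in
      apart (seq x N) (seq y N) y+η≤x x≤y+½η
    where
    ½η<η : ½ * η < η
    ½η<η = subst₂ _<_ (ℚ.+-identityˡ (½ * η)) (solve 1 (λ η → con ½ :* η :+ con ½ :* η := η) refl η)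
             (ℚ.+-monoˡ-< (½ * η) (*-posℚ 0<½ 0<η))
    apart : ∀ p q → q + η ≤ p → ¬ p ≤ q + ½ * η
    apart p q q+η≤p p≤q+½η = ℚ.<-irrefl refl (ℚ.<-≤-trans (ℚ.+-monoʳ-< q ½η<η) (ℚ.≤-trans q+η≤p p≤q+½η))

  -- At each tolerance `compare` returns either the estimate wanted or a positive gap, and a gap
  -- refutes `x ≤ℝ y`.
  ≤ℝ-stable : ∀ x y → ¬ ¬ x ≤ℝ y → x ≤ℝ y
  ≤ℝ-stable x y ¬¬x≤y ε 0<ε =
    [ id , (λ sep → contradiction (separated⇒≰ x y sep) ¬¬x≤y) ]′ (compare x y ε 0<ε)

  ≤ℝ-total : ∀ x y → ¬ ¬ (x ≤ℝ y ⊎ y ≤ℝ x)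
  ≤ℝ-total x y none = none (inj₂ λ ε 0<ε →
    [ id , (λ sep → contradiction (inj₁ (x≤y sep)) none) ]′ (compare y x ε 0<ε))
    where
    drop : ∀ p q {η ε} → p + η ≤ q → 0ℚ ≤ η → 0ℚ ≤ ε → p ≤ q + ε
    drop p q {η} {ε} p+η≤q 0≤η 0≤ε = ℚ.≤-trans (by-slack η 0≤η refl) (ℚ.≤-trans p+η≤q (by-slack ε 0≤ε refl))
    x≤y : (∃[ η ] (0ℚ < η × Eventually λ n → seq x n + η ≤ seq y n)) → x ≤ℝ y
    x≤y (η , 0<η , sep) ε 0<ε = weaken (λ {n} h → drop (seq x n) (seq y n) {η} {ε} h (ℚ.<⇒≤ 0<η) (ℚ.<⇒≤ 0<ε)) sep

  -- If `y` exceeds `z` by a gap η, then `x` cannot exceed zero by a gap θ, since the products would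
  -- be θ η apart. So `x ≤ℝ 0ℝ`, which is excluded.
  *ℝ-cancelˡ-≤ : ∀ x y z → ¬ x ≤ℝ 0ℝ → x *ℝ y ≤ℝ x *ℝ z → y ≤ℝ z
  *ℝ-cancelˡ-≤ x y z x≰0 xy≤xz ε 0<ε =
    [ id , (λ sep → contradiction (x≤0 sep) x≰0) ]′ (compare y z ε 0<ε)
    where
    scale : ∀ p q r {θ η} → 0ℚ < θ → 0ℚ < η → 0ℚ + θ ≤ p → r + η ≤ q → p * r + θ * η ≤ p * q
    scale p q r {θ} {η} 0<θ 0<η θ≤p r+η≤q = by-slack ((p - (0ℚ + θ)) * η + p * (q - (r + η)))
      (+-nonNegℚ (*-nonNegℚ (0≤gap θ≤p) (ℚ.<⇒≤ 0<η))
        (*-nonNegℚ (ℚ.≤-trans (ℚ.≤-trans (ℚ.<⇒≤ 0<θ) (ℚ.≤-reflexive (sym (ℚ.+-identityˡ θ)))) θ≤p) (0≤gap r+η≤q)))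
      (solve 5 (λ p q r θ η → p :* r :+ θ :* η :+ ((p :- (con 0ℚ :+ θ)) :* η :+ p :* (q :- (r :+ η))) := p :* q)
        refl p q r θ η)
    x≤0 : (∃[ η ] (0ℚ < η × Eventually λ n → seq z n + η ≤ seq y n)) → x ≤ℝ 0ℝ
    x≤0 (η , 0<η , z+η≤y) ε′ 0<ε′ = [ id , (λ (θ , 0<θ , θ≤x) → contradiction xy≤xz (separated⇒≰ (x *ℝ y) (x *ℝ z)
        (θ * η , *-posℚ 0<θ 0<η ,
         weaken (λ {n} (p , q) → scale (seq x n) (seq y n) (seq z n) {θ} {η} 0<θ 0<η p q) (both θ≤x z+η≤y)))) ]′
      (compare x 0ℝ ε′ 0<ε′)

  ℝ-isStableOrderedSemiring : IsStableOrderedSemiring _≃_ _≤ℝ_ _+ℝ_ _*ℝ_ 0ℝ 1ℝ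
  ℝ-isStableOrderedSemiring = record
    { isCommutativeSemiring = ℝ-isCommutativeSemiring
    ; isPartialOrder = ≤ℝ-isPartialOrder
    ; +-mono-≤       = λ {w} {x} {y} {z} → +ℝ-mono-≤ w x y z
    ; +-cancelʳ-≤    = λ z {x} {y} → +ℝ-cancelʳ-≤ z x y
    ; 0≤1            = pointwise-≤ 0ℝ 1ℝ λ _ → ℚ.nonNegative⁻¹ 1ℚ
    ; *-monoˡ-≤      = λ {x} {y} {z} → *ℝ-monoˡ-≤ x y z
    ; *-cancelˡ-≤    = λ {x} {y} {z} → *ℝ-cancelˡ-≤ x y z
    ; difference     = λ {x} {y} _ → y +ℝ fromℚ (- 1ℚ) *ℝ x ,
        pointwise-≃ (x +ℝ (y +ℝ fromℚ (- 1ℚ) *ℝ x)) y λ n →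
          solve 2 (λ x y → x :+ (y :+ con (- 1ℚ) :* x) := y) refl (seq x n) (seq y n)
    ; ≤-stable       = λ {x} {y} → ≤ℝ-stable x y
    ; ≤-total        = ≤ℝ-total
    }

-- From eigenvectors to nonnegative vectors, the quadratic equation, and the theorem.

module SpectralRadii where

  open EdgeBound using (module Adjacency)
  open Books
  open Reals
  open Comparisons
  open import Data.Fin.Base using (Fin; zero; suc)
  open import Data.Integer.Base using (+_)
  import Data.Integer.Base as ℤ
  import Data.Integer.Properties as ℤ
  import Data.Nat.Base as ℕ
  import Data.Nat.Properties as ℕ
  open import Data.Nat.Base using (ℕ; _∸_)
  open import Data.Nat.Tactic.RingSolver using (solve-∀)
  open import Data.Product.Base using (_×_; _,_; proj₂)
  open import Data.Sum.Base using (_⊎_; inj₁; inj₂)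
  open import Data.Rational.Base as ℚ hiding (_≃_)
  import Data.Rational.Properties as ℚ
  open import Data.Rational.Solver using (module +-*-Solver)
  import Data.Rational.Unnormalised.Base as ℚᵘ
  import Data.Rational.Unnormalised.Properties as ℚᵘ
  open import Function.Base using (_∘_)
  open import Function.Bundles using (_⇔_; mk⇔; Equivalence)
  open import Relation.Binary.PropositionalEquality
  open import Relation.Nullary.Decidable using (yes; no)
  open import Relation.Binary.Structures using (IsEquivalence)
  open import Relation.Nullary.Negation using (¬_)

  ιℝ : ℕ → ℝ
  ιℝ ℕ.zero    = 0ℝ
  ιℝ (ℕ.suc m) = 1ℝ +ℝ ιℝ m

  ≃-trans : ∀ x y z → x ≃ y → y ≃ z → x ≃ z
  ≃-trans x y z = IsEquivalence.trans ≃-isEquivalence {x} {y} {z}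


  ∣p∣≤∣q∣+∣p-q∣ : ∀ p q → ∣ p ∣ ≤ ∣ q ∣ + ∣ p - q ∣
  ∣p∣≤∣q∣+∣p-q∣ p q = subst (λ t → ∣ t ∣ ≤ ∣ q ∣ + ∣ p - q ∣)
    (solve 2 (λ p q → q :+ (p :- q) := p) refl p q) (ℚ.∣p+q∣≤∣p∣+∣q∣ q (p - q))
    where open +-*-Solver

  ∣∣p∣-∣q∣∣≤ : ∀ p q {ε} → ∣ p - q ∣ ≤ ε → ∣ ∣ p ∣ - ∣ q ∣ ∣ ≤ ε
  ∣∣p∣-∣q∣∣≤ p q {ε} h = ≤⇒∣p-q∣≤ ∣ p ∣ ∣ q ∣ ε
    (ℚ.≤-trans (∣p∣≤∣q∣+∣p-q∣ p q) (ℚ.+-monoʳ-≤ ∣ q ∣ h))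
    (ℚ.≤-trans (∣p∣≤∣q∣+∣p-q∣ q p) (ℚ.+-monoʳ-≤ ∣ p ∣ (subst (_≤ ε) (∣p-q∣≡∣q-p∣ p q) h)))

  ∣_∣ℝ : ℝ → ℝ
  ∣ x ∣ℝ = mkℝ (λ n → ∣ seq x n ∣) λ ε 0<ε → let N , h = cauchy x ε 0<ε in
    N , λ {m} {n} m≥ n≥ → ∣∣p∣-∣q∣∣≤ (seq x m) (seq x n) (h m≥ n≥)

  ∣∣ℝ-cong : ∀ x y → x ≃ y → ∣ x ∣ℝ ≃ ∣ y ∣ℝ
  ∣∣ℝ-cong x y x≃y ε 0<ε = weaken (λ {n} → ∣∣p∣-∣q∣∣≤ (seq x n) (seq y n)) (x≃y ε 0<ε)

  ∣∣ℝ-nonNeg : ∀ x → 0ℝ ≤ℝ ∣ x ∣ℝ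
  ∣∣ℝ-nonNeg x = pointwise-≤ 0ℝ ∣ x ∣ℝ λ n → ℚ.0≤∣p∣ (seq x n)

  ∣x∣ℝ≤0⇒x≃0 : ∀ x → ∣ x ∣ℝ ≤ℝ 0ℝ → x ≃ 0ℝ
  ∣x∣ℝ≤0⇒x≃0 x h ε 0<ε = weaken
    (λ {n} → subst₂ _≤_ (cong ∣_∣ (sym (ℚ.+-identityʳ (seq x n)))) (ℚ.+-identityˡ ε)) (h ε 0<ε)

  ∣∣ℝ-sum : ∀ {n} (f : Fin n → ℝ) → ∣ sumℝ f ∣ℝ ≤ℝ sumℝ (λ i → ∣ f i ∣ℝ)
  ∣∣ℝ-sum {ℕ.zero}  f = pointwise-≤ ∣ 0ℝ ∣ℝ 0ℝ λ _ → ℚ.≤-refl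
  ∣∣ℝ-sum {ℕ.suc n} f = ≤ℝ-trans ∣ f zero +ℝ rest ∣ℝ (∣ f zero ∣ℝ +ℝ ∣ rest ∣ℝ) (∣ f zero ∣ℝ +ℝ restAbs)
    (pointwise-≤ ∣ f zero +ℝ rest ∣ℝ (∣ f zero ∣ℝ +ℝ ∣ rest ∣ℝ) λ k → ℚ.∣p+q∣≤∣p∣+∣q∣ (seq (f zero) k) (seq rest k))
    (+ℝ-mono-≤ ∣ f zero ∣ℝ ∣ f zero ∣ℝ ∣ rest ∣ℝ restAbs (pointwise-≤ ∣ f zero ∣ℝ ∣ f zero ∣ℝ λ _ → ℚ.≤-refl) (∣∣ℝ-sum (f ∘ suc)))
    where
    rest    = sumℝ (f ∘ suc)
    restAbs = sumℝ λ i → ∣ f (suc i) ∣ℝ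

  sumℝ-cong : ∀ {n} (f g : Fin n → ℝ) → (∀ i → f i ≃ g i) → sumℝ f ≃ sumℝ g
  sumℝ-cong {ℕ.zero}  f g f≃g = pointwise-≃ 0ℝ 0ℝ λ _ → refl
  sumℝ-cong {ℕ.suc n} f g f≃g = +ℝ-cong {f zero} {g zero} {sumℝ (f ∘ suc)} {sumℝ (g ∘ suc)}
    (f≃g zero) (sumℝ-cong (f ∘ suc) (g ∘ suc) (f≃g ∘ suc))

  private
    -- Relates a matrix entry to its counterpart in ℕ case by case, because `ιℝ 1` is `1ℝ +ℝ 0ℝ` and
    -- agrees with `1ℝ` only termwise.
    Indicates : ℝ → ℕ → Set
    Indicates c k = (c ≡ 1ℝ × k ≡ 1) ⊎ (c ≡ 0ℝ × k ≡ 0)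

    indicates-* : ∀ c k → Indicates c k → ∀ x → c *ℝ x ≃ ιℝ k *ℝ x
    indicates-* _ _ (inj₁ (refl , refl)) x = pointwise-≃ (1ℝ *ℝ x) (ιℝ 1 *ℝ x) λ n →
      cong (_* seq x n) (sym (ℚ.+-identityʳ 1ℚ))
    indicates-* _ _ (inj₂ (refl , refl)) x = pointwise-≃ (0ℝ *ℝ x) (ιℝ 0 *ℝ x) λ n → refl

    ∣indicates-*∣ : ∀ c k → Indicates c k → ∀ x → ∣ c *ℝ x ∣ℝ ≃ ιℝ k *ℝ ∣ x ∣ℝ
    ∣indicates-*∣ _ _ (inj₁ (refl , refl)) x = pointwise-≃ ∣ 1ℝ *ℝ x ∣ℝ (ιℝ 1 *ℝ ∣ x ∣ℝ) λ n →
      trans (ℚ.∣p*q∣≡∣p∣*∣q∣ 1ℚ (seq x n)) (cong (_* ∣ seq x n ∣) (sym (ℚ.+-identityʳ 1ℚ)))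
    ∣indicates-*∣ _ _ (inj₂ (refl , refl)) x = pointwise-≃ ∣ 0ℝ *ℝ x ∣ℝ (ιℝ 0 *ℝ ∣ x ∣ℝ) λ n →
      ℚ.∣p*q∣≡∣p∣*∣q∣ 0ℚ (seq x n)

  module _ {n} (G : Graph (Fin n)) where
    open Graph G

    private
      entry : ∀ i j → Indicates (adjacencyMatrix G i j) (Adjacency.a G i j)
      entry i j with adj? i j
      ... | yes _ = inj₁ (refl , refl)
      ... | no  _ = inj₂ (refl , refl)

    *ᵥ≃∙ : ∀ x i → (adjacencyMatrix G *ᵥ x) i ≃ sumℝ (λ j → ιℝ (Adjacency.a G i j) *ℝ x j)
    *ᵥ≃∙ x i = sumℝ-cong (λ j → adjacencyMatrix G i j *ℝ x j) (λ j → ιℝ (Adjacency.a G i j) *ℝ x j)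
      λ j → indicates-* (adjacencyMatrix G i j) (Adjacency.a G i j) (entry i j) (x j)

    -- The triangle inequality: ρ |v| ≤ |ρ v| = |A v| ≤ A |v|, whatever the sign of `ρ`.
    ∣eigenvector∣ : ∀ ρ v → (∀ i → (adjacencyMatrix G *ᵥ v) i ≃ ρ *ℝ v i) →
      ∀ i → ρ *ℝ ∣ v i ∣ℝ ≤ℝ sumℝ (λ j → ιℝ (Adjacency.a G i j) *ℝ ∣ v j ∣ℝ)
    ∣eigenvector∣ ρ v eig i =
      ≤ℝ-trans (ρ *ℝ ∣ v i ∣ℝ) ∣ ρ *ℝ v i ∣ℝ rhs
        (pointwise-≤ (ρ *ℝ ∣ v i ∣ℝ) ∣ ρ *ℝ v i ∣ℝ λ k → bound (seq ρ k) (seq (v i) k))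
      (≤ℝ-trans ∣ ρ *ℝ v i ∣ℝ ∣ Av ∣ℝ rhs
        (≃⇒≥ ∣ Av ∣ℝ ∣ ρ *ℝ v i ∣ℝ (∣∣ℝ-cong Av (ρ *ℝ v i) (eig i)))
      (≤ℝ-trans ∣ Av ∣ℝ (sumℝ λ j → ∣ adjacencyMatrix G i j *ℝ v j ∣ℝ) rhs
        (∣∣ℝ-sum λ j → adjacencyMatrix G i j *ℝ v j)
        (≃⇒≤ (sumℝ λ j → ∣ adjacencyMatrix G i j *ℝ v j ∣ℝ) rhs
          (sumℝ-cong (λ j → ∣ adjacencyMatrix G i j *ℝ v j ∣ℝ) (λ j → ιℝ (Adjacency.a G i j) *ℝ ∣ v j ∣ℝ)
            λ j → ∣indicates-*∣ (adjacencyMatrix G i j) (Adjacency.a G i j) (entry i j) (v j)))))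
      where
      Av = (adjacencyMatrix G *ᵥ v) i
      rhs = sumℝ λ j → ιℝ (Adjacency.a G i j) *ℝ ∣ v j ∣ℝ
      bound : ∀ p q → p * ∣ q ∣ ≤ ∣ p * q ∣
      bound p q = ℚ.≤-trans (ℚ.*-monoʳ-≤-nonNeg ∣ q ∣ {{nonNegative (ℚ.0≤∣p∣ q)}} (p≤∣p∣ p))
        (ℚ.≤-reflexive (sym (ℚ.∣p*q∣≡∣p∣*∣q∣ p q)))

  /1-suc : ∀ m → + ℕ.suc m / 1 ≡ 1ℚ + + m / 1
  /1-suc m = ℚ.toℚᵘ-injective (ℚᵘ.≃-trans (ℚ.toℚᵘ-fromℚᵘ (ℚᵘ.mkℚᵘ (+ ℕ.suc m) 0))
    (ℚᵘ.≃-trans (ℚᵘ.*≡* (cong (λ t → (ℤ.1ℤ ℤ.+ t) ℤ.* ℤ.1ℤ) (sym (ℤ.*-identityʳ (+ m)))))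
    (ℚᵘ.≃-trans (ℚᵘ.+-congʳ (toℚᵘ 1ℚ) (ℚᵘ.≃-sym (ℚ.toℚᵘ-fromℚᵘ (ℚᵘ.mkℚᵘ (+ m) 0))))
    (ℚᵘ.≃-sym (ℚ.toℚᵘ-homo-+ 1ℚ (+ m / 1))))))

  seq-ι : ∀ m k → seq (ιℝ m) k ≡ + m / 1
  seq-ι ℕ.zero    k = refl
  seq-ι (ℕ.suc m) k = trans (cong (λ x → 1ℚ + x) (seq-ι m k)) (sym (/1-suc m))

  /1-nonNeg : ∀ m → 0ℚ ≤ + m / 1
  /1-nonNeg ℕ.zero    = ℚ.≤-refl
  /1-nonNeg (ℕ.suc m) = subst (0ℚ ≤_) (sym (/1-suc m)) (+-nonNegℚ (ℚ.nonNegative⁻¹ 1ℚ) (/1-nonNeg m))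

  module _ (n : ℕ) (3≤n : 3 ℕ.≤ n) where
    private
      t : ℚ
      t = + (2 ℕ.* (n ∸ 2)) / 1

    -- A quarter of the discriminant of λ² - λ = 2 (n - 2).
    radicand≡ : + (2 ℕ.* n) / 1 - + 15 / 4 ≡ + (2 ℕ.* (n ∸ 2)) / 1 + + 1 / 4
    radicand≡ = trans (cong (λ m → + m / 1 - + 15 / 4) 2n≡) (trans (cong (_- + 15 / 4) four+) (simplify t))
      where
      open +-*-Solver
      double : ∀ m → 2 ℕ.* (2 ℕ.+ m) ≡ 4 ℕ.+ 2 ℕ.* m
      double = solve-∀
      2n≡ : 2 ℕ.* n ≡ 4 ℕ.+ 2 ℕ.* (n ∸ 2)
      2n≡ = trans (cong (2 ℕ.*_) (sym (ℕ.m+[n∸m]≡n (ℕ.≤-trans (ℕ.n≤1+n 2) 3≤n)))) (double (n ∸ 2))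
      m = 2 ℕ.* (n ∸ 2)
      four+ : + (4 ℕ.+ m) / 1 ≡ 1ℚ + (1ℚ + (1ℚ + (1ℚ + t)))
      four+ = trans (/1-suc (3 ℕ.+ m)) (cong (λ x → 1ℚ + x) (trans (/1-suc (2 ℕ.+ m)) (cong (λ x → 1ℚ + x)
        (trans (/1-suc (1 ℕ.+ m)) (cong (λ x → 1ℚ + x) (/1-suc m))))))
      simplify : ∀ t → 1ℚ + (1ℚ + (1ℚ + (1ℚ + t))) - + 15 / 4 ≡ t + + 1 / 4
      simplify = solve 1 (λ t → con 1ℚ :+ (con 1ℚ :+ (con 1ℚ :+ (con 1ℚ :+ t))) :- con (+ 15 / 4) := t :+ con (+ 1 / 4)) refl

    -- This is where n ≥ 3 makes the square root exceed 1, so that `ν` below is positive.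
    2<radicand : 1ℚ + 1ℚ < + (2 ℕ.* n) / 1 - + 15 / 4
    2<radicand = subst (1ℚ + 1ℚ <_) (sym radicand≡) (ℚ.≤-<-trans 2≤t
      (subst (_< t + + 1 / 4) (ℚ.+-identityʳ t) (ℚ.+-monoʳ-< t (ℚ.positive⁻¹ (+ 1 / 4)))))
      where
      k = 2 ℕ.* (n ∸ 2) ∸ 2
      2≤2[n∸2] : 2 ℕ.≤ 2 ℕ.* (n ∸ 2)
      2≤2[n∸2] = ℕ.*-monoʳ-≤ 2 (ℕ.∸-monoˡ-≤ 2 3≤n)
      2≤t : 1ℚ + 1ℚ ≤ t
      2≤t = by-slack (+ k / 1) (/1-nonNeg k) (trans (ℚ.+-assoc 1ℚ 1ℚ (+ k / 1))
        (trans (sym (trans (/1-suc (1 ℕ.+ k)) (cong (λ x → 1ℚ + x) (/1-suc k)))) (cong (λ m → + m / 1) (ℕ.m+[n∸m]≡n 2≤2[n∸2]))))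

    0≤radicand : 0ℚ ≤ + (2 ℕ.* n) / 1 - + 15 / 4
    0≤radicand = ℚ.≤-trans (ℚ.nonNegative⁻¹ (1ℚ + 1ℚ)) (ℚ.<⇒≤ 2<radicand)

  -- With ν = r - 1/2 and μ = r + 1/2 one has 1 + ν = μ and μ ν = r² - 1/4 = 2 (n - 2).
  module LargerRoot (n : ℕ) (q : ℚ) (q≡ : q ≡ + (2 ℕ.* (n ∸ 2)) / 1 + + 1 / 4) (2<q : 1ℚ + 1ℚ < q)
    (r : ℝ) (0≤r : 0ℝ ≤ℝ r) (r² : r *ℝ r ≃ fromℚ q) where

    open +-*-Solver

    r≰1 : ¬ r ≤ℝ 1ℝ
    r≰1 r≤1 = ℚ.<-irrefl refl (ℚ.<-≤-trans 2<q (proj₂ (q≤1 1ℚ (ℚ.positive⁻¹ 1ℚ)) ℕ.≤-refl))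
      where
      q≤1 : fromℚ q ≤ℝ 1ℝ
      q≤1 = ≤ℝ-trans (fromℚ q) (r *ℝ r) 1ℝ (≃⇒≥ (r *ℝ r) (fromℚ q) r²)
        (≤ℝ-trans (r *ℝ r) (r *ℝ 1ℝ) 1ℝ (*ℝ-monoˡ-≤ r r 1ℝ 0≤r r≤1)
          (≤ℝ-trans (r *ℝ 1ℝ) r 1ℝ (pointwise-≤ (r *ℝ 1ℝ) r λ k → ℚ.≤-reflexive (ℚ.*-identityʳ (seq r k))) r≤1))

    1+ν≃μ : 1ℝ +ℝ (fromℚ (- ½) +ℝ r) ≃ fromℚ ½ +ℝ r
    1+ν≃μ = pointwise-≃ (1ℝ +ℝ (fromℚ (- ½) +ℝ r)) (fromℚ ½ +ℝ r) λ k → shift (seq r k)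
      where
      shift : ∀ p → 1ℚ + (- ½ + p) ≡ ½ + p
      shift = solve 1 (λ p → con 1ℚ :+ (con (- ½) :+ p) := con ½ :+ p) refl

    ν>0 : ¬ fromℚ (- ½) +ℝ r ≤ℝ 0ℝ
    ν>0 h = r≰1 (≤ℝ-trans r (fromℚ (- ½) +ℝ r +ℝ fromℚ ½) 1ℝ
      (pointwise-≤ r (fromℚ (- ½) +ℝ r +ℝ fromℚ ½) λ k → ℚ.≤-reflexive (shift (seq r k)))
      (≤ℝ-trans (fromℚ (- ½) +ℝ r +ℝ fromℚ ½) (0ℝ +ℝ 1ℝ) 1ℝ
        (+ℝ-mono-≤ (fromℚ (- ½) +ℝ r) 0ℝ (fromℚ ½) 1ℝ h (pointwise-≤ (fromℚ ½) 1ℝ λ _ → ½≤1))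
        (pointwise-≤ (0ℝ +ℝ 1ℝ) 1ℝ λ _ → ℚ.≤-reflexive (ℚ.+-identityˡ 1ℚ))))
      where
      shift : ∀ p → p ≡ - ½ + p + ½
      shift = solve 1 (λ p → p := con (- ½) :+ p :+ con ½) refl
      ½≤1 : ½ ≤ 1ℚ
      ½≤1 = by-slack ½ (ℚ.nonNegative⁻¹ ½) refl

    root-equation : (1ℝ +ℝ (fromℚ (- ½) +ℝ r)) *ℝ (fromℚ (- ½) +ℝ r) ≃ ιℝ (2 ℕ.* (n ∸ 2))
    root-equation = ≃-trans ((1ℝ +ℝ (fromℚ (- ½) +ℝ r)) *ℝ (fromℚ (- ½) +ℝ r)) (r *ℝ r +ℝ c) T
      (pointwise-≃ ((1ℝ +ℝ (fromℚ (- ½) +ℝ r)) *ℝ (fromℚ (- ½) +ℝ r)) (r *ℝ r +ℝ c) λ k → expand (seq r k))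
      (≃-trans (r *ℝ r +ℝ c) (fromℚ q +ℝ c) T
        (+ℝ-cong {r *ℝ r} {fromℚ q} {c} {c} r² (pointwise-≃ c c λ _ → refl))
        (pointwise-≃ (fromℚ q +ℝ c) T λ k → trans (cong (λ x → x + - (+ 1 / 4)) q≡)
          (trans (cancel (+ (2 ℕ.* (n ∸ 2)) / 1)) (sym (seq-ι (2 ℕ.* (n ∸ 2)) k)))))
      where
      c = fromℚ (- (+ 1 / 4))
      T = ιℝ (2 ℕ.* (n ∸ 2))
      expand : ∀ p → (1ℚ + (- ½ + p)) * (- ½ + p) ≡ p * p + - (+ 1 / 4)
      expand = solve 1 (λ p → (con 1ℚ :+ (con (- ½) :+ p)) :* (con (- ½) :+ p) := p :* p :+ con (- (+ 1 / 4))) refl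
      cancel : ∀ t → t + + 1 / 4 + - (+ 1 / 4) ≡ t
      cancel = solve 1 (λ t → t :+ con (+ 1 / 4) :+ con (- (+ 1 / 4)) := t) refl

  module Spectral (n : ℕ) (3≤n : 3 ℕ.≤ n) (G : Graph (Fin n)) (noDCC : ¬ ContainsDoublyChordedCycle G)
    (ν μ : ℝ) (ν>0 : ¬ ν ≤ℝ 0ℝ) (1+ν≃μ : 1ℝ +ℝ ν ≃ μ)
    (root-equation : (1ℝ +ℝ ν) *ℝ ν ≃ ιℝ (2 ℕ.* (n ∸ 2))) where

    open Interface ℝ-isStableOrderedSemiring ιℝ refl (λ _ → refl) sumℝ (λ _ → refl) n 3≤n G noDCC

    module _ {ρ} (v : Fin n → ℝ) (v≢0 : ¬ (∀ i → v i ≃ 0ℝ))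
      (eigen : ∀ i → (adjacencyMatrix G *ᵥ v) i ≃ ρ *ℝ v i) where

      private
        ∣v∣≢0 : ¬ (∀ i → ∣ v i ∣ℝ ≤ℝ 0ℝ)
        ∣v∣≢0 all≤0 = v≢0 λ i → ∣x∣ℝ≤0⇒x≃0 (v i) (all≤0 i)

      eigenvalue-≤ : ρ ≤ℝ μ
      eigenvalue-≤ = subeigenvalue-≤ {ν} {μ} ν>0 1+ν≃μ root-equation {ρ} {λ i → ∣ v i ∣ℝ}
        (λ i → ∣∣ℝ-nonNeg (v i)) ∣v∣≢0 (∣eigenvector∣ G ρ v eigen)

      eigenvalue-≃⇒≅ : ρ ≃ μ → G ≅ completeTripartite 1 1 (n ∸ 2)
      eigenvalue-≃⇒≅ ρ≃μ = Equivalence.to (Book⇔≅K₁₁ₙ₋₂ G)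
        (subeigenvalue-≈⇒Book {ν} {μ} ν>0 1+ν≃μ root-equation {ρ} {λ i → ∣ v i ∣ℝ}
          (λ i → ∣∣ℝ-nonNeg (v i)) ∣v∣≢0 (∣eigenvector∣ G ρ v eigen) ρ≃μ)

    ≅⇒eigenvalue : G ≅ completeTripartite 1 1 (n ∸ 2) → IsEigenvalue (adjacencyMatrix G) μ
    ≅⇒eigenvalue iso =
      let _ , _ , book   = Equivalence.from (Book⇔≅K₁₁ₙ₋₂ G) iso
          x , x≢0 , eig  = Book⇒eigenvector {ν} {μ} ν>0 1+ν≃μ root-equation book
      in x , x≢0 , λ i → ≃-trans ((adjacencyMatrix G *ᵥ x) i) (sumℝ λ j → ιℝ (Adjacency.a G i j) *ℝ x j) (μ *ℝ x i)
           (*ᵥ≃∙ G x i) (eig i)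

  -- Stated for any r with r² = q, because unfolding √ during conversion is too costly.
  spectralRadius : ∀ n → 3 ℕ.≤ n → (G : Graph (Fin n)) → ¬ ContainsDoublyChordedCycle G →
    ∀ q → q ≡ + (2 ℕ.* (n ∸ 2)) / 1 + + 1 / 4 → 1ℚ + 1ℚ < q → ∀ r → 0ℝ ≤ℝ r → r *ℝ r ≃ fromℚ q →
    ∀ ρ → IsSpectralRadius G ρ →
    (ρ ≤ℝ fromℚ ½ +ℝ r) × ((ρ ≃ fromℚ ½ +ℝ r) ⇔ (G ≅ completeTripartite 1 1 (n ∸ 2)))
  spectralRadius n 3≤n G noDCC q q≡ 2<q r 0≤r r² ρ ((v , v≢0 , eigen) , maximal) =
    ρ≤μ , mk⇔ (eigenvalue-≃⇒≅ {ρ} v v≢0 eigen)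
      -- For the tripartite graph the bound is itself an eigenvalue, so maximality of `ρ` gives the
      -- reverse inequality.
      (λ iso → ≤ℝ-antisym ρ (fromℚ ½ +ℝ r) ρ≤μ (maximal (fromℚ ½ +ℝ r) (≅⇒eigenvalue iso)))
    where
    open LargerRoot n q q≡ 2<q r 0≤r r²
    open Spectral n 3≤n G noDCC (fromℚ (- ½) +ℝ r) (fromℚ ½ +ℝ r) ν>0 1+ν≃μ root-equation
    ρ≤μ : ρ ≤ℝ fromℚ ½ +ℝ r
    ρ≤μ = eigenvalue-≤ {ρ} v v≢0 eigen

open import Data.Fin.Base using (Fin)
open import Data.Integer.Base using (+_)
open import Data.Nat.Base using (ℕ; _≤_; _*_; _∸_)
open import Data.Product.Base using (_×_)
open import Data.Rational.Base using (½; _/_; _-_)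
open import Function.Bundles using (_⇔_)
open import Relation.Nullary.Negation using (¬_)
open SpectralRadii

theorem1p1 : (n : ℕ) → 3 ≤ n → (G : Graph (Fin n)) →
    ¬ ContainsDoublyChordedCycle G →
    (ρ : ℝ) → IsSpectralRadius G ρ →
    (ρ ≤ℝ fromℚ ½ +ℝ √ (+ (2 * n) / 1 - + 15 / 4)) ×
    ((ρ ≃ fromℚ ½ +ℝ √ (+ (2 * n) / 1 - + 15 / 4)) ⇔ (G ≅ completeTripartite 1 1 (n ∸ 2)))
theorem1p1 n 3≤n G noDCC = spectralRadius n 3≤n G noDCC (+ (2 * n) / 1 - + 15 / 4)
  (radicand≡ n 3≤n) (2<radicand n 3≤n) (√ (+ (2 * n) / 1 - + 15 / 4))
  (√-nonNeg (+ (2 * n) / 1 - + 15 / 4))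
  (√-square (+ (2 * n) / 1 - + 15 / 4) (0≤radicand n 3≤n))
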